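{- $L(12453)=(1+\sqrt{8})^2=9+4\sqrt{2}$.
   Context: A permutation $p=p_1\cdots p_n$ of $[n]=\{1,\dots,n\}$ contains a pattern $q=q_1\cdots q_k$ (a permutation of $[k]$) if there are indices $i_1<\dots<i_k$ with $p_{i_a}<p_{i_b}$ iff $q_a<q_b$; otherwise $p$ avoids $q$. $S_n(q)$ denotes the number of permutations of length $n$ avoiding $q$, and $L(q)=\lim_{n\to\infty}\sqrt[n]{S_n(q)}$ (this limit is known to exist for every pattern $q$). -}

module Defs where

open import Data.Bool using (Bool; true; false; _∧_; not; if_then_else_)
open import Data.Nat using (ℕ; zero; suc; _+_; _*_; _∸_; _^_; _≤_; _<_; _<ᵇ_; _≡ᵇ_)
open import Data.List using (List; []; _∷_; map; length; upTo; concatMap; filterᵇ; zip)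
open import Data.Bool.ListAction using (all; any)
open import Data.Product using (_×_; _,_; proj₁; proj₂; Σ; ∃)
open import Data.Sum using (_⊎_)

-- Permutations of length n are encoded as lists of values in {0,…,n-1}
-- with pairwise distinct entries (only relative order matters for patterns).

words : ℕ → ℕ → List (List ℕ)
words zero    k = [] ∷ []
words (suc n) k = concatMap (λ x → map (x ∷_) (words n k)) (upTo k)

notIn : ℕ → List ℕ → Bool
notIn x xs = all (λ y → not (x ≡ᵇ y)) xs

distinct : List ℕ → Bool
distinct []       = true
distinct (x ∷ xs) = notIn x xs ∧ distinct xs

perms : ℕ → List (List ℕ)
perms n = filterᵇ distinct (words n n)

subseqs : ℕ → List ℕ → List (List ℕ)
subseqs zero    _        = [] ∷ []
subseqs (suc k) []       = []
subseqs (suc k) (x ∷ xs) = map (x ∷_) (subseqs k xs) Data.List.++ subseqs (suc k) xs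

_⇔ᵇ_ : Bool → Bool → Bool
true  ⇔ᵇ b = b
false ⇔ᵇ b = not b

orderIso : List ℕ → List ℕ → Bool
orderIso xs ys =
  (length xs ≡ᵇ length ys) ∧
  all (λ u → all (λ v → (proj₁ u <ᵇ proj₁ v) ⇔ᵇ (proj₂ u <ᵇ proj₂ v)) (zip xs ys)) (zip xs ys)

contains : List ℕ → List ℕ → Bool
contains p q = any (λ s → orderIso s q) (subseqs (length q) p)

S : List ℕ → ℕ → ℕ
S q n = length (filterᵇ (λ p → not (contains p q)) (perms n))

q12453 : List ℕ
q12453 = 1 ∷ 2 ∷ 4 ∷ 5 ∷ 3 ∷ []

-- Comparisons of a positive rational a/b (b ≥ 1) with 9 + 4√2 = 9 + √32,
-- written with natural-number arithmetic only.
-- a/b < 9+√32  iff  a < 9b  or  (a - 9b)² < 32 b²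
BelowL : ℕ → ℕ → Set
BelowL a b = (a < 9 * b) ⊎ ((a ∸ 9 * b) * (a ∸ 9 * b) < 32 * (b * b))

AboveL : ℕ → ℕ → Set
AboveL a b = (9 * b < a) × (32 * (b * b) < (a ∸ 9 * b) * (a ∸ 9 * b))

-- lim_{n→∞} (x n)^{1/n} = 9+4√2, expressed via rational bounds:
-- for every rational a/b below the limit, eventually (a/b)^n ≤ x n,
-- and for every rational a/b above it, eventually x n ≤ (a/b)^n.
-- (Since x n ≥ 0, only positive rationals need to be considered.)
NthRootLimitIs9+4√2 : (ℕ → ℕ) → Set
NthRootLimitIs9+4√2 x =
  ((a b : ℕ) → 1 ≤ a → 1 ≤ b → BelowL a b →
     ∃ λ N → (n : ℕ) → N ≤ n → a ^ n ≤ x n * b ^ n)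
  × ((a b : ℕ) → 1 ≤ b → AboveL a b →
     ∃ λ N → (n : ℕ) → N ≤ n → x n * b ^ n ≤ a ^ n)

{-# OPTIONS --safe #-}
module Submission where

-- A permutation avoids 12453 iff its entries other than the left-to-right minima avoid 1342. Recording the
-- positions and the values of the minima bounds S_n(12453) by Σ_k C(n,k)² S_{n-k}(1342), which grows like
-- (1 + √8)^{2n} if S_n(1342) grows like 8^n. Conversely, cut a skew sum of 1342-avoiders of equal length
-- into blocks; entries inserted at positions inside one block and at values inside the next one are
-- left-to-right minima, so that nearly as many 12453-avoiders arise.
--
-- For 1342, build permutations by prepending entries. Let N(u) be the series of 1342-avoiders in which u
-- marks the number of largest entries that together avoid 231. With H = N(1), it satisfies
-- H (u-1) (N-1) + x H u N = x u² N², which is symmetric in u and N. Hence the orbit u_0 = 1,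
-- u_{k+1} = N(u_k) obeys a second-order recurrence; for R_k = (1 - 1/u_k) / x it reads
-- R_k = 1 + x R_k (R_{k-1} + R_{k+1}) with R_0 = 0, the equation of plane trees with positive labels that
-- differ by one along each edge. These grow like the solution of C = 1 + 2 x C², that is, like 8^n.

-- The square in (1 + √8)² comes from choosing positions and values independently: up to a factor n
-- + 1, the sum Σ_k C(n,k)² 8^(n-k) is the square of Σ_k C(n,k) √8^(n-k) = (1 + √8)^n. As √8 is
-- irrational, both estimates are made for rationals c / d on one side of it. In the lower bound,
-- freely chosen positions and values need not produce minima. Drawing the values from the following
-- block puts them below everything that stands before them. Each block loses a factor polynomial in
-- its length, and blocks that are long enough outweigh this loss. The rate 8 is obtained without a
-- closed form and without analysis, from truncated sums at rational points. At x = 1/8, the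
-- equation C = 1 + 2 x C² has the double root 2, which bounds every R_k. For x > 1/8 it has no real
-- root, so the truncated values of R_k exceed any bound once k is large. Some R_k then satisfies a
-- renewal equation of total mass at least 1, which forces its coefficients to grow at the rate 1 /
-- x, and h inherits this growth.

open import Defs

-- Formal power series over the integers.

module PowerSeries where

  open import Algebra.Bundles using (CommutativeRing)
  open import Data.Nat.Base as ℕ using (ℕ; zero; suc; s≤s; z≤n)
  import Data.Nat.Properties as ℕ
  open import Data.Integer.Base using (ℤ; +_; 0ℤ; 1ℤ; _+_; _*_; -_)
  import Data.Integer.Properties as ℤ
  open import Data.Integer.Tactic.RingSolver using (solve-∀)
  open import Data.Maybe.Base using (Maybe; just; nothing)
  open import Data.Product.Base using (_,_)
  open import Level using (0ℓ)
  open import Relation.Binary.PropositionalEquality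
  open import Relation.Nullary.Decidable using (yes; no)
  import Algebra.Solver.Ring
  open import Algebra.Solver.Ring.AlmostCommutativeRing using (fromCommutativeRing; _-Raw-AlmostCommutative⟶_)

  Series : Set
  Series = ℕ → ℤ

  infix 4 _≋_
  _≋_ : Series → Series → Set
  f ≋ g = ∀ n → f n ≡ g n

  tail : Series → Series
  tail f n = f (suc n)

  const : ℤ → Series
  const z zero    = z
  const z (suc _) = 0ℤ

  𝟘 𝟙 X : Series
  𝟘 _ = 0ℤ
  𝟙 = const 1ℤ
  X zero    = 0ℤ
  X (suc n) = 𝟙 n

  infixl 6 _⊕_
  infixl 7 _⊗_

  _⊕_ _⊗_ : Series → Series → Series
  (f ⊕ g) n = f n + g n
  (f ⊗ g) zero    = f 0 * g 0
  (f ⊗ g) (suc n) = f 0 * g (suc n) + (tail f ⊗ g) n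

  ⊖_ : Series → Series
  (⊖ f) n = - f n

  scale : ℤ → Series → Series
  scale z f n = z * f n

  ⊗-cong : ∀ {f f′ g g′} → f ≋ f′ → g ≋ g′ → f ⊗ g ≋ f′ ⊗ g′
  ⊗-cong p q zero    = cong₂ _*_ (p 0) (q 0)
  ⊗-cong p q (suc n) = cong₂ _+_ (cong₂ _*_ (p 0) (q (suc n))) (⊗-cong (λ i → p (suc i)) q n)

  ⊗-congˡ : ∀ f {g g′} → g ≋ g′ → f ⊗ g ≋ f ⊗ g′
  ⊗-congˡ f = ⊗-cong {f} (λ _ → refl)

  ⊕-cong : ∀ {f f′ g g′} → f ≋ f′ → g ≋ g′ → f ⊕ g ≋ f′ ⊕ g′
  ⊕-cong p q n = cong₂ _+_ (p n) (q n)

  ⊕-congˡ : ∀ f {g g′} → g ≋ g′ → f ⊕ g ≋ f ⊕ g′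
  ⊕-congˡ f p n = cong (_+_ (f n)) (p n)

  ⊕-congʳ : ∀ g {f f′} → f ≋ f′ → f ⊕ g ≋ f′ ⊕ g
  ⊕-congʳ g p n = cong (λ z → z + g n) (p n)

  ≋-sym : ∀ {f g} → f ≋ g → g ≋ f
  ≋-sym p n = sym (p n)

  infixr 5 _⨾_
  _⨾_ : ∀ {f g h} → f ≋ g → g ≋ h → f ≋ h
  (p ⨾ q) n = trans (p n) (q n)

  ⊗-cong-≤ : ∀ {f f′ g g′} n → (∀ i → i ℕ.≤ n → f i ≡ f′ i) → (∀ i → i ℕ.≤ n → g i ≡ g′ i) →
             (f ⊗ g) n ≡ (f′ ⊗ g′) n
  ⊗-cong-≤ zero    p q = cong₂ _*_ (p 0 z≤n) (q 0 z≤n)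
  ⊗-cong-≤ (suc n) p q = cong₂ _+_ (cong₂ _*_ (p 0 z≤n) (q (suc n) ℕ.≤-refl))
    (⊗-cong-≤ n (λ i l → p (suc i) (s≤s l)) (λ i l → q i (ℕ.m≤n⇒m≤1+n l)))

  ⊗-zeroˡ : ∀ {f} g → f ≋ 𝟘 → f ⊗ g ≋ 𝟘
  ⊗-zeroˡ {f} g p zero rewrite p 0 = refl
  ⊗-zeroˡ {f} g p (suc n) rewrite p 0 | ⊗-zeroˡ g (λ i → p (suc i)) n = refl

  ⊗-distribʳ : ∀ h f g → (f ⊕ g) ⊗ h ≋ f ⊗ h ⊕ g ⊗ h
  ⊗-distribʳ h f g zero    = ℤ.*-distribʳ-+ (h 0) (f 0) (g 0)
  ⊗-distribʳ h f g (suc n) =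
    trans (cong (_+_ ((f 0 + g 0) * h (suc n))) (⊗-distribʳ h (tail f) (tail g) n))
          (rearrange (f 0) (g 0) (h (suc n)) _ _)
    where
    rearrange : ∀ a b c d e → (a + b) * c + (d + e) ≡ (a * c + d) + (b * c + e)
    rearrange = solve-∀

  ⊗-sucʳ : ∀ f g n → (f ⊗ g) (suc n) ≡ f (suc n) * g 0 + (f ⊗ tail g) n
  ⊗-sucʳ f g zero    = ℤ.+-comm (f 0 * g 1) (f 1 * g 0)
  ⊗-sucʳ f g (suc n) =
    trans (cong (_+_ (f 0 * g (suc (suc n)))) (⊗-sucʳ (tail f) g n)) (rearrange (f 0 * g (suc (suc n))) (f (suc (suc n)) * g 0) _)
    where
    rearrange : ∀ a b c → a + (b + c) ≡ b + (a + c)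
    rearrange = solve-∀

  ⊗-comm : ∀ f g → f ⊗ g ≋ g ⊗ f
  ⊗-comm f g zero    = ℤ.*-comm (f 0) (g 0)
  ⊗-comm f g (suc n) =
    trans (cong₂ _+_ (ℤ.*-comm (f 0) (g (suc n))) (⊗-comm (tail f) g n)) (sym (⊗-sucʳ g f n))

  scale-⊗ : ∀ z f g → scale z f ⊗ g ≋ scale z (f ⊗ g)
  scale-⊗ z f g zero    = ℤ.*-assoc z (f 0) (g 0)
  scale-⊗ z f g (suc n) =
    trans (cong (_+_ (z * f 0 * g (suc n))) (scale-⊗ z (tail f) g n)) (rearrange z (f 0) (g (suc n)) _)
    where
    rearrange : ∀ a b c d → a * b * c + a * d ≡ a * (b * c + d)
    rearrange = solve-∀

  ⊗-assoc : ∀ f g h → (f ⊗ g) ⊗ h ≋ f ⊗ (g ⊗ h)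
  ⊗-assoc f g h zero    = ℤ.*-assoc (f 0) (g 0) (h 0)
  ⊗-assoc f g h (suc n) = trans
    (cong (_+_ (f 0 * g 0 * h (suc n)))
      (trans (⊗-distribʳ h (scale (f 0) (tail g)) (tail f ⊗ g) n)
             (cong₂ _+_ (scale-⊗ (f 0) (tail g) h n) (⊗-assoc (tail f) g h n))))
    (rearrange (f 0) (g 0) (h (suc n)) _ _)
    where
    rearrange : ∀ a b c d e → a * b * c + (a * d + e) ≡ a * (b * c + d) + e
    rearrange = solve-∀

  ⊗-identityˡ : ∀ f → 𝟙 ⊗ f ≋ f
  ⊗-identityˡ f zero    = ℤ.*-identityˡ (f 0)
  ⊗-identityˡ f (suc n) =
    trans (cong₂ _+_ (ℤ.*-identityˡ (f (suc n))) (⊗-zeroˡ f (λ _ → refl) n)) (ℤ.+-identityʳ _)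

  X⊗-suc : ∀ f n → (X ⊗ f) (suc n) ≡ f n
  X⊗-suc f n = trans (ℤ.+-identityˡ _) (⊗-identityˡ f n)

  seriesRing : CommutativeRing 0ℓ 0ℓ
  seriesRing = record
    { Carrier = Series ; _≈_ = _≋_ ; _+_ = _⊕_ ; _*_ = _⊗_ ; -_ = ⊖_ ; 0# = 𝟘 ; 1# = 𝟙
    ; isCommutativeRing = record
      { isRing = record
        { +-isAbelianGroup = record
          { isGroup = record
            { isMonoid = record
              { isSemigroup = record
                { isMagma = record
                  { isEquivalence = record
                    { refl = λ _ → refl ; sym = λ p n → sym (p n) ; trans = λ p q n → trans (p n) (q n) }
                  ; ∙-cong = ⊕-cong }
                ; assoc = λ f g h n → ℤ.+-assoc (f n) (g n) (h n) }
              ; identity = (λ f n → ℤ.+-identityˡ (f n)) , (λ f n → ℤ.+-identityʳ (f n)) }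
            ; inverse = (λ f n → ℤ.+-inverseˡ (f n)) , (λ f n → ℤ.+-inverseʳ (f n))
            ; ⁻¹-cong = λ p n → cong -_ (p n) }
          ; comm = λ f g n → ℤ.+-comm (f n) (g n) }
        ; *-cong = ⊗-cong
        ; *-assoc = ⊗-assoc
        ; *-identity = ⊗-identityˡ , (λ f n → trans (⊗-comm f 𝟙 n) (⊗-identityˡ f n))
        ; distrib = (λ f g h n → trans (⊗-comm f (g ⊕ h) n)
                      (trans (⊗-distribʳ f g h n) (cong₂ _+_ (⊗-comm g f n) (⊗-comm h f n))))
                  , ⊗-distribʳ }
      ; *-comm = ⊗-comm } }

  const-+ : ∀ a b → const (a + b) ≋ const a ⊕ const b
  const-+ a b zero    = refl
  const-+ a b (suc n) = refl

  const-* : ∀ a b → const (a * b) ≋ const a ⊗ const b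
  const-* a b zero    = refl
  const-* a b (suc n) = sym (cong₂ _+_ (ℤ.*-zeroʳ a) (⊗-zeroˡ (const b) (λ _ → refl) n))

  const-neg : ∀ a → const (- a) ≋ ⊖ const a
  const-neg a zero    = refl
  const-neg a (suc n) = refl

  -- The solver denotes zero by `const 0ℤ`, which equals `𝟘` only coefficient by coefficient; chains
  -- that end in zero close with this step.
  const-0 : const 0ℤ ≋ 𝟘
  const-0 zero    = refl
  const-0 (suc n) = refl

  private
    constants : CommutativeRing.rawRing ℤ.+-*-commutativeRing
                -Raw-AlmostCommutative⟶ fromCommutativeRing seriesRing
    constants = record
      { ⟦_⟧ = const ; +-homo = const-+ ; *-homo = const-* ; -‿homo = const-neg
      ; 0-homo = const-0 ; 1-homo = λ _ → refl }

    _≟const_ : ∀ a b → Maybe (const a ≋ const b)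
    a ≟const b with a ℤ.≟ b
    ... | yes refl = just (λ _ → refl)
    ... | no  _    = nothing

  module SeriesSolver = Algebra.Solver.Ring
    (CommutativeRing.rawRing ℤ.+-*-commutativeRing) (fromCommutativeRing seriesRing) constants _≟const_

-- The generating tree of the 1342-avoiders.

module Tree where

  open import Data.Bool.Base using (Bool; true; false)
  open import Data.List.Base using (List; []; _∷_; map; length; replicate)
  open import Data.Nat.Base using (suc)

  -- State of a sequence: letter i tells whether its i-th largest entry is a left-to-right maximum, the
  -- length being the largest s for which the s largest entries avoid 231. The sequence obtained by
  -- prepending an entry with c larger ones still avoids 1342 iff c ≤ s; its state is the c-th child.
  Word : Set
  Word = List Bool

  -- The argument holds the letters of the entries below the prepended one, none of which remains a
  -- left-to-right maximum. If the largest of them was one, prepending creates no new obstruction,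
  -- and all letters survive as `false`. If it was not, the new entry, a larger entry that precedes
  -- that largest one, and that largest one itself form a 231, so the state ends at the new letter.
  buried : Word → Word
  buried []          = []
  buried (true ∷ r)  = replicate (suc (length r)) false
  buried (false ∷ r) = []

  children : Word → List Word
  children []      = (true ∷ []) ∷ []
  children (t ∷ w) = (true ∷ buried (t ∷ w)) ∷ map (t ∷_) (children w)

-- Weighted walks in the generating tree.

module Walks where

  open PowerSeries
  open Tree
  open import Data.Bool.Base using (true; false)
  open import Data.Integer.Base using (ℤ; +_; 0ℤ; 1ℤ; _+_)
  import Data.Integer.Properties as ℤ
  open import Data.List.Base using (List; []; _∷_; map; length; replicate)
  open import Data.Nat.Base using (ℕ; zero; suc)
  open import Function.Base using (_∘_)
  open import Relation.Binary.PropositionalEquality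
  open import Algebra.Bundles using (CommutativeRing)
  open SeriesSolver
  open CommutativeRing seriesRing using (zeroʳ)

  private
    variable
      A : Set

  sum : (A → Series) → List A → Series
  sum g []       = 𝟘
  sum g (w ∷ ws) = g w ⊕ sum g ws

  sum-cong : {g h : A → Series} → (∀ w → g w ≋ h w) → ∀ ws → sum g ws ≋ sum h ws
  sum-cong p [] _     = refl
  sum-cong p (w ∷ ws) = ⊕-cong (p w) (sum-cong p ws)

  sum-cong-at : {g h : A → Series} (n : ℕ) → (∀ w → g w n ≡ h w n) → ∀ ws → sum g ws n ≡ sum h ws n
  sum-cong-at n p []       = refl
  sum-cong-at n p (w ∷ ws) = cong₂ _+_ (p w) (sum-cong-at n p ws)

  sum-map : {B : Set} (g : B → Series) (f : A → B) → ∀ ws → sum g (map f ws) ≋ sum (g ∘ f) ws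
  sum-map g f [] _     = refl
  sum-map g f (w ∷ ws) = ⊕-congˡ (g (f w)) (sum-map g f ws)

  sum-linear : ∀ a b (g h : A → Series) ws →
               sum (λ w → a ⊗ g w ⊕ b ⊗ h w) ws ≋ a ⊗ sum g ws ⊕ b ⊗ sum h ws
  sum-linear a b g h []       = ≋-sym (⊕-cong (zeroʳ a) (zeroʳ b))
  sum-linear a b g h (w ∷ ws) =
      ⊕-congˡ (a ⊗ g w ⊕ b ⊗ h w) (sum-linear a b g h ws)
    ⨾ solve 6 (λ a b x y s t → (a :* x :+ b :* y) :+ (a :* s :+ b :* t) := a :* (x :+ s) :+ b :* (y :+ t))
        (λ _ → refl) a b (g w) (h w) (sum g ws) (sum h ws)

  -- Because of the factor `X`, coefficient n + 1 depends, besides the source term, only on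
  -- coefficients n of finitely many unknowns. Identities between walk series follow by checking
  -- that both sides solve the same system.
  guarded-unique : (s : A → Series) (f : A → List A) {Y Z : A → Series} →
                   (∀ i → Y i ≋ s i ⊕ X ⊗ sum Y (f i)) → (∀ i → Z i ≋ s i ⊕ X ⊗ sum Z (f i)) →
                   ∀ i → Y i ≋ Z i
  guarded-unique s f p q i zero = trans (p i 0) (sym (q i 0))
  guarded-unique s f {Y} {Z} p q i (suc n) = begin
    Y i (suc n)                                  ≡⟨ p i (suc n) ⟩
    s i (suc n) + (X ⊗ sum Y (f i)) (suc n)      ≡⟨ cong (_+_ (s i (suc n))) (X⊗-suc (sum Y (f i)) n) ⟩
    s i (suc n) + sum Y (f i) n                  ≡⟨ cong (_+_ (s i (suc n))) (sum-cong-at n (λ j → guarded-unique s f {Y} {Z} p q j n) (f i)) ⟩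
    s i (suc n) + sum Z (f i) n                  ≡⟨ cong (_+_ (s i (suc n))) (X⊗-suc (sum Z (f i)) n) ⟨
    s i (suc n) + (X ⊗ sum Z (f i)) (suc n)      ≡⟨ q i (suc n) ⟨
    Z i (suc n)                                  ∎
    where open ≡-Reasoning

  Weight : Set
  Weight = ℕ → Series

  -- The coefficient of Xⁿ collects the walks with at most n steps: one with i steps ending in a state of
  -- length s contributes the coefficient of degree n - i of φ s.
  walks : Weight → Word → Series
  walks φ w zero    = φ (length w) 0
  walks φ w (suc n) = φ (length w) (suc n) + sum (λ w′ _ → walks φ w′ n) (children w) 0

  walks-step : ∀ φ w → walks φ w ≋ φ (length w) ⊕ X ⊗ sum (walks φ) (children w)
  walks-step φ w zero    = sym (ℤ.+-identityʳ _)
  walks-step φ w (suc n) = cong (_+_ (φ (length w) (suc n))) (trans (at (children w)) (sym (X⊗-suc _ n)))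
    where
    at : ∀ ws → sum (λ w′ _ → walks φ w′ n) ws 0 ≡ sum (walks φ) ws n
    at []       = refl
    at (v ∷ ws) = cong (_+_ (walks φ v n)) (at ws)

  walks-cong : ∀ {φ ψ} → (∀ s → φ s ≋ ψ s) → ∀ w → walks φ w ≋ walks ψ w
  walks-cong {φ} {ψ} p = guarded-unique (λ w → φ (length w)) children (walks-step φ)
    (λ w → walks-step ψ w ⨾ ⊕-congʳ (X ⊗ sum (walks ψ) (children w)) (≋-sym (p (length w))))

  walks-linear : ∀ a b φ ψ w → walks (λ s → a ⊗ φ s ⊕ b ⊗ ψ s) w ≋ a ⊗ walks φ w ⊕ b ⊗ walks ψ w
  walks-linear a b φ ψ = guarded-unique s children (walks-step _) (λ w →
    let S = sum (walks φ) (children w) ; T = sum (walks ψ) (children w) in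
      ⊕-cong (⊗-congˡ a (walks-step φ w)) (⊗-congˡ b (walks-step ψ w))
    ⨾ solve 7 (λ a b x y z s t → a :* (x :+ z :* s) :+ b :* (y :+ z :* t)
                               := (a :* x :+ b :* y) :+ z :* (a :* s :+ b :* t)) (λ _ → refl)
        a b (φ (length w)) (ψ (length w)) X S T
    ⨾ ⊕-congˡ (s w) (⊗-congˡ X (≋-sym (sum-linear a b (walks φ) (walks ψ) (children w)))))
    where
    s : Word → Series
    s w = a ⊗ φ (length w) ⊕ b ⊗ ψ (length w)

  walks-⊗ : ∀ a φ w → walks (λ s → a ⊗ φ s) w ≋ a ⊗ walks φ w
  walks-⊗ a φ w =
      walks-cong (λ s → drop-zero (φ s)) w
    ⨾ walks-linear a (const 0ℤ) φ φ w
    ⨾ ≋-sym (drop-zero (walks φ w))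
    where
    drop-zero : ∀ f → a ⊗ f ≋ a ⊗ f ⊕ const 0ℤ ⊗ f
    drop-zero = solve 2 (λ a f → a :* f := a :* f :+ con 0ℤ :* f) (λ _ → refl) a

  run : ℕ → Word
  run T = replicate T false

  sum-combine : ∀ c (g h : A → Series) ws → 𝟙 ⊗ sum g ws ⊕ c ⊗ sum h ws ≋ sum (λ w → g w ⊕ c ⊗ h w) ws
  sum-combine c g h ws =
      ≋-sym (sum-linear 𝟙 c g h ws)
    ⨾ sum-cong (λ w → ⊕-congʳ (c ⊗ h w) (⊗-identityˡ (g w))) ws

  -- Decomposition of a walk at its last step to the child 0, which leaves a state true ∷ run T.
  walks-true : ∀ φ w → walks φ (true ∷ w) ≋
               walks (φ ∘ suc) w ⊕ X ⊗ walks (λ T → walks (φ ∘ suc) (run T)) (true ∷ w)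
  -- The unknowns are indexed by the tail `w`: the children of `true ∷ w` all begin with `true`
  -- again, and their tails are `run (suc (length w))` and the children of `w`.
  walks-true φ = guarded-unique (λ w → φ (suc (length w))) (λ w → run (suc (length w)) ∷ children w)
    (λ w → walks-step φ (true ∷ w)
         ⨾ ⊕-congˡ (φ (suc (length w))) (⊗-congˡ X (⊕-congˡ (walks φ (true ∷ run (suc (length w))))
             (sum-map (walks φ) (true ∷_) (children w)))))
    (λ w → let b = run (suc (length w)) ; s = φ (suc (length w)) ; q = ψ (suc (length w)) ; cs = children w in
      ⊕-cong (walks-step (φ ∘ suc) w) (⊗-congˡ X (walks-step ψ (true ∷ w)
        ⨾ ⊕-congˡ q (⊗-congˡ X (⊕-congˡ (Ψ (true ∷ b)) (sum-map Ψ (true ∷_) cs)))))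
    ⨾ solve 6 (λ p s q y t z → (p :+ z :* s) :+ z :* (q :+ z :* (y :+ t))
                             := p :+ z :* ((q :+ z :* y) :+ (con 1ℤ :* s :+ z :* t))) (λ _ → refl)
        s (sum Φ cs) q (Ψ (true ∷ b)) (sum (Ψ ∘ (true ∷_)) cs) X
    ⨾ ⊕-congˡ s (⊗-congˡ X (⊕-congˡ (q ⊕ X ⊗ Ψ (true ∷ b)) (sum-combine X Φ (Ψ ∘ (true ∷_)) cs))))
    where
    ψ : Weight
    ψ T = walks (φ ∘ suc) (run T)
    Φ Ψ : Word → Series
    Φ = walks (φ ∘ suc)
    Ψ = walks ψ

  -- Decomposition of a walk at its first step to the child 0, which leaves the state true ∷ [].
  walks-false : ∀ φ w → walks φ (false ∷ w) ≋
                walks (φ ∘ suc) w ⊕ X ⊗ walks φ (true ∷ []) ⊗ walks (λ _ → 𝟙) w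
  walks-false φ = guarded-unique s children
    (λ w → walks-step φ (false ∷ w)
         ⨾ solve 4 (λ p z a s → p :+ z :* (a :+ s) := (p :+ z :* a) :+ z :* s) (λ _ → refl)
             (φ (suc (length w))) X a (sum (walks φ) (map (false ∷_) (children w)))
         ⨾ ⊕-congˡ (s w) (⊗-congˡ X (sum-map (walks φ) (false ∷_) (children w))))
    (λ w → let cs = children w in
      ⊕-cong (walks-step (φ ∘ suc) w) (⊗-congˡ (X ⊗ a) (walks-step (λ _ → 𝟙) w))
    ⨾ solve 5 (λ p z a s t → (p :+ z :* s) :+ (z :* a) :* (con 1ℤ :+ z :* t)
                           := (p :+ z :* a) :+ z :* (con 1ℤ :* s :+ (z :* a) :* t)) (λ _ → refl)
        (φ (suc (length w))) X a (sum Φ cs) (sum I cs)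
    ⨾ ⊕-congˡ (s w) (⊗-congˡ X (sum-combine (X ⊗ a) Φ I cs)))
    where
    a : Series
    a = walks φ (true ∷ [])
    s : Word → Series
    s w = φ (suc (length w)) ⊕ X ⊗ a
    Φ I : Word → Series
    Φ = walks (φ ∘ suc)
    I = walks (λ _ → 𝟙)

-- The kernel equation relating u and `N u`.

module Kernel where

  open PowerSeries
  open Tree
  open Walks
  open import Data.Bool.Base using (true)
  open import Data.Integer.Base using (ℤ; 1ℤ)
  import Data.Integer.Properties as ℤ
  open import Data.List.Base using ([]; _∷_)
  open import Data.Nat.Base using (ℕ; zero; suc)
  open import Function.Base using (_∘_)
  open import Relation.Binary.PropositionalEquality
  open SeriesSolver

  -- Algebraic consequences are stated as polynomial identities in which each hypothesis occurs as a
  -- difference with an explicit cofactor: `solve` checks the identity, and `absorb` removes the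
  -- differences one by one.
  absorb : ∀ c b {p q} → p ≋ q → b ⊕ c ⊗ (p ⊕ ⊖ q) ≋ b
  absorb c b {p} {q} e =
      ⊕-congˡ b (⊗-congˡ c (⊕-congʳ (⊖ q) e))
    ⨾ solve 3 (λ b c q → b :+ c :* (q :+ :- q) := b) (λ _ → refl) b c q

  pow : Series → Weight
  pow u zero    = 𝟙
  pow u (suc s) = u ⊗ pow u s

  pow-cong : ∀ {u v} → u ≋ v → ∀ s → pow u s ≋ pow v s
  pow-cong p zero _  = refl
  pow-cong p (suc s) = ⊗-cong p (pow-cong p s)

  pow-𝟙 : ∀ s → pow 𝟙 s ≋ 𝟙
  pow-𝟙 zero _  = refl
  pow-𝟙 (suc s) = ⊗-identityˡ (pow 𝟙 s) ⨾ pow-𝟙 s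

  N : Series → Series
  N u = walks (pow u) []

  N-cong : ∀ {u v} → u ≋ v → N u ≋ N v
  N-cong p = walks-cong (pow-cong p) []

  H : Series
  H = walks (λ _ → 𝟙) []

  walks-root : ∀ φ → walks φ [] ≋ φ 0 ⊕ X ⊗ walks φ (true ∷ [])
  walks-root φ =
      walks-step φ []
    ⨾ ⊕-congˡ (φ 0) (⊗-congˡ X (λ n → ℤ.+-identityʳ _))

  -- In `walks-true` at `true ∷ []`, the term without a step to the child 0 is the new weight at T =
  -- 0, because `run 0` is the root. So the right side is again a series of walks from the root.
  walks-last : ∀ φ → walks φ [] ≋ φ 0 ⊕ X ⊗ walks (λ T → walks (φ ∘ suc) (run T)) []
  walks-last φ =
      walks-root φ
    ⨾ ⊕-congˡ (φ 0) (⊗-congˡ X (walks-true φ [] ⨾ ≋-sym (walks-root (λ T → walks (φ ∘ suc) (run T)))))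

  -- By `walks-false`, a further letter `false` multiplies the series by 1 + X ·
  -- `walks (λ _ → 𝟙) (true ∷ [])`, which is `H`.
  walks-run : ∀ T → walks (λ _ → 𝟙) (run T) ≋ pow H (suc T)
  walks-run zero    = solve 1 (λ h → h := h :* con 1ℤ) (λ _ → refl) H
  walks-run (suc T) =
      walks-false (λ _ → 𝟙) (run T)
    ⨾ solve 3 (λ w z a → w :+ z :* a :* w := (con 1ℤ :+ z :* a) :* w) (λ _ → refl)
        (walks (λ _ → 𝟙) (run T)) X (walks (λ _ → 𝟙) (true ∷ []))
    ⨾ ⊗-cong (≋-sym (walks-root (λ _ → 𝟙))) (walks-run T)

  H-equation : H ≋ 𝟙 ⊕ X ⊗ (H ⊗ N H)
  H-equation =
      walks-last (λ _ → 𝟙)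
    ⨾ ⊕-congˡ 𝟙 (⊗-congˡ X (walks-cong walks-run [] ⨾ walks-⊗ H (pow H) []))

  module _ (u : Series) where
    private
      v R : Series
      v = N u
      R = N H

      V : ℕ → Series
      V T = walks (pow u) (run T)

      α β : Series
      α = u ⊗ v ⊕ ⊖ H
      β = ⊖ ((v ⊕ ⊖ 𝟙) ⊗ H)

      shift : ∀ w → walks (pow u ∘ suc) w ≋ u ⊗ walks (pow u) w
      shift = walks-⊗ u (pow u)

      V-suc : ∀ T → V (suc T) ≋ u ⊗ V T ⊕ (v ⊕ ⊖ 𝟙) ⊗ pow H (suc T)
      V-suc T =
          walks-false (pow u) (run T)
        ⨾ ⊕-cong (shift (run T)) (⊗-cong
            (solve 1 (λ p → p := (con 1ℤ :+ p) :+ :- con 1ℤ) (λ _ → refl) (X ⊗ walks (pow u) (true ∷ []))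
              ⨾ ⊕-congʳ (⊖ 𝟙) (≋-sym (walks-root (pow u))))
            (walks-run T))

      -- The recurrence `V-suc` has the rates u and `H`, so its solution combines their powers. The
      -- factor u - H stays on the left because it cannot be divided out: u = `H` does occur in the
      -- orbit.
      V-closed : ∀ T → (u ⊕ ⊖ H) ⊗ V T ≋ α ⊗ pow u T ⊕ β ⊗ pow H T
      V-closed zero = solve 3 (λ u v h → (u :+ :- h) :* v
        := (u :* v :+ :- h) :* con 1ℤ :+ (:- ((v :+ :- con 1ℤ) :* h)) :* con 1ℤ) (λ _ → refl) u v H
      V-closed (suc T) =
          ⊗-congˡ (u ⊕ ⊖ H) (V-suc T)
        ⨾ solve 6 (λ u v h s t w →
              (u :+ :- h) :* (u :* w :+ (v :+ :- con 1ℤ) :* (h :* t))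
            := ((u :* v :+ :- h) :* (u :* s) :+ (:- ((v :+ :- con 1ℤ) :* h)) :* (h :* t))
               :+ u :* ((u :+ :- h) :* w :+ :- ((u :* v :+ :- h) :* s :+ (:- ((v :+ :- con 1ℤ) :* h)) :* t)))
            (λ _ → refl) u v H (pow u T) (pow H T) (V T)
        ⨾ absorb u (α ⊗ pow u (suc T) ⊕ β ⊗ pow H (suc T)) (V-closed T)

      v-equation : v ≋ 𝟙 ⊕ X ⊗ (u ⊗ walks V [])
      v-equation =
          walks-last (pow u)
        ⨾ ⊕-congˡ 𝟙 (⊗-congˡ X (walks-cong (λ T → shift (run T)) [] ⨾ walks-⊗ u V []))

      walks-V : (u ⊕ ⊖ H) ⊗ walks V [] ≋ α ⊗ v ⊕ β ⊗ R
      walks-V =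
          ≋-sym (walks-⊗ (u ⊕ ⊖ H) V [])
        ⨾ walks-cong V-closed []
        ⨾ walks-linear α β (pow u) (pow H) []

    -- By symmetry, N (N u) and u are the two roots v of the equation for N u.
    kernel : H ⊗ (u ⊕ ⊖ 𝟙) ⊗ (v ⊕ ⊖ 𝟙) ≋ X ⊗ (u ⊗ u ⊗ (v ⊗ v)) ⊕ ⊖ (X ⊗ (H ⊗ (u ⊗ v)))
    kernel =
        -- The cofactors first eliminate `walks V []` and then `R`, which survives only inside the
        -- product X H R; `H-equation` turns that product into H - 1.
        solve 6 (λ u v h r z w →
            h :* (u :+ :- con 1ℤ) :* (v :+ :- con 1ℤ)
          := (z :* (u :* u :* (v :* v)) :+ :- (z :* (h :* (u :* v))))
             :+ (u :+ :- h) :* (v :+ :- (con 1ℤ :+ z :* (u :* w)))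
             :+ (z :* u) :* ((u :+ :- h) :* w
                  :+ :- ((u :* v :+ :- h) :* v :+ (:- ((v :+ :- con 1ℤ) :* h)) :* r))
             :+ (u :* (v :+ :- con 1ℤ)) :* (h :+ :- (con 1ℤ :+ z :* (h :* r))))
          (λ _ → refl) u v H R X (walks V [])
      ⨾ absorb (u ⊗ (v ⊕ ⊖ 𝟙)) _ H-equation
      ⨾ absorb (X ⊗ u) _ walks-V
      ⨾ absorb (u ⊕ ⊖ H) _ v-equation

-- From the orbit of `N` to labelled trees.

module Labels where

  open PowerSeries
  open Tree
  open Walks
  open Kernel
  open import Data.Bool.Base using (true)
  open import Data.Integer.Base using (ℤ; +_; 0ℤ; 1ℤ; _+_; _*_; -_)
  import Data.Integer.Properties as ℤ
  open import Data.List.Base using ([]; _∷_; length)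
  open import Data.Nat.Base as ℕ using (ℕ; zero; suc; s≤s; z≤n)
  import Data.Nat.Properties as ℕ
  open import Data.Product.Base using (_×_; _,_; proj₁; proj₂)
  open import Relation.Binary.PropositionalEquality
  open SeriesSolver

  -- The difference u - w has order k and leading coefficient 1, so it can be cancelled from
  -- products over the integers.
  Gap : ℕ → Series → Series → Set
  Gap k u w = (∀ i → i ℕ.< k → u i ≡ w i) × u k ≡ 1ℤ + w k

  module _ {k : ℕ} {u w : Series} (agree : ∀ i → i ℕ.< k → u i ≡ w i) where

    pow-agree : ∀ s i → i ℕ.< k → pow u s i ≡ pow w s i
    pow-agree zero    i l = refl
    pow-agree (suc s) i l = ⊗-cong-≤ i (λ j m → agree j (ℕ.≤-<-trans m l))
                                       (λ j m → pow-agree s j (ℕ.≤-<-trans m l))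

    walks-agree : ∀ x i → i ℕ.< k → walks (pow u) x i ≡ walks (pow w) x i
    walks-agree x zero    l = pow-agree (length x) 0 l
    walks-agree x (suc i) l =
      cong₂ _+_ (pow-agree (length x) (suc i) l)
        (sum-cong-at 0 (λ y → walks-agree y i (ℕ.<-trans ℕ.≤-refl l)) (children x))

  ⊗-identityʳ : ∀ f → f ⊗ 𝟙 ≋ f
  ⊗-identityʳ = solve 1 (λ f → f :* con 1ℤ := f) (λ _ → refl)

  -- Only the walk without steps sees degree k of the weight, and it ends in a state of length 1,
  -- where the weight is u itself. Every step costs a degree, and below degree k the weights agree.
  Gap-singleton : ∀ k {u w} → Gap k u w → walks (pow u) (true ∷ []) k ≡ 1ℤ + walks (pow w) (true ∷ []) k
  Gap-singleton zero {u} {w} (_ , e) =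
    trans (⊗-identityʳ u 0) (trans e (cong (_+_ 1ℤ) (sym (⊗-identityʳ w 0))))
  Gap-singleton (suc k) {u} {w} (a , e) = trans
    (cong₂ _+_ (trans (⊗-identityʳ u (suc k)) e)
               (sum-cong-at {g = λ y _ → walks (pow u) y k} {h = λ y _ → walks (pow w) y k} 0 (λ y → walks-agree a y k ℕ.≤-refl) (children (true ∷ []))))
    (trans (ℤ.+-assoc 1ℤ (w (suc k)) rest)
           (cong (λ z → 1ℤ + (z + rest)) (sym (⊗-identityʳ w (suc k)))))
    where
    rest : ℤ
    rest = sum (λ y _ → walks (pow w) y k) (children (true ∷ [])) 0

  N-suc : ∀ u n → N u (suc n) ≡ walks (pow u) (true ∷ []) n
  N-suc u n = trans (ℤ.+-identityˡ _) (ℤ.+-identityʳ _)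

  Gap-N : ∀ k {u w} → Gap k u w → Gap (suc k) (N u) (N w)
  Gap-N k {u} {w} g@(a , _) = below , trans (N-suc u k) (trans (Gap-singleton k g) (cong (_+_ 1ℤ) (sym (N-suc w k))))
    where
    below : ∀ i → i ℕ.< suc k → N u i ≡ N w i
    below zero    _       = refl
    below (suc i) (s≤s l) = trans (N-suc u i) (trans (walks-agree a (true ∷ []) i l) (sym (N-suc w i)))

  U : ℕ → Series
  U zero    = 𝟙
  U (suc k) = N (U k)

  -- The difference of `U 2` and 1 starts with x, and each application of `N` raises the order by
  -- one. Thus `U j` and `U (suc (suc j))` are distinct roots of the same quadratic equation, as
  -- Vieta's relations require.
  U-Gap : ∀ j → Gap (suc j) (U (suc (suc j))) (U j)
  U-Gap zero    = (λ { zero _ → refl ; (suc i) (s≤s ()) }) , refl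
  U-Gap (suc j) = Gap-N (suc j) (U-Gap j)

  U₁ : U 1 ≋ H
  U₁ = walks-cong pow-𝟙 []

  ≋-from-diff : ∀ {f g} → f ⊕ ⊖ g ≋ 𝟘 → f ≋ g
  ≋-from-diff {f} {g} e =
      solve 2 (λ f g → f := g :+ (f :+ :- g)) (λ _ → refl) f g
    ⨾ ⊕-congˡ g e ⨾ (λ n → ℤ.+-identityʳ (g n))

  cancel-unit : ∀ {d} → d 0 ≡ 1ℤ → ∀ n f → (∀ i → i ℕ.≤ n → (d ⊗ f) i ≡ 0ℤ) → f n ≡ 0ℤ
  cancel-unit {d} e zero f p =
    trans (sym (ℤ.*-identityˡ (f 0))) (trans (cong (λ z → z * f 0) (sym e)) (p 0 z≤n))
  cancel-unit {d} e (suc n) f p = cancel-unit e n (tail f) (λ i l → trans (sym (drop i)) (p (suc i) (s≤s l)))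
    where
    f0 : f 0 ≡ 0ℤ
    f0 = cancel-unit e 0 f (λ i l → p i (ℕ.≤-trans l z≤n))
    drop : ∀ i → (d ⊗ f) (suc i) ≡ (d ⊗ tail f) i
    drop i = trans (⊗-sucʳ d f i) (trans (cong (λ z → d (suc i) * z + (d ⊗ tail f) i) f0)
               (trans (cong (λ z → z + (d ⊗ tail f) i) (ℤ.*-zeroʳ (d (suc i)))) (ℤ.+-identityˡ _)))

  cancel : ∀ k {d} → (∀ i → i ℕ.< k → d i ≡ 0ℤ) → d k ≡ 1ℤ → ∀ f → d ⊗ f ≋ 𝟘 → f ≋ 𝟘
  cancel zero    a e f p n = cancel-unit e n f (λ i _ → p i)
  cancel (suc k) {d} a e f p = cancel k (λ i l → a (suc i) (s≤s l)) e f (λ n →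
    trans (sym (trans (cong (λ z → z * f (suc n) + (tail d ⊗ f) n) (a 0 (s≤s z≤n))) (ℤ.+-identityˡ _))) (p (suc n)))

  module _ (j : ℕ) where
    private
      w u v : Series
      w = U j
      u = U (suc j)
      v = U (suc (suc j))

    -- The kernel is symmetric, so its instances for u and for w make v and w roots of one quadratic
    -- equation over u. Subtracting them leaves a multiple of v - w, which `U-Gap` allows to cancel.
    vieta-sum : X ⊗ (u ⊗ u ⊗ (v ⊕ w)) ≋ H ⊗ (u ⊕ ⊖ 𝟙) ⊕ X ⊗ (H ⊗ u)
    vieta-sum = ≋-from-diff (cancel (suc j) {v ⊕ ⊖ w}
      (λ i l → trans (cong (_+ - w i) (proj₁ (U-Gap j) i l)) (ℤ.+-inverseʳ (w i)))
      (trans (cong (λ z → z + - w (suc j)) (proj₂ (U-Gap j)))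
         (trans (ℤ.+-assoc 1ℤ (w (suc j)) (- w (suc j))) (cong (_+_ 1ℤ) (ℤ.+-inverseʳ (w (suc j))))))
      _
      (solve 5 (λ u v w h z →
           (v :+ :- w) :* (z :* (u :* u :* (v :+ w)) :+ :- (h :* (u :+ :- con 1ℤ) :+ z :* (h :* u)))
         := (con 0ℤ :+ con 1ℤ :* (h :* (w :+ :- con 1ℤ) :* (u :+ :- con 1ℤ)
               :+ :- (z :* (w :* w :* (u :* u)) :+ :- (z :* (h :* (w :* u))))))
            :+ (:- con 1ℤ) :* (h :* (u :+ :- con 1ℤ) :* (v :+ :- con 1ℤ)
               :+ :- (z :* (u :* u :* (v :* v)) :+ :- (z :* (h :* (u :* v))))))
         (λ _ → refl) u v w H X
       ⨾ absorb (⊖ 𝟙) _ (kernel u)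
       ⨾ absorb 𝟙 (const 0ℤ) (kernel w)
       ⨾ const-0))

    vieta-product : X ⊗ (u ⊗ u ⊗ (v ⊗ w)) ≋ H ⊗ (u ⊕ ⊖ 𝟙)
    vieta-product =
        solve 5 (λ u v w h z →
           z :* (u :* u :* (v :* w))
         := (h :* (u :+ :- con 1ℤ)
             :+ v :* (z :* (u :* u :* (v :+ w)) :+ :- (h :* (u :+ :- con 1ℤ) :+ z :* (h :* u))))
            :+ con 1ℤ :* (h :* (u :+ :- con 1ℤ) :* (v :+ :- con 1ℤ)
               :+ :- (z :* (u :* u :* (v :* v)) :+ :- (z :* (h :* (u :* v))))))
         (λ _ → refl) u v w H X
      ⨾ absorb 𝟙 _ (kernel u)
      ⨾ absorb v (H ⊗ (u ⊕ ⊖ 𝟙)) vieta-sum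

  -- This is 1 / H: `U 2` equals `N H`, and `H-equation` reads (1 - X N H) H = 1.
  q : Series
  q = 𝟙 ⊕ ⊖ (X ⊗ U 2)

  q⊗H : q ⊗ H ≋ 𝟙
  q⊗H =
      solve 3 (λ h z n → (con 1ℤ :+ :- (z :* n)) :* h := con 1ℤ :+ con 1ℤ :* (h :+ :- (con 1ℤ :+ z :* (h :* n)))) (λ _ → refl) H X (U 2)
    ⨾ absorb 𝟙 𝟙 (H-equation ⨾ ⊕-congˡ 𝟙 (⊗-congˡ X (⊗-congˡ H (N-cong (≋-sym U₁)))))

  -- A form of (1 - 1 / U k) / x without division: by `vieta-product`, x u² v w / H = u - 1.
  R : ℕ → Series
  R zero    = 𝟘
  R (suc j) = U j ⊗ U (suc j) ⊗ U (suc (suc j)) ⊗ q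

  U-inverse : ∀ k → U k ⊗ (𝟙 ⊕ ⊖ (X ⊗ R k)) ≋ 𝟙
  U-inverse zero = ⊗-identityˡ _ ⨾ (λ { zero → refl ; (suc n) → cong (λ z → 0ℤ + - z) (X⊗-suc 𝟘 n) })
  U-inverse (suc j) =
      solve 6 (λ u v w h z q →
          u :* (con 1ℤ :+ :- (z :* (w :* u :* v :* q)))
        := (con 1ℤ :+ (:- q) :* (z :* (u :* u :* (v :* w)) :+ :- (h :* (u :+ :- con 1ℤ))))
           :+ (:- (u :+ :- con 1ℤ)) :* (q :* h :+ :- con 1ℤ))
        (λ _ → refl) (U (suc j)) (U (suc (suc j))) (U j) H X q
    ⨾ absorb (⊖ (U (suc j) ⊕ ⊖ 𝟙)) _ q⊗H
    ⨾ absorb (⊖ q) 𝟙 (vieta-product j)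

  X-cancel : ∀ {f} → X ⊗ f ≋ 𝟘 → f ≋ 𝟘
  X-cancel {f} p n = trans (sym (X⊗-suc f n)) (p (suc n))

  -- Replacing x R by 1 - 1 / U for both neighbours turns x r (R_j + R_{j+2}) into 2 r - q u (v +
  -- w). The sum of roots, divided by H, u and x, gives q u (v + w) = 1 + r, which is `balance`.
  R-equation : ∀ j → R (suc j) ≋ 𝟙 ⊕ X ⊗ (R (suc j) ⊗ (R j ⊕ R (suc (suc j))))
  R-equation j =
      solve 7 (λ u v w z q rv rw → let r = w :* u :* v :* q in
          r := (((con 1ℤ :+ z :* (r :* (rw :+ rv)))
                :+ (w :* u :* q) :* (v :* (con 1ℤ :+ :- (z :* rv)) :+ :- con 1ℤ))
                :+ (u :* v :* q) :* (w :* (con 1ℤ :+ :- (z :* rw)) :+ :- con 1ℤ))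
                :+ con 1ℤ :* ((q :* u :* (v :+ w) :+ :- r) :+ :- con 1ℤ))
        (λ _ → refl) u v w X q (R (suc (suc j))) (R j)
    ⨾ absorb 𝟙 _ balance
    ⨾ absorb (u ⊗ v ⊗ q) _ (U-inverse j)
    ⨾ absorb (w ⊗ u ⊗ q) _ (U-inverse (suc (suc j)))
    where
    w u v r : Series
    w = U j
    u = U (suc j)
    v = U (suc (suc j))
    r = R (suc j)
    balance : q ⊗ u ⊗ (v ⊕ w) ⊕ ⊖ r ≋ 𝟙
    balance = ≋-from-diff (X-cancel
      (solve 7 (λ u v w h z q r →
          z :* ((q :* u :* (v :+ w) :+ :- r) :+ :- con 1ℤ)
        := ((con 0ℤ :+ ((con 1ℤ :+ :- (z :* r)) :* q) :* (z :* (u :* u :* (v :+ w)) :+ :- (h :* (u :+ :- con 1ℤ) :+ z :* (h :* u))))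
            :+ ((con 1ℤ :+ :- (z :* r)) :* (u :+ :- con 1ℤ :+ z :* u)) :* (q :* h :+ :- con 1ℤ))
           :+ (:- (z :* (q :* u :* (v :+ w))) :+ (con 1ℤ :+ z)) :* (u :* (con 1ℤ :+ :- (z :* r)) :+ :- con 1ℤ))
        (λ _ → refl) u v w H X q r
      ⨾ absorb (⊖ (X ⊗ (q ⊗ u ⊗ (v ⊕ w))) ⊕ (𝟙 ⊕ X)) _ (U-inverse (suc j))
      ⨾ absorb ((𝟙 ⊕ ⊖ (X ⊗ r)) ⊗ (u ⊕ ⊖ 𝟙 ⊕ X ⊗ u)) _ q⊗H
      ⨾ absorb ((𝟙 ⊕ ⊖ (X ⊗ r)) ⊗ q) (const 0ℤ) (vieta-sum j)
      ⨾ const-0))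

  H-labels : H ≋ 𝟙 ⊕ X ⊗ (R 1 ⊗ H)
  H-labels =
      ≋-sym U₁
    ⨾ solve 3 (λ u z r → u := (con 1ℤ :+ z :* (r :* u)) :+ con 1ℤ :* (u :* (con 1ℤ :+ :- (z :* r)) :+ :- con 1ℤ)) (λ _ → refl) (U 1) X (R 1)
    ⨾ absorb 𝟙 _ (U-inverse 1)
    ⨾ ⊕-congˡ 𝟙 (⊗-congˡ X (⊗-congˡ (R 1) U₁))

-- Passage to natural coefficients.

module Coefficients where

  open PowerSeries using (_⊗_; 𝟙; X⊗-suc)
  open Tree
  open Walks using (walks) renaming (sum to sumSeries)
  open Labels using (R; R-equation; H-labels)
  open import Data.Integer.Base as ℤ using (ℤ; +_; ∣_∣)
  import Data.Integer.Properties as ℤ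
  open import Data.List.Base using ([]; _∷_; map)
  open import Data.Nat.Base
  open import Data.Nat.ListAction using (sum)
  import Data.Nat.Properties as ℕ
  open import Data.Sum.Base using (inj₁; inj₂)
  open import Function.Base using (_∘_)
  open import Relation.Binary.PropositionalEquality

  conv : (ℕ → ℕ) → (ℕ → ℕ) → ℕ → ℕ
  conv f g zero    = f 0 * g 0
  conv f g (suc n) = f 0 * g (suc n) + conv (f ∘ suc) g n

  ⊗-conv : ∀ {F G f g} n → (∀ i → i ≤ n → F i ≡ + f i) → (∀ i → i ≤ n → G i ≡ + g i) →
           (F ⊗ G) n ≡ + conv f g n
  ⊗-conv {f = f} {g} zero    p q = trans (cong₂ ℤ._*_ (p 0 z≤n) (q 0 z≤n)) (sym (ℤ.pos-* (f 0) (g 0)))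
  ⊗-conv {f = f} {g} (suc n) p q = trans
    (cong₂ ℤ._+_
      (trans (cong₂ ℤ._*_ (p 0 z≤n) (q (suc n) ℕ.≤-refl)) (sym (ℤ.pos-* (f 0) (g (suc n)))))
      (⊗-conv n (λ i l → p (suc i) (s≤s l)) (λ i l → q i (ℕ.m≤n⇒m≤1+n l))))
    (sym (ℤ.pos-+ (f 0 * g (suc n)) (conv (f ∘ suc) g n)))

  paths : ℕ → Word → ℕ
  paths zero    w = 1
  paths (suc n) w = sum (map (paths n) (children w))

  walks-paths : ∀ n w → walks (λ _ → 𝟙) w n ≡ + paths n w
  walks-paths zero    w = refl
  walks-paths (suc n) w = trans (ℤ.+-identityˡ _) (go (children w))
    where
    go : ∀ ws → sumSeries (λ w′ _ → walks (λ _ → 𝟙) w′ n) ws 0 ≡ + sum (map (paths n) ws)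
    go []       = refl
    go (v ∷ ws) = trans (cong₂ ℤ._+_ (walks-paths n v) (go ws)) (sym (ℤ.pos-+ (paths n v) _))

  h : ℕ → ℕ
  h n = paths n []

  r : ℕ → ℕ → ℕ
  r k n = ∣ R k n ∣

  neighbours : ℕ → ℕ → ℕ
  neighbours j n = r j n + r (suc (suc j)) n

  R-step : ∀ j n → R (suc j) (suc n) ≡ (R (suc j) ⊗ (λ i → R j i ℤ.+ R (suc (suc j)) i)) n
  R-step j n = trans (R-equation j (suc n)) (trans (ℤ.+-identityˡ _) (X⊗-suc _ n))

  R-zero : ∀ j → R (suc j) 0 ≡ + 1
  R-zero j = R-equation j 0

  +∣_∣ : ∀ {z n} → z ≡ + n → z ≡ + ∣ z ∣
  +∣ eq ∣ = trans eq (cong +_ (sym (cong ∣_∣ eq)))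

  -- The recurrence has no negative terms, so signs are settled by induction on the degree. All
  -- indices are treated at once, as each step moves to the neighbouring ones.
  R-positive : ∀ n m → m ≤ n → ∀ k → R k m ≡ + r k m
  R-step-conv : ∀ n j → R (suc j) (suc n) ≡ + conv (r (suc j)) (neighbours j) n

  R-step-conv n j = trans (R-step j n) (⊗-conv n (λ i l → R-positive n i l (suc j))
    (λ i l → trans (cong₂ ℤ._+_ (R-positive n i l j) (R-positive n i l (suc (suc j))))
                   (sym (ℤ.pos-+ (r j i) _))))

  R-positive n       m       l zero    = refl
  R-positive n       zero    l (suc j) = +∣ R-zero j ∣
  R-positive (suc n) (suc m) (s≤s l) (suc j) with ℕ.m≤n⇒m<n∨m≡n l
  ... | inj₁ m<n  = R-positive n (suc m) m<n (suc j)
  ... | inj₂ m≡n  = +∣ subst (λ i → R (suc j) (suc i) ≡ + conv (r (suc j)) (neighbours j) i) (sym m≡n) (R-step-conv n j) ∣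

  r-zero : ∀ n → r 0 n ≡ 0
  r-zero n = refl

  r-suc-zero : ∀ j → r (suc j) 0 ≡ 1
  r-suc-zero j = cong ∣_∣ (R-zero j)

  r-suc : ∀ j n → r (suc j) (suc n) ≡ conv (r (suc j)) (neighbours j) n
  r-suc j n = cong ∣_∣ (R-step-conv n j)

  h-suc : ∀ n → h (suc n) ≡ conv (r 1) h n
  h-suc n = ℤ.+-injective (trans (sym (walks-paths (suc n) [])) (trans (H-labels (suc n))
    (trans (ℤ.+-identityˡ _) (trans (X⊗-suc _ n)
      (⊗-conv n (λ i _ → R-positive i i ℕ.≤-refl 1) (λ i _ → walks-paths i []))))))

-- Exponential growth at rate 8.

module Growth where

  open Coefficients using (conv)
  open import Data.Nat.Base
  open import Data.Nat.Properties
  open import Data.Nat.Tactic.RingSolver using (solve-∀)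
  open import Data.Product.Base using (∃; _,_; proj₁; proj₂)
  open import Data.Sum.Base using (inj₁; inj₂)
  open import Function.Base using (_∘_)
  open import Relation.Binary.PropositionalEquality
  open import Relation.Nullary.Decidable using (yes; no)

  conv-first : ∀ f g n → f 0 * g n ≤ conv f g n
  conv-first f g zero    = ≤-refl
  conv-first f g (suc n) = m≤m+n _ _

  conv-last : ∀ f g n → f n * g 0 ≤ conv f g n
  conv-last f g zero    = ≤-refl
  conv-last f g (suc n) = ≤-trans (conv-last (f ∘ suc) g n) (m≤n+m _ _)

  conv-sucʳ : ∀ f g n → conv f g (suc n) ≡ f (suc n) * g 0 + conv f (g ∘ suc) n
  conv-sucʳ f g zero    = +-comm (f 0 * g 1) (f 1 * g 0)
  conv-sucʳ f g (suc n) = trans (cong (f 0 * g (suc (suc n)) +_) (conv-sucʳ (f ∘ suc) g n))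
    (rearrange (f 0 * g (suc (suc n))) (f (suc (suc n)) * g 0) _)
    where
    rearrange : ∀ a b c → a + (b + c) ≡ b + (a + c)
    rearrange = solve-∀

  conv-comm : ∀ f g n → conv f g n ≡ conv g f n
  conv-comm f g zero    = *-comm (f 0) (g 0)
  conv-comm f g (suc n) =
    trans (cong₂ _+_ (*-comm (f 0) (g (suc n))) (conv-comm (f ∘ suc) g n)) (sym (conv-sucʳ g f n))

  -- ev M f = a^M * Σ_{i ≤ M} f i (b / a)^i
  module Evaluation (a b : ℕ) where

    ev : ℕ → (ℕ → ℕ) → ℕ
    ev zero    f = f 0
    ev (suc M) f = f 0 * a ^ suc M + b * ev M (f ∘ suc)

    ev-mono : ∀ {f g} → (∀ i → f i ≤ g i) → ∀ M → ev M f ≤ ev M g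
    ev-mono p zero    = p 0
    ev-mono p (suc M) = +-mono-≤ (*-monoˡ-≤ (a ^ suc M) (p 0)) (*-monoʳ-≤ b (ev-mono (p ∘ suc) M))

    ev-cong : ∀ {f g} → (∀ i → f i ≡ g i) → ∀ M → ev M f ≡ ev M g
    ev-cong p M = ≤-antisym (ev-mono (λ i → ≤-reflexive (p i)) M) (ev-mono (λ i → ≤-reflexive (sym (p i))) M)

    ev-linear : ∀ c f g M → ev M (λ i → c * f i + g i) ≡ c * ev M f + ev M g
    ev-linear c f g zero    = refl
    ev-linear c f g (suc M) =
      trans (cong (λ z → (c * f 0 + g 0) * a ^ suc M + b * z) (ev-linear c (f ∘ suc) (g ∘ suc) M))
            (rearrange c (f 0) (g 0) (a ^ suc M) b (ev M (f ∘ suc)) (ev M (g ∘ suc)))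
      where
      rearrange : ∀ c x y p b s t → (c * x + y) * p + b * (c * s + t) ≡ c * (x * p + b * s) + (y * p + b * t)
      rearrange = solve-∀

    ev-+ : ∀ f g M → ev M (λ i → f i + g i) ≡ ev M f + ev M g
    ev-+ f g M = trans (ev-cong (λ i → cong (_+ g i) (sym (*-identityˡ (f i)))) M)
      (trans (ev-linear 1 f g M) (cong (_+ ev M g) (*-identityˡ (ev M f))))

    ev-conv : ∀ f g M → ev (suc M) (conv f g) ≡ f 0 * ev (suc M) g + b * ev M (conv (f ∘ suc) g)
    ev-conv f g M =
      trans (cong (λ z → f 0 * g 0 * a ^ suc M + b * z) (ev-linear (f 0) (g ∘ suc) (conv (f ∘ suc) g) M))
            (rearrange (f 0) (g 0) (a ^ suc M) b (ev M (g ∘ suc)) (ev M (conv (f ∘ suc) g)))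
      where
      rearrange : ∀ x y p b s t → x * y * p + b * (x * s + t) ≡ x * (y * p + b * s) + b * t
      rearrange = solve-∀

    ev-unfold : ∀ M f g → f 0 ≡ 1 → (∀ n → f (suc n) ≡ g n) → ev (suc M) f ≡ a ^ suc M + b * ev M g
    ev-unfold M f g p q = cong₂ _+_
      (trans (cong (_* a ^ suc M) p) (*-identityˡ (a ^ suc M)))
      (cong (b *_) (ev-cong q M))

    ev-scale : ∀ f M → a * ev M f ≤ ev (suc M) f
    ev-scale f zero    = ≤-trans (≤-reflexive (rearrange a (f 0))) (m≤m+n _ _)
      where
      rearrange : ∀ a x → a * x ≡ x * (a * 1)
      rearrange = solve-∀
    ev-scale f (suc M) = begin
      a * (f 0 * a ^ suc M + b * ev M (f ∘ suc))            ≡⟨ rearrange a (f 0) (a ^ suc M) b (ev M (f ∘ suc)) ⟩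
      f 0 * a ^ suc (suc M) + b * (a * ev M (f ∘ suc))      ≤⟨ +-monoʳ-≤ (f 0 * a ^ suc (suc M)) (*-monoʳ-≤ b (ev-scale (f ∘ suc) M)) ⟩
      f 0 * a ^ suc (suc M) + b * ev (suc M) (f ∘ suc)      ∎
      where
      open ≤-Reasoning
      rearrange : ∀ a x p b s → a * (x * p + b * s) ≡ x * (a * p) + b * (a * s)
      rearrange = solve-∀

    ev-scale-^ : ∀ f N M → a ^ M * ev N f ≤ ev (M + N) f
    ev-scale-^ f N zero    = ≤-reflexive (*-identityˡ (ev N f))
    ev-scale-^ f N (suc M) = begin
      a * a ^ M * ev N f    ≡⟨ *-assoc a (a ^ M) (ev N f) ⟩
      a * (a ^ M * ev N f)  ≤⟨ *-monoʳ-≤ a (ev-scale-^ f N M) ⟩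
      a * ev (M + N) f      ≤⟨ ev-scale f (M + N) ⟩
      ev (suc M + N) f      ∎
      where open ≤-Reasoning

    -- Pairs of degrees with sum at most M have both members at most M; the factor `a ^ M` balances
    -- the two normalisations.
    ev-conv-upper : ∀ f g M → a ^ M * ev M (conv f g) ≤ ev M f * ev M g
    ev-conv-upper f g zero    = ≤-reflexive (*-identityˡ (f 0 * g 0))
    ev-conv-upper f g (suc M) = begin
      a ^ suc M * ev (suc M) (conv f g)
        ≡⟨ cong (a ^ suc M *_) (ev-conv f g M) ⟩
      a * a ^ M * (f 0 * ev (suc M) g + b * ev M (conv (f ∘ suc) g))
        ≡⟨ split a (a ^ M) (f 0) (ev (suc M) g) b (ev M (conv (f ∘ suc) g)) ⟩
      f 0 * (a * a ^ M) * ev (suc M) g + b * a * (a ^ M * ev M (conv (f ∘ suc) g))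
        ≤⟨ +-monoʳ-≤ (f 0 * (a * a ^ M) * ev (suc M) g) (*-monoʳ-≤ (b * a) (ev-conv-upper (f ∘ suc) g M)) ⟩
      f 0 * (a * a ^ M) * ev (suc M) g + b * a * (ev M (f ∘ suc) * ev M g)
        ≡⟨ cong (f 0 * (a * a ^ M) * ev (suc M) g +_) (regroup b a (ev M (f ∘ suc)) (ev M g)) ⟩
      f 0 * (a * a ^ M) * ev (suc M) g + b * ev M (f ∘ suc) * (a * ev M g)
        ≤⟨ +-monoʳ-≤ (f 0 * (a * a ^ M) * ev (suc M) g) (*-monoʳ-≤ (b * ev M (f ∘ suc)) (ev-scale g M)) ⟩
      f 0 * (a * a ^ M) * ev (suc M) g + b * ev M (f ∘ suc) * ev (suc M) g
        ≡⟨ *-distribʳ-+ (ev (suc M) g) (f 0 * (a * a ^ M)) (b * ev M (f ∘ suc)) ⟨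
      ev (suc M) f * ev (suc M) g ∎
      where
      open ≤-Reasoning
      split : ∀ a p x s b t → a * p * (x * s + b * t) ≡ x * (a * p) * s + b * a * (p * t)
      split = solve-∀
      regroup : ∀ b a s t → b * a * (s * t) ≡ b * s * (a * t)
      regroup = solve-∀

    -- Degrees up to M and up to N add up to at most M + N.
    ev-conv-lower : ∀ f g M N → ev M f * ev N g ≤ ev (M + N) (conv f g)
    ev-conv-lower f g zero    N = begin
      f 0 * ev N g                  ≡⟨ +-identityʳ _ ⟨
      f 0 * ev N g + 0              ≤⟨ +-monoʳ-≤ (f 0 * ev N g) z≤n ⟩
      f 0 * ev N g + ev N (λ _ → 0) ≡⟨ ev-linear (f 0) g (λ _ → 0) N ⟨
      ev N (λ i → f 0 * g i + 0)    ≤⟨ ev-mono (λ i → ≤-trans (≤-reflexive (+-identityʳ _)) (conv-first f g i)) N ⟩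
      ev N (conv f g)               ∎
      where open ≤-Reasoning
    ev-conv-lower f g (suc M) N = begin
      (f 0 * a ^ suc M + b * ev M (f ∘ suc)) * ev N g
        ≡⟨ split (f 0) (a ^ suc M) b (ev M (f ∘ suc)) (ev N g) ⟩
      f 0 * (a ^ suc M * ev N g) + b * (ev M (f ∘ suc) * ev N g)
        ≤⟨ +-mono-≤ (*-monoʳ-≤ (f 0) (ev-scale-^ g N (suc M))) (*-monoʳ-≤ b (ev-conv-lower (f ∘ suc) g M N)) ⟩
      f 0 * ev (suc M + N) g + b * ev (M + N) (conv (f ∘ suc) g)
        ≡⟨ ev-conv f g (M + N) ⟨
      ev (suc M + N) (conv f g) ∎
      where
      open ≤-Reasoning
      split : ∀ x p b s t → (x * p + b * s) * t ≡ x * (p * t) + b * (s * t)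
      split = solve-∀

    -- Only the first M + 1 terms of the convolution are kept. The bound on `g` is assumed up to n
    -- only, so that a renewal equation can apply this to its own solution inductively.
    ev-renewal : ∀ K s g n M → M ≤ n → (∀ i → i ≤ n → a ^ i ≤ K * g i * b ^ i) →
                 a ^ (n ∸ M) * ev M s ≤ K * conv s g n * b ^ n
    ev-renewal K s g n zero l p = begin
      a ^ n * s 0             ≤⟨ *-monoˡ-≤ (s 0) (p n ≤-refl) ⟩
      K * g n * b ^ n * s 0   ≡⟨ rearrange K (g n) (b ^ n) (s 0) ⟩
      K * (s 0 * g n) * b ^ n ≤⟨ *-monoˡ-≤ (b ^ n) (*-monoʳ-≤ K (conv-first s g n)) ⟩
      K * conv s g n * b ^ n  ∎
      where
      open ≤-Reasoning
      rearrange : ∀ K x p s → K * x * p * s ≡ K * (s * x) * p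
      rearrange = solve-∀
    ev-renewal K s g (suc n) (suc M) (s≤s l) p = begin
      a ^ (n ∸ M) * (s 0 * a ^ suc M + b * ev M (s ∘ suc))
        ≡⟨ split (a ^ (n ∸ M)) (s 0) (a ^ suc M) b (ev M (s ∘ suc)) ⟩
      s 0 * (a ^ (n ∸ M) * a ^ suc M) + b * (a ^ (n ∸ M) * ev M (s ∘ suc))
        ≡⟨ cong (λ z → s 0 * z + b * (a ^ (n ∸ M) * ev M (s ∘ suc))) total ⟩
      s 0 * a ^ suc n + b * (a ^ (n ∸ M) * ev M (s ∘ suc))
        ≤⟨ +-mono-≤ (*-monoʳ-≤ (s 0) (p (suc n) ≤-refl))
             (*-monoʳ-≤ b (ev-renewal K (s ∘ suc) g n M l (λ i m → p i (m≤n⇒m≤1+n m)))) ⟩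
      s 0 * (K * g (suc n) * b ^ suc n) + b * (K * conv (s ∘ suc) g n * b ^ n)
        ≡⟨ join (s 0) K (g (suc n)) b (b ^ n) (conv (s ∘ suc) g n) ⟩
      K * conv s g (suc n) * b ^ suc n ∎
      where
      open ≤-Reasoning
      split : ∀ q x p b t → q * (x * p + b * t) ≡ x * (q * p) + b * (q * t)
      split = solve-∀
      total : a ^ (n ∸ M) * a ^ suc M ≡ a ^ suc n
      total = trans (sym (^-distribˡ-+-* a (n ∸ M) (suc M)))
        (cong (a ^_) (trans (+-suc (n ∸ M) M) (cong suc (m∸n+n≡m l))))
      join : ∀ x K g b p t → x * (K * g * (b * p)) + b * (K * t * p) ≡ K * (x * g + t) * (b * p)
      join = solve-∀

  module Asymptotics
    (r : ℕ → ℕ → ℕ) (h : ℕ → ℕ)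
    (r-zero : ∀ n → r 0 n ≡ 0)
    (r-suc-zero : ∀ j → r (suc j) 0 ≡ 1)
    (r-suc : ∀ j n → r (suc j) (suc n) ≡ conv (r (suc j)) (λ i → r j i + r (suc (suc j)) i) n)
    (h-zero : h 0 ≡ 1)
    (h-suc : ∀ n → h (suc n) ≡ conv (r 1) h n)
    where

    neighbours : ℕ → ℕ → ℕ
    neighbours j n = r j n + r (suc (suc j)) n

    -- At x = 1/8, the solution of C = 1 + 2 x C² is 2; it dominates all r k.
    module _ where
      open Evaluation 8 1

      step-upper : ∀ M {f g c} → ev M f ≤ c * 8 ^ M → ev M g ≤ 4 * 8 ^ M → ev M (conv f g) ≤ c * 4 * 8 ^ M
      step-upper M {f} {g} {c} p q = *-cancelˡ-≤ (8 ^ M) {{m^n≢0 8 M}} (begin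
        8 ^ M * ev M (conv f g)     ≤⟨ ev-conv-upper f g M ⟩
        ev M f * ev M g             ≤⟨ *-mono-≤ p q ⟩
        c * 8 ^ M * (4 * 8 ^ M)     ≡⟨ rearrange c (8 ^ M) ⟩
        8 ^ M * (c * 4 * 8 ^ M)     ∎)
        where
        open ≤-Reasoning
        rearrange : ∀ c p → c * p * (4 * p) ≡ p * (c * 4 * p)
        rearrange = solve-∀

      unfold : ∀ M f g → f 0 ≡ 1 → (∀ n → f (suc n) ≡ g n) → ev (suc M) f ≡ 8 ^ suc M + ev M g
      unfold M f g p q = trans (ev-unfold M f g p q) (cong (8 ^ suc M +_) (*-identityˡ (ev M g)))

      r-upper : ∀ M k → ev M (r k) ≤ 2 * 8 ^ M
      r-upper zero    zero    = ≤-trans (≤-reflexive (r-zero 0)) z≤n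
      r-upper zero    (suc j) = ≤-trans (≤-reflexive (r-suc-zero j)) (s≤s z≤n)
      r-upper (suc M) zero    = ≤-trans (≤-reflexive (trans (ev-cong r-zero (suc M)) (zeros (suc M)))) z≤n
        where
        zeros : ∀ M → ev M (λ _ → 0) ≡ 0
        zeros zero    = refl
        zeros (suc M) = cong (1 *_) (zeros M)
      r-upper (suc M) (suc j) = begin
        ev (suc M) (r (suc j))                               ≡⟨ unfold M (r (suc j)) _ (r-suc-zero j) (r-suc j) ⟩
        8 ^ suc M + ev M (conv (r (suc j)) (neighbours j))   ≤⟨ +-monoʳ-≤ (8 ^ suc M) (step-upper M {r (suc j)} {neighbours j} {2} (r-upper M (suc j)) both) ⟩
        8 * 8 ^ M + 2 * 4 * 8 ^ M                            ≡⟨ rearrange (8 ^ M) ⟩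
        2 * 8 ^ suc M                                        ∎
        where
        open ≤-Reasoning
        rearrange : ∀ p → 8 * p + 2 * 4 * p ≡ 2 * (8 * p)
        rearrange = solve-∀
        both : ev M (neighbours j) ≤ 4 * 8 ^ M
        both = ≤-trans (≤-reflexive (ev-+ (r j) (r (suc (suc j))) M))
          (≤-trans (+-mono-≤ (r-upper M j) (r-upper M (suc (suc j)))) (≤-reflexive (double (8 ^ M))))
          where
          double : ∀ p → 2 * p + 2 * p ≡ 4 * p
          double = solve-∀

      h-upper-ev : ∀ M → ev M h ≤ 2 * 8 ^ M
      h-upper-ev zero    = ≤-trans (≤-reflexive h-zero) (s≤s z≤n)
      h-upper-ev (suc M) = begin
        ev (suc M) h                   ≡⟨ unfold M h (conv (r 1) h) h-zero h-suc ⟩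
        8 ^ suc M + ev M (conv (r 1) h) ≤⟨ +-monoʳ-≤ (8 ^ suc M) (step-upper M {r 1} {h} {2} (r-upper M 1) (≤-trans (h-upper-ev M) (*-monoˡ-≤ (8 ^ M) (s≤s (s≤s (z≤n {2})))))) ⟩
        8 * 8 ^ M + 2 * 4 * 8 ^ M      ≡⟨ rearrange (8 ^ M) ⟩
        2 * 8 ^ suc M                  ∎
        where
        open ≤-Reasoning
        rearrange : ∀ p → 8 * p + 2 * 4 * p ≡ 2 * (8 * p)
        rearrange = solve-∀

      ev-last : ∀ M f → f M ≤ ev M f
      ev-last zero    f = ≤-refl
      ev-last (suc M) f = ≤-trans (ev-last M (f ∘ suc)) (≤-trans (≤-reflexive (sym (*-identityˡ (ev M (f ∘ suc))))) (m≤n+m _ (f 0 * 8 ^ suc M)))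

      h-upper : ∀ n → h n ≤ 2 * 8 ^ n
      h-upper n = ≤-trans (ev-last n h) (h-upper-ev n)

    r≤r-suc : ∀ j n → r (suc (suc j)) n ≤ r (suc j) (suc n)
    r≤r-suc j n = begin
      r (suc (suc j)) n                        ≤⟨ m≤n+m _ (r j n) ⟩
      neighbours j n                           ≡⟨ *-identityˡ _ ⟨
      1 * neighbours j n                       ≡⟨ cong (_* neighbours j n) (r-suc-zero j) ⟨
      r (suc j) 0 * neighbours j n             ≤⟨ conv-first (r (suc j)) (neighbours j) n ⟩
      conv (r (suc j)) (neighbours j) n        ≡⟨ r-suc j n ⟨
      r (suc j) (suc n)                        ∎
      where open ≤-Reasoning

    r-positive : ∀ n j → 1 ≤ r (suc j) n
    r-positive zero    j = ≤-reflexive (sym (r-suc-zero j))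
    r-positive (suc n) j = ≤-trans (r-positive n (suc j)) (r≤r-suc j n)

    -- For labelled trees: a path of j edges from label 1 leads to a tree whose root has label j +
    -- 1.
    r≤r1 : ∀ j n → r (suc j) n ≤ r 1 (j + n)
    r≤r1 zero    n = ≤-refl
    r≤r1 (suc j) n = ≤-trans (r≤r-suc j n) (≤-trans (r≤r1 j (suc n)) (≤-reflexive (cong (r 1) (+-suc j n))))

    r1≤h : ∀ n → r 1 n ≤ h (suc n)
    r1≤h n = begin
      r 1 n          ≡⟨ *-identityʳ (r 1 n) ⟨
      r 1 n * 1      ≡⟨ cong (r 1 n *_) h-zero ⟨
      r 1 n * h 0    ≤⟨ conv-last (r 1) h n ⟩
      conv (r 1) h n ≡⟨ h-suc n ⟨
      h (suc n)      ∎
      where open ≤-Reasoning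

    h-positive : ∀ n → 1 ≤ h n
    h-positive zero    = ≤-reflexive (sym h-zero)
    h-positive (suc n) = ≤-trans (r-positive n 0) (r1≤h n)

    module _ (a b : ℕ) (1≤a : 1 ≤ a) (1≤b : 1 ≤ b) (a<8b : a < 8 * b) where
      open Evaluation a b

      -- With x = b / a > 1/8, the map y ↦ 1 + 2 x y² exceeds the identity by at least 1 / (8 b), as
      -- (8b + j)² - 4 (j + 1) (8b - 1) = (8b - j - 2)².
      increment : ∀ j → 4 * suc j * a ≤ (8 * b + j) * (8 * b + j)
      increment j with <⇒≤pred a<8b
      ... | a≤ with 8 * b
      ... | suc B = ≤-trans (*-monoʳ-≤ (4 * suc j) a≤) (≤-trans (square B (suc j)) (≤-reflexive (cong (λ z → z * z) (+-suc B j))))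
        where
        square : ∀ B i → 4 * i * B ≤ (B + i) * (B + i)
        square B i with ≤-total B i
        ... | inj₁ B≤i with m≤n⇒∃[o]m+o≡n B≤i
        ...   | o , refl = ≤-trans (m≤m+n _ (o * o)) (≤-reflexive (eq B o))
          where
          eq : ∀ B o → 4 * (B + o) * B + o * o ≡ (B + (B + o)) * (B + (B + o))
          eq = solve-∀
        square B i | inj₂ i≤B with m≤n⇒∃[o]m+o≡n i≤B
        ...   | o , refl = ≤-trans (m≤m+n _ (o * o)) (≤-reflexive (eq i o))
          where
          eq : ∀ i o → 4 * i * (i + o) + o * o ≡ (i + o + i) * (i + o + i)
          eq = solve-∀

      private
        B : ℕ
        B = 8 * b

        instance
          a≢0 : NonZero a
          a≢0 = >-nonZero 1≤a
          b≢0 : NonZero b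
          b≢0 = >-nonZero 1≤b

      reach-step : ∀ j p e₁ e₂ e₃ → (B + j) * p ≤ B * e₁ → (B + j) * p ≤ B * e₂ → (B + j) * p ≤ B * e₃ →
                   suc j * (a * (p * p)) ≤ B * (b * (e₁ * (e₂ + e₃)))
      reach-step j p e₁ e₂ e₃ l₁ l₂ l₃ = *-cancelˡ-≤ 8 (begin
        8 * (suc j * (a * (p * p)))                  ≡⟨ eq₁ (suc j) a p ⟩
        2 * (4 * suc j * a * (p * p))                ≤⟨ *-monoʳ-≤ 2 (*-monoˡ-≤ (p * p) (increment j)) ⟩
        2 * ((B + j) * (B + j) * (p * p))            ≡⟨ eq₂ (B + j) p ⟩
        (B + j) * p * ((B + j) * p + (B + j) * p)    ≤⟨ *-mono-≤ l₁ (+-mono-≤ l₂ l₃) ⟩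
        8 * b * e₁ * (8 * b * e₂ + 8 * b * e₃)       ≡⟨ eq₃ b e₁ e₂ e₃ ⟩
        8 * (8 * b * (b * (e₁ * (e₂ + e₃))))         ∎)
        where
        open ≤-Reasoning
        eq₁ : ∀ i a p → 8 * (i * (a * (p * p))) ≡ 2 * (4 * i * a * (p * p))
        eq₁ = solve-∀
        eq₂ : ∀ c p → 2 * (c * c * (p * p)) ≡ c * p * (c * p + c * p)
        eq₂ = solve-∀
        eq₃ : ∀ b x y z → 8 * b * x * (8 * b * y + 8 * b * z) ≡ 8 * (8 * b * (b * (x * (y + z))))
        eq₃ = solve-∀

      -- Both neighbours of a label above j + 1 lie above j, so one use of the recurrence raises the
      -- bound on the value at b / a from 1 + j / (8 b) to 1 + (j + 1) / (8 b). The truncation depth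
      -- doubles to make room for a product of two truncations.
      reach : ∀ j → ∃ λ M → ∀ k → j < k → (B + j) * a ^ M ≤ B * ev M (r k)
      reach zero    = 0 , λ { (suc k) _ → ≤-reflexive (trans (*-identityʳ (B + 0)) (trans (+-identityʳ B)
                        (trans (sym (*-identityʳ B)) (cong (B *_) (sym (r-suc-zero k)))))) }
      reach (suc j) with reach j
      ... | M , p = suc (M + M) , λ { (suc k) (s≤s j<k) → begin
        (B + suc j) * a ^ suc (M + M)
          ≡⟨ *-distribʳ-+ (a ^ suc (M + M)) B (suc j) ⟩
        B * a ^ suc (M + M) + suc j * (a * a ^ (M + M))
          ≡⟨ cong (λ z → B * a ^ suc (M + M) + suc j * (a * z)) (^-distribˡ-+-* a M M) ⟩
        B * a ^ suc (M + M) + suc j * (a * (a ^ M * a ^ M))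
          ≤⟨ +-monoʳ-≤ (B * a ^ suc (M + M)) (reach-step j (a ^ M) _ _ _
               (p (suc k) (m<n⇒m<1+n j<k)) (p k j<k) (p (suc (suc k)) (m<n⇒m<1+n (m<n⇒m<1+n j<k)))) ⟩
        B * a ^ suc (M + M) + B * (b * (ev M (r (suc k)) * (ev M (r k) + ev M (r (suc (suc k))))))
          ≡⟨ *-distribˡ-+ B (a ^ suc (M + M)) _ ⟨
        B * (a ^ suc (M + M) + b * (ev M (r (suc k)) * (ev M (r k) + ev M (r (suc (suc k))))))
          ≡⟨ cong (λ z → B * (a ^ suc (M + M) + b * (ev M (r (suc k)) * z))) (ev-+ (r k) (r (suc (suc k))) M) ⟨
        B * (a ^ suc (M + M) + b * (ev M (r (suc k)) * ev M (neighbours k)))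
          ≤⟨ *-monoʳ-≤ B (+-monoʳ-≤ (a ^ suc (M + M)) (*-monoʳ-≤ b (ev-conv-lower (r (suc k)) (neighbours k) M M))) ⟩
        B * (a ^ suc (M + M) + b * ev (M + M) (conv (r (suc k)) (neighbours k)))
          ≡⟨ cong (B *_) (ev-unfold (M + M) (r (suc k)) _ (r-suc-zero k) (r-suc k)) ⟨
        B * ev (suc (M + M)) (r (suc k)) ∎ }
        where open ≤-Reasoning

      1≤m*n : ∀ {m n} → 1 ≤ m → 1 ≤ n → 1 ≤ m * n
      1≤m*n = *-mono-≤

      1≤^ : ∀ {m} → 1 ≤ m → ∀ n → 1 ≤ m ^ n
      1≤^ p zero    = ≤-refl
      1≤^ p (suc n) = 1≤m*n p (1≤^ p n)

      private
        depth k : ℕ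
        depth = proj₁ (reach (4 * a))
        k = suc (4 * a)

      -- With 4 a as the argument of `reach`, each neighbour has a value of at least a / (2 b).
      -- Hence the renewal equation for `r (suc k)` has total mass at least 1 at x = b / a.
      mass : a ^ suc depth ≤ b * ev depth (neighbours k)
      mass = *-cancelˡ-≤ 8 (begin
        8 * (a * a ^ depth)                              ≡⟨ eq₁ a (a ^ depth) ⟩
        4 * a * a ^ depth + 4 * a * a ^ depth            ≤⟨ +-mono-≤ (large k ≤-refl) (large (suc (suc k)) (m<n⇒m<1+n (m<n⇒m<1+n ≤-refl))) ⟩
        B * ev depth (r k) + B * ev depth (r (suc (suc k)))  ≡⟨ *-distribˡ-+ B (ev depth (r k)) _ ⟨
        B * (ev depth (r k) + ev depth (r (suc (suc k))))    ≡⟨ cong (B *_) (ev-+ (r k) (r (suc (suc k))) depth) ⟨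
        8 * b * ev depth (neighbours k)                  ≡⟨ *-assoc 8 b _ ⟩
        8 * (b * ev depth (neighbours k))                ∎)
        where
        open ≤-Reasoning
        eq₁ : ∀ a p → 8 * (a * p) ≡ 4 * a * p + 4 * a * p
        eq₁ = solve-∀
        large : ∀ i → 4 * a < i → 4 * a * a ^ depth ≤ B * ev depth (r i)
        large i l = ≤-trans (*-monoˡ-≤ (a ^ depth) (m≤n+m (4 * a) B)) (proj₂ (reach (4 * a)) i l)

      -- Under a renewal of mass at least 1 within bounded distance, the terms r_i (b / a)^i never
      -- drop below their minimum over the initial stretch. There, r_i ≥ 1 gives the bound 1 /
      -- a^depth.
      r-lower : ∀ n i → i ≤ n → a ^ i ≤ a ^ depth * r (suc k) i * b ^ i
      r-lower-small : ∀ i → i ≤ depth → a ^ i ≤ a ^ depth * r (suc k) i * b ^ i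
      r-lower-small i l = begin
        a ^ i                               ≤⟨ ^-monoʳ-≤ a l ⟩
        a ^ depth                           ≡⟨ *-identityʳ _ ⟨
        a ^ depth * 1                       ≤⟨ *-monoʳ-≤ (a ^ depth) (1≤m*n (r-positive i k) (1≤^ 1≤b i)) ⟩
        a ^ depth * (r (suc k) i * b ^ i)   ≡⟨ *-assoc (a ^ depth) _ _ ⟨
        a ^ depth * r (suc k) i * b ^ i     ∎
        where open ≤-Reasoning
      r-lower n       zero    l = r-lower-small 0 z≤n
      r-lower (suc n) (suc i) (s≤s l) with suc i ≤? depth
      ... | yes m = r-lower-small (suc i) m
      ... | no ¬m = begin
        a ^ suc i                                              ≡⟨ cong (a ^_) (trans (+-suc (i ∸ depth) depth) (cong suc (m∸n+n≡m d≤i))) ⟨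
        a ^ (i ∸ depth + suc depth)                            ≡⟨ ^-distribˡ-+-* a (i ∸ depth) (suc depth) ⟩
        a ^ (i ∸ depth) * a ^ suc depth                        ≤⟨ *-monoʳ-≤ (a ^ (i ∸ depth)) mass ⟩
        a ^ (i ∸ depth) * (b * ev depth (neighbours k))        ≡⟨ eq₁ (a ^ (i ∸ depth)) b _ ⟩
        b * (a ^ (i ∸ depth) * ev depth (neighbours k))        ≤⟨ *-monoʳ-≤ b (ev-renewal (a ^ depth) (neighbours k) (r (suc k)) i depth d≤i
                                                                    (λ j m → r-lower n j (≤-trans m l))) ⟩
        b * (a ^ depth * conv (neighbours k) (r (suc k)) i * b ^ i)  ≡⟨ eq₂ b (a ^ depth) _ (b ^ i) ⟩
        a ^ depth * conv (neighbours k) (r (suc k)) i * b ^ suc i    ≡⟨ cong (λ z → a ^ depth * z * b ^ suc i) (trans (conv-comm (neighbours k) (r (suc k)) i) (sym (r-suc k i))) ⟩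
        a ^ depth * r (suc k) (suc i) * b ^ suc i              ∎
        where
        open ≤-Reasoning
        d≤i : depth ≤ i
        d≤i = ≤-pred (≰⇒> ¬m)
        eq₁ : ∀ p b e → p * (b * e) ≡ b * (p * e)
        eq₁ = solve-∀
        eq₂ : ∀ b p c q → b * (p * c * q) ≡ p * c * (b * q)
        eq₂ = solve-∀

      h-lower : ∃ λ K → ∀ n → a ^ n ≤ K * h n * b ^ n
      h-lower = K , bound
        where
        open ≤-Reasoning
        K : ℕ
        -- The first factor pays for the shift of the degree by k + 1 in `r≤r1` and `r1≤h`, and for
        -- all smaller n.
        K = a ^ suc k * a ^ depth
        bound : ∀ n → a ^ n ≤ K * h n * b ^ n
        bound n with suc k ≤? n
        ... | no ¬l = begin
          a ^ n                 ≤⟨ ^-monoʳ-≤ a (<⇒≤ (≰⇒> ¬l)) ⟩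
          a ^ suc k             ≡⟨ *-identityʳ _ ⟨
          a ^ suc k * 1         ≤⟨ *-monoʳ-≤ (a ^ suc k) (1≤m*n (1≤^ 1≤a depth) (1≤m*n (h-positive n) (1≤^ 1≤b n))) ⟩
          a ^ suc k * (a ^ depth * (h n * b ^ n)) ≡⟨ eq (a ^ suc k) (a ^ depth) (h n) (b ^ n) ⟩
          K * h n * b ^ n       ∎
          where
          eq : ∀ p d x y → p * (d * (x * y)) ≡ p * d * x * y
          eq = solve-∀
        ... | yes l with m≤n⇒∃[o]m+o≡n l
        ...   | m , refl = begin
          a ^ (suc k + m)       ≡⟨ ^-distribˡ-+-* a (suc k) m ⟩
          a ^ suc k * a ^ m     ≤⟨ *-monoʳ-≤ (a ^ suc k) (r-lower m m ≤-refl) ⟩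
          a ^ suc k * (a ^ depth * r (suc k) m * b ^ m)
            ≤⟨ *-monoʳ-≤ (a ^ suc k) (*-mono-≤ (*-monoʳ-≤ (a ^ depth) (≤-trans (r≤r1 k m) (r1≤h (k + m))))
                 (^-monoʳ-≤ b (m≤n+m m (suc k)))) ⟩
          a ^ suc k * (a ^ depth * h (suc k + m) * b ^ (suc k + m))
            ≡⟨ eq (a ^ suc k) (a ^ depth) (h (suc k + m)) (b ^ (suc k + m)) ⟩
          K * h (suc k + m) * b ^ (suc k + m) ∎
          where
          eq : ∀ p d x y → p * (d * x * y) ≡ p * d * x * y
          eq = solve-∀

-- States of sequences and avoidance of 1342.

module Avoidance where

  open Tree
  open import Data.Bool.Base using (Bool; true; false)
  open import Data.Empty using (⊥)
  open import Data.List.Base hiding (_∷ʳ_; lookup)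
  open import Data.List.Membership.Propositional using (_∈_)
  open import Data.List.Properties using (filter-accept; filter-reject; length-++; length-replicate; take++drop≡id; length-take)
  open import Data.List.Relation.Binary.Sublist.Propositional using (_⊆_; []; _∷_; _∷ʳ_; lookup; from∈; ⊆-trans)
  open import Data.List.Relation.Binary.Sublist.Propositional.Properties using (filter-⊆)
  open import Data.List.Relation.Unary.All as All using (All; []; _∷_)
  open import Data.List.Relation.Unary.All.Properties using (all-filter)
  open import Data.List.Relation.Unary.AllPairs using ([]; _∷_)
  open import Data.List.Relation.Unary.Any using (here; there)
  open import Data.List.Relation.Unary.Unique.Propositional using (Unique)
  open import Data.Maybe.Base using (Maybe; just; nothing)
  open import Data.Maybe.Properties using (just-injective)
  open import Data.Nat.Base
  open import Data.Nat.Properties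
  open import Data.Product.Base using (∃; _×_; _,_)
  open import Data.Sum.Base as Sum using (_⊎_; inj₁; inj₂)
  open import Function.Base using (_∘_)
  open import Relation.Binary.Definitions using (tri<; tri≈; tri>)
  open import Relation.Binary.PropositionalEquality
  open import Relation.Nullary.Decidable using (yes; no)
  open import Relation.Nullary.Negation using (¬_; contradiction)

  Has231 Has1342 Has12453 : List ℕ → Set
  Has231   w = ∃ λ b → ∃ λ c → ∃ λ a → b ∷ c ∷ a ∷ [] ⊆ w × a < b × b < c
  Has1342  w = ∃ λ a → ∃ λ c → ∃ λ d → ∃ λ b → a ∷ c ∷ d ∷ b ∷ [] ⊆ w × a < b × b < c × c < d
  Has12453 w = ∃ λ z → ∃ λ a → ∃ λ c → ∃ λ d → ∃ λ b →
               z ∷ a ∷ c ∷ d ∷ b ∷ [] ⊆ w × z < a × a < b × b < c × c < d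

  above : ℕ → List ℕ → List ℕ
  above k = filter (k <?_)

  cnt : ℕ → List ℕ → ℕ
  cnt k w = length (above k w)

  lehmer : List ℕ → List ℕ
  lehmer []      = []
  lehmer (k ∷ w) = cnt k w ∷ lehmer w

  -- The head of the code belongs to the latest step, as entries are prepended. The child c is given
  -- by cutting the state after its first c letters.
  data Walk : List ℕ → Word → Set where
    []   : Walk [] []
    step : ∀ {c cs v₁ v₂} → c ≡ length v₁ → Walk cs (v₁ ++ v₂) → Walk (c ∷ cs) (v₁ ++ true ∷ buried v₂)

  above-accept : ∀ {k x} w → k < x → above k (x ∷ w) ≡ x ∷ above k w
  above-accept w = filter-accept (_ <?_)

  above-reject : ∀ {k x} w → ¬ k < x → above k (x ∷ w) ≡ above k w
  above-reject w = filter-reject (_ <?_)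

  cnt-accept : ∀ {k x} w → k < x → cnt k (x ∷ w) ≡ suc (cnt k w)
  cnt-accept w l = cong length (above-accept w l)

  cnt-reject : ∀ {k x} w → ¬ k < x → cnt k (x ∷ w) ≡ cnt k w
  cnt-reject w l = cong length (above-reject w l)

  above-⊆ : ∀ k w → above k w ⊆ w
  above-⊆ k = filter-⊆ (k <?_)

  above-All : ∀ k w → All (k <_) (above k w)
  above-All k = all-filter (k <?_)

  ⊆-above : ∀ {k s w} → s ⊆ w → All (k <_) s → s ⊆ above k w
  ⊆-above []         []       = []
  ⊆-above {k} {w = x ∷ w} (.x ∷ʳ p) a with k <? x
  ... | yes l rewrite above-accept w l = x ∷ʳ ⊆-above p a
  ... | no ¬l rewrite above-reject w ¬l = ⊆-above p a
  ⊆-above {w = x ∷ w} (refl ∷ p) (l ∷ a) rewrite above-accept w l = refl ∷ ⊆-above p a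

  cnt-antitone : ∀ {h k} w → h ≤ k → cnt k w ≤ cnt h w
  cnt-antitone []          l = z≤n
  cnt-antitone {h} {k} (x ∷ w) l with k <? x | h <? x
  ... | yes p | yes q rewrite cnt-accept w p | cnt-accept w q = s≤s (cnt-antitone w l)
  ... | yes p | no ¬q = contradiction (≤-<-trans l p) ¬q
  ... | no ¬p | yes q rewrite cnt-reject w ¬p | cnt-accept w q = m≤n⇒m≤1+n (cnt-antitone w l)
  ... | no ¬p | no ¬q rewrite cnt-reject w ¬p | cnt-reject w ¬q = cnt-antitone w l

  cnt-strict : ∀ {h k y} w → h ≤ k → y ∈ w → h < y → y ≤ k → cnt k w < cnt h w
  cnt-strict (x ∷ w) l (here refl) h<y y≤k
    rewrite cnt-reject w (≤⇒≯ y≤k) | cnt-accept w h<y = s≤s (cnt-antitone w l)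
  cnt-strict {h} {k} (x ∷ w) l (there y∈w) h<y y≤k with k <? x | h <? x
  ... | yes p | yes q rewrite cnt-accept w p | cnt-accept w q = s≤s (cnt-strict w l y∈w h<y y≤k)
  ... | yes p | no ¬q = contradiction (≤-<-trans l p) ¬q
  ... | no ¬p | yes q rewrite cnt-reject w ¬p | cnt-accept w q = m≤n⇒m≤1+n (cnt-strict w l y∈w h<y y≤k)
  ... | no ¬p | no ¬q rewrite cnt-reject w ¬p | cnt-reject w ¬q = cnt-strict w l y∈w h<y y≤k

  cnt-gap : ∀ {h k} w → cnt k w < cnt h w → ∃ λ y → y ∈ w × h < y × y ≤ k
  cnt-gap {h} {k} (x ∷ w) l with k <? x | h <? x
  ... | no ¬p | yes q = x , here refl , q , ≮⇒≥ ¬p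
  ... | yes p | yes q rewrite cnt-accept w p | cnt-accept w q with cnt-gap w (≤-pred l)
  ...   | y , m , r = y , there m , r
  cnt-gap {h} {k} (x ∷ w) l | yes p | no ¬q rewrite cnt-accept w p | cnt-reject w ¬q with cnt-gap w (<-trans ≤-refl l)
  ...   | y , m , r = y , there m , r
  cnt-gap {h} {k} (x ∷ w) l | no ¬p | no ¬q rewrite cnt-reject w ¬p | cnt-reject w ¬q with cnt-gap w l
  ...   | y , m , r = y , there m , r

  largest-below : ∀ k w z → z < k → ∃ λ y → (y ≡ z ⊎ y ∈ w) × z ≤ y × y < k × All (λ x → x < k → x ≤ y) w
  largest-below k []      z l = z , inj₁ refl , ≤-refl , l , []
  largest-below k (x ∷ w) z l with x <? k | z <? x
  ... | yes p | yes q with largest-below k w x p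
  ...   | y , inj₁ refl , x≤y , y<k , a = y , inj₂ (here refl) , <⇒≤ q , y<k , (λ _ → ≤-refl) ∷ a
  ...   | y , inj₂ m    , x≤y , y<k , a = y , inj₂ (there m) , ≤-trans (<⇒≤ q) x≤y , y<k , (λ _ → x≤y) ∷ a
  largest-below k (x ∷ w) z l | yes p | no ¬q with largest-below k w z l
  ...   | y , e , z≤y , y<k , a = y , Sum.map₂ there e , z≤y , y<k , (λ _ → ≤-trans (≮⇒≥ ¬q) z≤y) ∷ a
  largest-below k (x ∷ w) z l | no ¬p | _ with largest-below k w z l
  ...   | y , e , z≤y , y<k , a = y , Sum.map₂ there e , z≤y , y<k , (λ p → contradiction p ¬p) ∷ a

  -- The largest entry y of w below k has the same larger entries as k, so its letter stands exactly
  -- where the letter of k is inserted.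
  predecessor : ∀ {k w} z → z ∈ w → z < k → All (k ≢_) w →
                ∃ λ y → y ∈ w × z ≤ y × y < k × cnt y w ≡ cnt k w × (∀ x → x ∈ w → y < x → k < x)
  predecessor {k} {w} z m l fresh with largest-below k w z l
  ... | y , e , z≤y , y<k , a = y , in-w e , z≤y , y<k , same w next , next
    where
    in-w : y ≡ z ⊎ y ∈ w → y ∈ w
    in-w (inj₁ refl) = m
    in-w (inj₂ y∈w)  = y∈w
    next : ∀ x → x ∈ w → y < x → k < x
    next x x∈w y<x with <-cmp x k
    ... | tri< x<k _ _ = contradiction y<x (≤⇒≯ (All.lookup a x∈w x<k))
    ... | tri≈ _ refl _ = contradiction refl (All.lookup fresh x∈w)
    ... | tri> _ _ k<x = k<x
    same : ∀ u → (∀ x → x ∈ u → y < x → k < x) → cnt y u ≡ cnt k u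
    same []      _ = refl
    same (x ∷ u) f with y <? x
    ... | yes p = trans (cnt-accept u p) (trans (cong suc (same u (λ x → f x ∘ there))) (sym (cnt-accept u (f x (here refl) p))))
    ... | no ¬p = trans (cnt-reject u ¬p) (trans (same u (λ x → f x ∘ there)) (sym (cnt-reject u (¬p ∘ <-trans y<k))))

  place : ∀ {y a b : ℕ} {w} → y ∈ w → a ∷ b ∷ [] ⊆ w → y ≢ a → y ≢ b → y ∷ a ∷ b ∷ [] ⊆ w ⊎ a ∷ y ∷ [] ⊆ w
  place (here refl) (_ ∷ʳ p)   _   _ = inj₁ (refl ∷ p)
  place (here refl) (refl ∷ p) y≢a _ = contradiction refl y≢a
  place (there m)   (x ∷ʳ p)   y≢a y≢b with place m p y≢a y≢b
  ... | inj₁ q = inj₁ (x ∷ʳ q)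
  ... | inj₂ q = inj₂ (x ∷ʳ q)
  place (there m)   (refl ∷ p) _   _ = inj₂ (refl ∷ from∈ m)

  at : Word → ℕ → Maybe Bool
  at []      _       = nothing
  at (t ∷ v) zero    = just t
  at (t ∷ v) (suc i) = at v i

  at-left : ∀ v {v′ i} → i < length v → at (v ++ v′) i ≡ at v i
  at-left (t ∷ v) {i = zero}  _       = refl
  at-left (t ∷ v) {i = suc i} (s≤s l) = at-left v l

  at-right : ∀ v {v′} i → at (v ++ v′) (length v + i) ≡ at v′ i
  at-right []      i = refl
  at-right (t ∷ v) i = at-right v i

  at-buried : ∀ v i {t} → at (buried v) i ≡ just t → t ≡ false
  at-buried (true ∷ v) i e = at-replicate (suc (length v)) i e
    where
    at-replicate : ∀ n i {t} → at (replicate n false) i ≡ just t → t ≡ false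
    at-replicate (suc n) zero    refl = refl
    at-replicate (suc n) (suc i) e    = at-replicate n i e

  Flag : Bool → ℕ → List ℕ → Set
  Flag true  y w = ∀ z → z ∷ y ∷ [] ⊆ w → ¬ y < z
  Flag false y w = ∃ λ z → z ∷ y ∷ [] ⊆ w × y < z

  Flag-∷ : ∀ t {y w k} → ¬ y < k → Flag t y w → Flag t y (k ∷ w)
  Flag-∷ true  l f z (_ ∷ʳ p)   = f z p
  Flag-∷ true  l f z (refl ∷ p) = l
  Flag-∷ false l (z , p , q)    = z , _ ∷ʳ p , q

  -- The sets of largest entries appear as `above h w` for thresholds h, which avoids ranking the
  -- entries. The letter of y is found at the index `cnt y w`, and entries too small for the state
  -- have none.
  record Represents (v : Word) (w : List ℕ) : Set where
    field
      sound    : ∀ h → cnt h w ≤ length v → ¬ Has231 (above h w)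
      complete : ∀ h → length v < cnt h w → Has231 (above h w)
      flags    : ∀ y → y ∈ w → ∀ t → at v (cnt y w) ≡ just t → Flag t y w

  open Represents

  represents-[] : Represents [] []
  represents-[] = record { sound = λ { _ _ (_ , _ , _ , () , _) } ; complete = λ _ () ; flags = λ _ () }

  Has231-∷ : ∀ {k u} → Has231 u → Has231 (k ∷ u)
  Has231-∷ (b , c , a , p , q) = b , c , a , _ ∷ʳ p , q

  module Insert (v₁ v₂ : Word) (w : List ℕ) (k : ℕ) (fresh : All (k ≢_) w)
                (length-v₁ : cnt k w ≡ length v₁) (rep : Represents (v₁ ++ v₂) w) where

    private
      v v′ : Word
      v  = v₁ ++ v₂
      v′ = v₁ ++ true ∷ buried v₂

      length-v : length v ≡ length v₁ + length v₂
      length-v = length-++ v₁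

      length-v′ : length v′ ≡ length v₁ + suc (length (buried v₂))
      length-v′ = length-++ v₁

      v₁≤v : length v₁ ≤ length v
      v₁≤v = ≤-trans (m≤m+n _ _) (≤-reflexive (sym length-v))

      v₁<v′ : length v₁ < length v′
      v₁<v′ = ≤-trans (s≤s (m≤m+n (length v₁) _)) (≤-reflexive (sym (trans length-v′ (+-suc (length v₁) _))))

      not-above : ∀ {h} → k ≤ h → cnt h (k ∷ w) ≤ length v₁
      not-above k≤h = ≤-trans (≤-reflexive (cnt-reject w (≤⇒≯ k≤h)))
                        (≤-trans (cnt-antitone w k≤h) (≤-reflexive length-v₁))

      at-end : ∀ t → at v (length v₁) ≡ just t → ∀ y → y ∈ w → cnt y w ≡ cnt k w → Flag t y w
      at-end t e y m c = flags rep y m t (trans (cong (at v) (trans c length-v₁)) e)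

      at-v₂ : ∀ {t r} → v₂ ≡ t ∷ r → at v (length v₁) ≡ just t
      at-v₂ refl = trans (cong (at v) (sym (+-identityʳ (length v₁)))) (at-right v₁ 0)

      straddle : ∀ {h z} → z ∈ above h w → z < k → cnt k w < cnt h w
      straddle {h} {z} m l = cnt-strict w (<⇒≤ (<-trans h<z l)) (lookup (above-⊆ h w) m) h<z (<⇒≤ l)
        where
        h<z : h < z
        h<z = All.lookup (above-All h w) m

      -- So few entries exceed h that all of them also exceed k, and k cannot play the 2 of a 231.
      flat : ∀ {h} → cnt h w ≤ length v₁ → ¬ Has231 (k ∷ above h w)
      flat {h} l (b , c , a , (_ ∷ʳ p) , q)         = sound rep h (≤-trans l v₁≤v) (b , c , a , p , q)
      flat {h} l (b , c , a , (refl ∷ p) , a<b , _) =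
        <⇒≱ (straddle (lookup p (there (here refl))) a<b) (≤-trans l (≤-reflexive (sym length-v₁)))

      -- Suppose k c a is a 231. The largest entry y below k is a left-to-right maximum, so it
      -- neither equals a nor comes after c. Hence y c a is a 231 that was already present among the
      -- entries above h.
      record-top : ∀ {h r} → v₂ ≡ true ∷ r → cnt h w ≤ length v → ¬ Has231 (k ∷ above h w)
      record-top {h} eq l (b , c , a , (_ ∷ʳ p) , q)         = sound rep h l (b , c , a , p , q)
      record-top {h} eq l (b , c , a , (refl ∷ p) , a<b , b<c)
        with predecessor a (lookup (above-⊆ h w) (lookup p (there (here refl)))) a<b fresh
      ... | y , y∈w , a≤y , y<k , c-eq , _ = finish (place y∈w p-w y≢c y≢a)
        where
        p-w : c ∷ a ∷ [] ⊆ w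
        p-w = ⊆-trans p (above-⊆ h w)
        y<c : y < c
        y<c = <-trans y<k b<c
        top : ∀ z → z ∷ y ∷ [] ⊆ w → ¬ y < z
        top = at-end true (at-v₂ eq) y y∈w c-eq
        y≢c : y ≢ c
        y≢c refl = <-irrefl refl y<c
        y≢a : y ≢ a
        y≢a refl = top c p-w y<c
        a<y : a < y
        a<y = ≤∧≢⇒< a≤y (y≢a ∘ sym)
        h<a : h < a
        h<a = All.lookup (above-All h w) (lookup p (there (here refl)))
        finish : y ∷ c ∷ a ∷ [] ⊆ w ⊎ c ∷ y ∷ [] ⊆ w → ⊥
        finish (inj₂ q) = top c q y<c
        finish (inj₁ q) = sound rep h l
          (y , c , a , ⊆-above q (<-trans h<a a<y ∷ <-trans h<a (<-trans a<b b<c) ∷ h<a ∷ []) , a<y , y<c)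

      sound-∷ : ∀ {h} → suc (cnt h w) ≤ length v′ → ¬ Has231 (k ∷ above h w)
      sound-∷ l = go v₂ refl (≤-trans l (≤-reflexive (trans length-v′ (+-suc (length v₁) _))))
        where
        go : ∀ {h} u → u ≡ v₂ → suc (cnt h w) ≤ suc (length v₁ + length (buried u)) → ¬ Has231 (k ∷ above h w)
        go []          refl (s≤s l) = flat (≤-trans l (≤-reflexive (+-identityʳ _)))
        go (false ∷ r) refl (s≤s l) = flat (≤-trans l (≤-reflexive (+-identityʳ _)))
        go (true ∷ r)  refl (s≤s l) = record-top refl
          (≤-trans l (≤-reflexive (trans (cong (length v₁ +_) (length-replicate (suc (length r)))) (sym length-v))))

      complete-∷ : ∀ {h} → length v′ < suc (cnt h w) → Has231 (k ∷ above h w)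
      complete-∷ {h} l = go v₂ refl (≤-trans (≤-reflexive (sym (trans length-v′ (+-suc (length v₁) _)))) (≤-pred l))
        where
        go : ∀ u → u ≡ v₂ → suc (length v₁ + length (buried u)) ≤ cnt h w → Has231 (k ∷ above h w)
        go []          refl l = Has231-∷ (complete rep h (≤-trans (≤-reflexive (cong suc length-v)) l))
        go (true ∷ r)  refl l = Has231-∷ (complete rep h (≤-trans (≤-reflexive (cong suc (trans length-v
          (cong (length v₁ +_) (sym (length-replicate (suc (length r)))))))) l))
        go (false ∷ r) refl l
          with cnt-gap {h} {k} w (≤-trans (≤-reflexive (cong suc (trans length-v₁ (sym (+-identityʳ _))))) l)
        ... | z , z∈w , h<z , z≤k
          with predecessor z z∈w (≤∧≢⇒< z≤k (All.lookup fresh z∈w ∘ sym)) fresh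
        ... | y , y∈w , z≤y , y<k , c-eq , next with at-end false (at-v₂ refl) y y∈w c-eq
        ... | x , p , y<x = k , x , y , refl ∷ ⊆-above p (<-trans h<z (≤-<-trans z≤y y<x) ∷ <-≤-trans h<z z≤y ∷ [])
                          , y<k , next x (lookup p (here refl)) y<x

    insert : Represents v′ (k ∷ w)
    sound insert h l with h <? k
    ... | yes h<k rewrite above-accept w h<k = sound-∷ l
    ... | no h≮k  rewrite above-reject w h≮k =
      sound rep h (≤-trans (≤-trans (cnt-antitone w (≮⇒≥ h≮k)) (≤-reflexive length-v₁)) v₁≤v)
    complete insert h l with h <? k
    ... | yes h<k rewrite above-accept w h<k = complete-∷ l
    ... | no h≮k  = contradiction (≤-trans (not-above (≮⇒≥ h≮k)) (<⇒≤ v₁<v′)) (<⇒≱ l)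
    flags insert y (here refl) t e = flag-k t (just-injective (trans (sym e) (trans
        (cong (at v′) (trans (cnt-reject w (<-irrefl refl)) (trans length-v₁ (sym (+-identityʳ _)))))
        (at-right v₁ 0))))
      where
      flag-k : ∀ t → t ≡ true → Flag t y (y ∷ w)
      flag-k true _ z (_ ∷ʳ p)   l = All.lookup fresh (lookup p (there (here refl))) refl
      flag-k true _ z (refl ∷ p) l = <-irrefl refl l
    flags insert y (there m) t e with <-cmp y k
    ... | tri≈ _ refl _ = contradiction refl (All.lookup fresh m)
    ... | tri> y≮k _ k<y = Flag-∷ t y≮k (flags rep y m t (trans (at-left v₁ l)
        (trans (sym (at-left v₁ l)) (trans (cong (at v′) (sym (cnt-reject w y≮k))) e))))
      where
      l : cnt y w < length v₁
      l = ≤-trans (cnt-strict w (<⇒≤ k<y) m k<y ≤-refl) (≤-reflexive length-v₁)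
    ... | tri< y<k _ _ with m≤n⇒∃[o]m+o≡n (cnt-antitone w (<⇒≤ y<k))
    ...   | o , c-eq = flag-below t (at-buried v₂ o (trans (sym (at-right v₁ (suc o)))
                         (trans (cong (at v′) (trans (+-suc (length v₁) o) (trans
                           (cong suc (trans (cong (_+ o) (sym length-v₁)) c-eq)) (sym (cnt-accept w y<k))))) e)))
      where
      flag-below : ∀ t → t ≡ false → Flag t y (k ∷ w)
      flag-below false _ = k , refl ∷ from∈ m , y<k

  Has1342-∷ : ∀ {k w} → Has231 (above k w) → Has1342 (k ∷ w)
  Has1342-∷ {k} {w} (c , d , b , p , b<c , c<d) =
    k , c , d , b , refl ∷ ⊆-trans p (above-⊆ k w) , All.lookup (above-All k w) (lookup p (there (there (here refl)))) , b<c , c<d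

  Has1342-∷⁻ : ∀ {k w} → Has1342 (k ∷ w) → Has1342 w ⊎ Has231 (above k w)
  Has1342-∷⁻ (a , c , d , b , (_ ∷ʳ p) , q) = inj₁ (a , c , d , b , p , q)
  Has1342-∷⁻ (a , c , d , b , (refl ∷ p) , a<b , b<c , c<d) =
    inj₂ (c , d , b , ⊆-above p (<-trans a<b b<c ∷ <-trans a<b (<-trans b<c c<d) ∷ a<b ∷ []) , b<c , c<d)

  avoids⇒walk : ∀ w → Unique w → ¬ Has1342 w → ∃ λ v → Walk (lehmer w) v × Represents v w
  avoids⇒walk []      []           _  = [] , [] , represents-[]
  avoids⇒walk (k ∷ w) (fresh ∷ un) av
    with avoids⇒walk w un (λ { (a , c , d , b , p , q) → av (a , c , d , b , _ ∷ʳ p , q) })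
  ... | v , W , rep = _ , step (sym length-take-v) (subst (Walk (lehmer w)) (sym v-eq) W)
                    , Insert.insert (take c v) (drop c v) w k fresh (sym length-take-v) (subst (λ u → Represents u w) (sym v-eq) rep)
    where
    c : ℕ
    c = cnt k w
    c≤v : c ≤ length v
    c≤v = ≮⇒≥ (λ l → av (Has1342-∷ (complete rep k l)))
    v-eq : take c v ++ drop c v ≡ v
    v-eq = take++drop≡id c v
    length-take-v : length (take c v) ≡ c
    length-take-v = trans (length-take c v) (m≤n⇒m⊓n≡m c≤v)

  walk⇒avoids : ∀ w {v} → Unique w → Walk (lehmer w) v → Represents v w × ¬ Has1342 w
  walk⇒avoids []      []           []  = represents-[] , λ { (_ , _ , _ , _ , () , _) }
  walk⇒avoids (k ∷ w) (fresh ∷ un) (step {v₁ = v₁} {v₂} c W) with walk⇒avoids w un W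
  ... | rep , av = Insert.insert v₁ v₂ w k fresh c rep , avoid
    where
    avoid : ¬ Has1342 (k ∷ w)
    avoid q with Has1342-∷⁻ q
    ... | inj₁ q′ = av q′
    ... | inj₂ q′ = sound rep k (≤-trans (≤-reflexive c) (≤-trans (m≤m+n _ _) (≤-reflexive (sym (length-++ v₁))))) q′

-- Enumeration of the avoiders by their Lehmer codes.

module Code where

  open Tree
  open Coefficients using (paths; h)
  open Avoidance using (Walk; []; step)
  open import Data.Bool.Base using (true; false)
  open import Data.Empty using (⊥)
  open import Data.List.Base hiding (_∷ʳ_; lookup; sum)
  open import Data.List.Membership.Propositional using (_∈_)
  open import Data.List.Membership.Propositional.Properties using (∈-++⁺ˡ; ∈-++⁺ʳ; ∈-++⁻)
  open import Data.List.Properties using (length-++; length-replicate; ∷-injectiveˡ)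
  open import Data.List.Relation.Unary.All using ([]; _∷_)
  open import Data.List.Relation.Unary.AllPairs using ([]; _∷_)
  open import Data.List.Relation.Unary.Any using (here)
  open import Data.List.Relation.Unary.Unique.Propositional using (Unique)
  import Data.List.Relation.Unary.Unique.Propositional.Properties as Unique
  open import Data.Nat.Base
  open import Data.Nat.ListAction using (sum)
  open import Data.Nat.Properties
  open import Data.Product.Base using (∃; ∃₂; _×_; _,_)
  open import Data.Sum.Base using (inj₁; inj₂)
  open import Function.Base using (_∘_)
  open import Relation.Binary.PropositionalEquality

  private
    variable
      A B C : Set

  concatFrom : (ℕ → A → List B) → ℕ → List A → List B
  concatFrom f i []       = []
  concatFrom f i (x ∷ xs) = f i x ++ concatFrom f (suc i) xs

  concatFrom-map : (f : ℕ → A → List B) (g : C → A) → ∀ i xs →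
                   concatFrom f i (map g xs) ≡ concatFrom (λ j → f j ∘ g) i xs
  concatFrom-map f g i []       = refl
  concatFrom-map f g i (x ∷ xs) = cong (f i (g x) ++_) (concatFrom-map f g (suc i) xs)

  length-concatFrom : (f : ℕ → A → List B) (g : A → ℕ) → (∀ i x → length (f i x) ≡ g x) →
                      ∀ i xs → length (concatFrom f i xs) ≡ sum (map g xs)
  length-concatFrom f g p i []       = refl
  length-concatFrom f g p i (x ∷ xs) =
    trans (length-++ (f i x)) (cong₂ _+_ (p i x) (length-concatFrom f g p (suc i) xs))

  concatFrom-≥ : (f : ℕ → A → List B) (T : ℕ → B → Set) → (∀ i x {y} → y ∈ f i x → T i y) →
                 ∀ i xs {y} → y ∈ concatFrom f i xs → ∃ λ j → i ≤ j × T j y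
  concatFrom-≥ f T t i (x ∷ xs) m with ∈-++⁻ (f i x) m
  ... | inj₁ m′ = i , ≤-refl , t i x m′
  ... | inj₂ m′ with concatFrom-≥ f T t (suc i) xs m′
  ...   | j , l , q = j , ≤-trans (n≤1+n i) l , q

  concatFrom-unique : (f : ℕ → A → List B) (T : ℕ → B → Set) → (∀ i x → Unique (f i x)) →
                      (∀ i x {y} → y ∈ f i x → T i y) → (∀ {i j y} → T i y → T j y → i ≡ j) →
                      ∀ i xs → Unique (concatFrom f i xs)
  concatFrom-unique f T u t inj i []       = []
  concatFrom-unique f T u t inj i (x ∷ xs) =
    Unique.++⁺ (u i x) (concatFrom-unique f T u t inj (suc i) xs) disjoint
    where
    disjoint : ∀ {y} → y ∈ f i x × y ∈ concatFrom f (suc i) xs → ⊥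
    disjoint (m , m′) with concatFrom-≥ f T t (suc i) xs m′
    ... | j , l , q = <-irrefl (inj (t i x m) q) l

  reindex : (g : ℕ → List B) → ∀ {i j y} → i ≡ j → y ∈ g i → y ∈ g j
  reindex g refl m = m

  child : Word → Word → Word
  child v₁ v₂ = v₁ ++ true ∷ buried v₂

  ∈-children : (f : ℕ → Word → List B) → ∀ i v₁ v₂ {y} → y ∈ f (i + length v₁) (child v₁ v₂) →
               y ∈ concatFrom f i (children (v₁ ++ v₂))
  ∈-children f i []       []      m = ∈-++⁺ˡ (reindex (λ j → f j _) (+-identityʳ i) m)
  ∈-children f i []       (t ∷ v) m = ∈-++⁺ˡ (reindex (λ j → f j _) (+-identityʳ i) m)
  ∈-children f i (t ∷ v₁) v₂      m = ∈-++⁺ʳ (f i _)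
    (subst (_ ∈_) (sym (concatFrom-map f (t ∷_) (suc i) (children (v₁ ++ v₂))))
      (∈-children (λ j → f j ∘ (t ∷_)) (suc i) v₁ v₂ (reindex (λ j → f j (t ∷ child v₁ v₂)) (+-suc i (length v₁)) m)))

  ∈-children⁻ : (f : ℕ → Word → List B) → ∀ i v {y} → y ∈ concatFrom f i (children v) →
                ∃₂ λ v₁ v₂ → v ≡ v₁ ++ v₂ × y ∈ f (i + length v₁) (child v₁ v₂)
  ∈-children⁻ f i [] m with ∈-++⁻ (f i (true ∷ [])) m
  ... | inj₁ m′ = [] , [] , refl , reindex (λ j → f j _) (sym (+-identityʳ i)) m′
  ∈-children⁻ f i (t ∷ v) m with ∈-++⁻ (f i (true ∷ buried (t ∷ v))) m
  ... | inj₁ m′ = [] , t ∷ v , refl , reindex (λ j → f j _) (sym (+-identityʳ i)) m′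
  ... | inj₂ m′ with ∈-children⁻ (λ j → f j ∘ (t ∷_)) (suc i) v (subst (_ ∈_) (concatFrom-map f (t ∷_) (suc i) (children v)) m′)
  ...   | v₁ , v₂ , eq , m″ = t ∷ v₁ , v₂ , cong (t ∷_) eq , reindex (λ j → f j (t ∷ child v₁ v₂)) (sym (+-suc i (length v₁))) m″

  codesFrom : ℕ → Word → List ℕ → List (List ℕ)
  codesFrom zero    v acc = acc ∷ []
  codesFrom (suc n) v acc = concatFrom (λ i v′ → codesFrom n v′ (i ∷ acc)) 0 (children v)

  codes : ℕ → List (List ℕ)
  codes n = codesFrom n [] []

  length-codesFrom : ∀ n v acc → length (codesFrom n v acc) ≡ paths n v
  length-codesFrom zero    v acc = refl
  length-codesFrom (suc n) v acc =
    length-concatFrom _ (paths n) (λ i v′ → length-codesFrom n v′ (i ∷ acc)) 0 (children v)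

  length-codes : ∀ n → length (codes n) ≡ h n
  length-codes n = length-codesFrom n [] []

  codesFrom-walk : ∀ n v acc {cs} → Walk acc v → cs ∈ codesFrom n v acc → ∃ (Walk cs)
  codesFrom-walk zero    v acc W (here refl) = v , W
  codesFrom-walk (suc n) v acc W m with ∈-children⁻ (λ i v′ → codesFrom n v′ (i ∷ acc)) 0 v m
  ... | v₁ , v₂ , refl , m′ = codesFrom-walk n (child v₁ v₂) (length v₁ ∷ acc) (step refl W) m′

  codesFrom-suffix : ∀ n v acc {cs} → cs ∈ codesFrom n v acc → ∃ λ ds → length ds ≡ n × cs ≡ ds ++ acc
  codesFrom-suffix zero    v acc (here refl) = [] , refl , refl
  codesFrom-suffix (suc n) v acc m with ∈-children⁻ (λ i v′ → codesFrom n v′ (i ∷ acc)) 0 v m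
  ... | v₁ , v₂ , _ , m′ with codesFrom-suffix n (child v₁ v₂) (length v₁ ∷ acc) m′
  ...   | ds , l , refl = ds ++ length v₁ ∷ [] , trans (length-++ ds) (trans (+-comm (length ds) 1) (cong suc l))
                        , sym (++-assoc ds (length v₁ ∷ []) acc)
    where open import Data.List.Properties using (++-assoc)

  -- Lists from different branches differ at index n, where the number of the chosen child stands.
  codesFrom-unique : ∀ n v acc → Unique (codesFrom n v acc)
  codesFrom-unique zero    v acc = [] ∷ []
  codesFrom-unique (suc n) v acc = concatFrom-unique _ Ends
    (λ i v′ → codesFrom-unique n v′ (i ∷ acc)) (λ i v′ → codesFrom-suffix n v′ (i ∷ acc)) inj 0 (children v)
    where
    Ends : ℕ → List ℕ → Set
    Ends i cs = ∃ λ ds → length ds ≡ n × cs ≡ ds ++ i ∷ acc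
    heads : ∀ (ds es : List ℕ) {i j} → length ds ≡ length es → ds ++ i ∷ acc ≡ es ++ j ∷ acc → i ≡ j
    heads []       []       l eq = ∷-injectiveˡ eq
    heads (_ ∷ ds) (_ ∷ es) l eq = heads ds es (suc-injective l) (cong (drop 1) eq)
    inj : ∀ {i j cs} → Ends i cs → Ends j cs → i ≡ j
    inj (ds , l , refl) (es , l′ , eq) = heads ds es (trans l (sym l′)) eq

  codes-unique : ∀ n → Unique (codes n)
  codes-unique n = codesFrom-unique n [] []

  codes-walk : ∀ n {cs} → cs ∈ codes n → ∃ (Walk cs)
  codes-walk n = codesFrom-walk n [] [] []

  codes-length : ∀ n {cs} → cs ∈ codes n → length cs ≡ n
  codes-length n m with codesFrom-suffix n [] [] m
  ... | ds , l , refl = trans (length-++ ds) (trans (+-identityʳ (length ds)) l)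

  walk-codesFrom : ∀ {cs v} → Walk cs v → ∀ n {c} → c ∈ codesFrom n v cs → c ∈ codes (n + length cs)
  walk-codesFrom []         n m = reindex codes (sym (+-identityʳ n)) m
  walk-codesFrom (step {cs = cs} {v₁} {v₂} refl W) n m = reindex codes (sym (+-suc n (length cs)))
    (walk-codesFrom W (suc n) (∈-children (λ i v′ → codesFrom n v′ (i ∷ cs)) 0 v₁ v₂ m))

  walk-codes : ∀ {cs v} → Walk cs v → cs ∈ codes (length cs)
  walk-codes W = walk-codesFrom W 0 (here refl)

  -- This characterises Lehmer codes: at most all later entries are larger. Codes of walks satisfy
  -- it because a state is never longer than its sequence.
  data Bounded : List ℕ → Set where
    []  : Bounded []
    _∷_ : ∀ {c cs} → c ≤ length cs → Bounded cs → Bounded (c ∷ cs)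

  walk-length : ∀ {cs v} → Walk cs v → length v ≤ length cs
  walk-length [] = z≤n
  walk-length (step {cs = cs} {v₁} {v₂} refl W) = begin
    length (child v₁ v₂)                   ≡⟨ length-++ v₁ ⟩
    length v₁ + suc (length (buried v₂))   ≡⟨ +-suc (length v₁) _ ⟩
    suc (length v₁ + length (buried v₂))   ≤⟨ s≤s (+-monoʳ-≤ (length v₁) (buried-≤ v₂)) ⟩
    suc (length v₁ + length v₂)            ≡⟨ cong suc (length-++ v₁) ⟨
    suc (length (v₁ ++ v₂))                ≤⟨ s≤s (walk-length W) ⟩
    suc (length cs)                        ∎
    where
    open ≤-Reasoning
    buried-≤ : ∀ v → length (buried v) ≤ length v
    buried-≤ []          = z≤n
    buried-≤ (true ∷ v)  = ≤-reflexive (length-replicate (suc (length v)))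
    buried-≤ (false ∷ v) = z≤n

  walk-bounded : ∀ {cs v} → Walk cs v → Bounded cs
  walk-bounded []         = []
  walk-bounded (step {v₁ = v₁} refl W) =
    ≤-trans (≤-trans (m≤m+n (length v₁) _) (≤-reflexive (sym (length-++ v₁)))) (walk-length W) ∷ walk-bounded W

-- Decoding of Lehmer codes, masks and merging.

module Decode where

  open Avoidance using (cnt; above; lehmer)
  open Code using (Bounded; []; _∷_)
  open import Data.Bool.Base using (Bool; true; false)
  open import Data.List.Base hiding (_∷ʳ_; lookup; sum; merge)
  open import Data.List.Membership.Propositional using (_∈_)
  open import Data.List.Membership.Propositional.Properties using (∈-∃++)
  open import Data.List.Properties using (length-++; filter-++; filter-all; filter-none; ++-identityʳ; ∷-injective)
  open import Data.List.Relation.Binary.Permutation.Propositional using (_↭_; ↭-refl; ↭-sym; ↭-trans; prep)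
  open import Data.List.Relation.Binary.Permutation.Propositional.Properties using (shift; drop-mid; ↭-length; filter-↭; ∈-resp-↭)
  open import Data.List.Relation.Binary.Sublist.Propositional using (_⊆_; []; _∷_; _∷ʳ_; lookup; minimum)
  open import Data.List.Relation.Binary.Sublist.Propositional.Properties using (All-resp-⊆)
  open import Data.List.Relation.Unary.All as All using (All; []; _∷_)
  open import Data.List.Relation.Unary.All.Properties using (++⁻) renaming (++⁺ to All-++⁺)
  open import Data.List.Relation.Unary.AllPairs using (AllPairs; []; _∷_)
  open import Data.List.Relation.Unary.Any using (here)
  open import Data.Nat.Base hiding (_⊔_)
  open import Data.Nat.Properties
  open import Data.Product.Base using (∃; ∃₂; _×_; _,_; proj₂)
  open import Relation.Binary.PropositionalEquality
  open import Relation.Nullary.Negation using (contradiction)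

  private
    variable
      A : Set

  Desc : List ℕ → Set
  Desc = AllPairs _>_

  AllPairs-⊆ : ∀ {R : A → A → Set} {xs ys} → xs ⊆ ys → AllPairs R ys → AllPairs R xs
  AllPairs-⊆ []         []       = []
  AllPairs-⊆ (y ∷ʳ p)   (a ∷ as) = AllPairs-⊆ p as
  AllPairs-⊆ (refl ∷ p) (a ∷ as) = All-resp-⊆ p a ∷ AllPairs-⊆ p as

  desc-middle : ∀ A₁ {k A₂} → Desc (A₁ ++ k ∷ A₂) → All (k <_) A₁ × All (_< k) A₂ × Desc (A₁ ++ A₂)
  desc-middle []       (a ∷ as) = [] , a , as
  desc-middle (x ∷ A₁) (a ∷ as) with desc-middle A₁ as | ++⁻ A₁ a
  ... | b₁ , b₂ , d | a₁ , l ∷ a₂ = l ∷ b₁ , b₂ , (All-++⁺ a₁ a₂ ∷ d)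

  cnt-middle : ∀ {w k} A₁ {A₂} → w ↭ A₁ ++ A₂ → All (k <_) A₁ → All (_< k) A₂ → cnt k w ≡ length A₁
  cnt-middle {w} {k} A₁ {A₂} p a₁ a₂ = begin
    cnt k w                          ≡⟨ ↭-length (filter-↭ (k <?_) p) ⟩
    cnt k (A₁ ++ A₂)                 ≡⟨ cong length (filter-++ (k <?_) A₁ A₂) ⟩
    length (above k A₁ ++ above k A₂) ≡⟨ cong₂ (λ x y → length (x ++ y)) (filter-all (k <?_) a₁)
                                          (filter-none (k <?_) (All.map (λ l m → <-asym l m) a₂)) ⟩
    length (A₁ ++ [])                ≡⟨ cong length (++-identityʳ A₁) ⟩
    length A₁                        ∎
    where open ≡-Reasoning

  -- Inverse of the Lehmer code: in the descending list A of values still available, the value at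
  -- index c has c larger ones. The empty result for an index out of range is a default, which
  -- `Bounded` excludes.
  pick : List ℕ → List ℕ → List ℕ
  pick []       A = []
  pick (c ∷ cs) A with drop c A
  ... | []     = []
  ... | k ∷ A₂ = k ∷ pick cs (take c A ++ A₂)

  take-length-++ : ∀ (xs : List A) {ys} → take (length xs) (xs ++ ys) ≡ xs
  take-length-++ []       = refl
  take-length-++ (x ∷ xs) = cong (x ∷_) (take-length-++ xs)

  drop-length-++ : ∀ (xs : List A) {ys} → drop (length xs) (xs ++ ys) ≡ ys
  drop-length-++ []       = refl
  drop-length-++ (x ∷ xs) = drop-length-++ xs

  pick-middle : ∀ A₁ {k A₂ c} cs → c ≡ length A₁ → pick (c ∷ cs) (A₁ ++ k ∷ A₂) ≡ k ∷ pick cs (A₁ ++ A₂)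
  pick-middle A₁ {k} {A₂} cs refl
    rewrite drop-length-++ A₁ {k ∷ A₂} | take-length-++ A₁ {k ∷ A₂} = refl

  pick-lehmer : ∀ w A → w ↭ A → Desc A → pick (lehmer w) A ≡ w
  pick-lehmer []      A p d = refl
  pick-lehmer (k ∷ w) A p d with ∈-∃++ (∈-resp-↭ p (here refl))
  ... | A₁ , A₂ , refl with desc-middle A₁ d
  ...   | a₁ , a₂ , d′ = trans (pick-middle A₁ (lehmer w) (cnt-middle A₁ w↭ a₁ a₂))
                               (cong (k ∷_) (pick-lehmer w (A₁ ++ A₂) w↭ d′))
    where
    w↭ : w ↭ A₁ ++ A₂
    w↭ = drop-mid [] A₁ p

  split-at : ∀ c (xs : List A) → c < length xs → ∃ λ ys → ∃₂ λ x zs → xs ≡ ys ++ x ∷ zs × c ≡ length ys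
  split-at zero    (x ∷ xs) l = [] , x , xs , refl , refl
  split-at (suc c) (x ∷ xs) (s≤s l) with split-at c xs l
  ... | ys , y , zs , refl , refl = x ∷ ys , y , zs , refl , refl

  length-middle : ∀ (xs : List A) {x ys n} → suc n ≡ length (xs ++ x ∷ ys) → n ≡ length (xs ++ ys)
  length-middle []       e = suc-injective e
  length-middle (_ ∷ xs) {n = zero}  e = contradiction (suc-injective e) (λ e′ → 0≢1+n (trans e′ (trans (length-++ xs) (+-suc _ _))))
  length-middle (_ ∷ xs) {n = suc n} e = cong suc (length-middle xs (suc-injective e))

  pick-↭ : ∀ {cs} A → Bounded cs → length cs ≡ length A → pick cs A ↭ A
  pick-↭ []      []                    e = ↭-refl
  pick-↭ {c ∷ cs} A (l ∷ b) e with split-at c A (≤-trans (s≤s l) (≤-reflexive e))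
  ... | A₁ , k , A₂ , refl , c-eq rewrite pick-middle A₁ {k} {A₂} cs c-eq =
    ↭-trans (prep k (pick-↭ (A₁ ++ A₂) b (length-middle A₁ e))) (↭-sym (shift k A₁ A₂))

  lehmer-pick : ∀ {cs} A → Bounded cs → length cs ≡ length A → Desc A → lehmer (pick cs A) ≡ cs
  lehmer-pick A []                e d = refl
  lehmer-pick {c ∷ cs} A (l ∷ b) e d with split-at c A (≤-trans (s≤s l) (≤-reflexive e))
  ... | A₁ , k , A₂ , refl , c-eq rewrite pick-middle A₁ {k} {A₂} cs c-eq with desc-middle A₁ d
  ...   | a₁ , a₂ , d′ = cong₂ _∷_
    (trans (cnt-middle A₁ (pick-↭ (A₁ ++ A₂) b (length-middle A₁ e)) a₁ a₂) (sym c-eq))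
    (lehmer-pick (A₁ ++ A₂) b (length-middle A₁ e) d′)

  trues falses : List Bool → ℕ
  trues []          = 0
  trues (true ∷ V)  = suc (trues V)
  trues (false ∷ V) = trues V
  falses []          = 0
  falses (true ∷ V)  = falses V
  falses (false ∷ V) = suc (falses V)

  trues+falses : ∀ V → trues V + falses V ≡ length V
  trues+falses []          = refl
  trues+falses (true ∷ V)  = cong suc (trues+falses V)
  trues+falses (false ∷ V) = trans (+-suc (trues V) (falses V)) (cong suc (trues+falses V))

  keepT keepF : List Bool → List A → List A
  keepT (true ∷ V)  (x ∷ xs) = x ∷ keepT V xs
  keepT (false ∷ V) (x ∷ xs) = keepT V xs
  keepT _           _        = []
  keepF (true ∷ V)  (x ∷ xs) = keepF V xs
  keepF (false ∷ V) (x ∷ xs) = x ∷ keepF V xs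
  keepF _           _        = []

  -- The mask tells for each position which list supplies the entry. The last clause also truncates
  -- on a shortage, which the hypotheses on `trues` and `falses` exclude.
  merge : List Bool → List A → List A → List A
  merge (true ∷ P)  (d ∷ D) W       = d ∷ merge P D W
  merge (false ∷ P) D       (w ∷ W) = w ∷ merge P D W
  merge _           _       _       = []

  keepT-⊆ : ∀ V (xs : List A) → keepT V xs ⊆ xs
  keepT-⊆ []          xs       = minimum xs
  keepT-⊆ (true ∷ V)  []       = []
  keepT-⊆ (false ∷ V) []       = []
  keepT-⊆ (true ∷ V)  (x ∷ xs) = refl ∷ keepT-⊆ V xs
  keepT-⊆ (false ∷ V) (x ∷ xs) = x ∷ʳ keepT-⊆ V xs

  keepF-⊆ : ∀ V (xs : List A) → keepF V xs ⊆ xs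
  keepF-⊆ []          xs       = minimum xs
  keepF-⊆ (true ∷ V)  []       = []
  keepF-⊆ (false ∷ V) []       = []
  keepF-⊆ (true ∷ V)  (x ∷ xs) = x ∷ʳ keepF-⊆ V xs
  keepF-⊆ (false ∷ V) (x ∷ xs) = refl ∷ keepF-⊆ V xs

  length-keepT : ∀ V (xs : List A) → length V ≤ length xs → length (keepT V xs) ≡ trues V
  length-keepT []          xs       l       = refl
  length-keepT (true ∷ V)  (x ∷ xs) (s≤s l) = cong suc (length-keepT V xs l)
  length-keepT (false ∷ V) (x ∷ xs) (s≤s l) = length-keepT V xs l

  length-keepF : ∀ V (xs : List A) → length V ≤ length xs → length (keepF V xs) ≡ falses V
  length-keepF []          xs       l       = refl
  length-keepF (true ∷ V)  (x ∷ xs) (s≤s l) = length-keepF V xs l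
  length-keepF (false ∷ V) (x ∷ xs) (s≤s l) = cong suc (length-keepF V xs l)

  keep-↭ : ∀ V (xs : List A) → length V ≤ length xs → keepT V xs ++ keepF V xs ++ drop (length V) xs ↭ xs
  keep-↭ []          xs       l       = ↭-refl
  keep-↭ (true ∷ V)  (x ∷ xs) (s≤s l) = prep x (keep-↭ V xs l)
  keep-↭ (false ∷ V) (x ∷ xs) (s≤s l) = ↭-trans (shift x (keepT V xs) _) (prep x (keep-↭ V xs l))

  merge-↭ : ∀ P {D W : List A} → length D ≡ trues P → length W ≡ falses P → merge P D W ↭ D ++ W
  merge-↭ []          {[]}    {[]}    _ _ = ↭-refl
  merge-↭ (true ∷ P)  {d ∷ D} {W}     e f = prep d (merge-↭ P (suc-injective e) f)
  merge-↭ (false ∷ P) {D}     {w ∷ W} e f =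
    ↭-trans (prep w (merge-↭ P e (suc-injective f))) (↭-sym (shift w D W))

  length-merge : ∀ P {D W : List A} → length D ≡ trues P → length W ≡ falses P → length (merge P D W) ≡ length P
  length-merge P {D} {W} e f =
    trans (↭-length (merge-↭ P e f)) (trans (length-++ D) (trans (cong₂ _+_ e f) (trues+falses P)))

  -- The threshold β separates the two sources, so the size of each entry reveals the letter of the
  -- mask.
  merge-injective : ∀ {β} P P′ {D D′ W W′} → length D ≡ trues P → length W ≡ falses P →
                    length D′ ≡ trues P′ → length W′ ≡ falses P′ →
                    All (_< β) D → All (_< β) D′ → All (β ≤_) W → All (β ≤_) W′ →
                    merge P D W ≡ merge P′ D′ W′ → P ≡ P′ × D ≡ D′ × W ≡ W′
  merge-injective [] [] {[]} {[]} {[]} {[]} _ _ _ _ _ _ _ _ _ = refl , refl , refl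
  merge-injective [] (true ∷ P′)  {D′ = _ ∷ _} _ _ _ _ _ _ _ _ ()
  merge-injective [] (false ∷ P′) {W′ = _ ∷ _} _ _ _ _ _ _ _ _ ()
  merge-injective (true ∷ P)  [] {D = _ ∷ _} _ _ _ _ _ _ _ _ ()
  merge-injective (false ∷ P) [] {W = _ ∷ _} _ _ _ _ _ _ _ _ ()
  merge-injective (true ∷ P) (true ∷ P′) {_ ∷ _} {_ ∷ _} e f e′ f′ (_ ∷ a) (_ ∷ a′) b b′ eq
    with refl , eq′ ← ∷-injective eq
    with refl , refl , refl ← merge-injective P P′ (suc-injective e) f (suc-injective e′) f′ a a′ b b′ eq′
    = refl , refl , refl
  merge-injective (false ∷ P) (false ∷ P′) {W = _ ∷ _} {_ ∷ _} e f e′ f′ a a′ (_ ∷ b) (_ ∷ b′) eq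
    with refl , eq′ ← ∷-injective eq
    with refl , refl , refl ← merge-injective P P′ e (suc-injective f) e′ (suc-injective f′) a a′ b b′ eq′
    = refl , refl , refl
  merge-injective (true ∷ P) (false ∷ P′) {_ ∷ _} {W′ = _ ∷ _} e f e′ f′ (x ∷ _) _ _ (y ∷ _) eq
    with refl , _ ← ∷-injective eq = contradiction x (≤⇒≯ y)
  merge-injective (false ∷ P) (true ∷ P′) {D′ = _ ∷ _} {_ ∷ _} e f e′ f′ _ (x ∷ _) (y ∷ _) _ eq
    with refl , _ ← ∷-injective eq = contradiction x (≤⇒≯ y)

  keepT-injective : ∀ V V′ xs → Desc xs → length V ≤ length xs → length V ≡ length V′ →
                    keepT V xs ≡ keepT V′ xs → V ≡ V′
  keepT-injective []          []           xs       d        l       e eq = refl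
  keepT-injective (true ∷ V)  (true ∷ V′)  (x ∷ xs) (_ ∷ d)  (s≤s l) e eq =
    cong (true ∷_) (keepT-injective V V′ xs d l (suc-injective e) (proj₂ (∷-injective eq)))
  keepT-injective (false ∷ V) (false ∷ V′) (x ∷ xs) (_ ∷ d)  (s≤s l) e eq =
    cong (false ∷_) (keepT-injective V V′ xs d l (suc-injective e) eq)
  keepT-injective (true ∷ V)  (false ∷ V′) (x ∷ xs) (a ∷ d)  l       e eq =
    contradiction (All.lookup a (lookup (keepT-⊆ V′ xs) (subst (x ∈_) eq (here refl)))) (<-irrefl refl)
  keepT-injective (false ∷ V) (true ∷ V′)  (x ∷ xs) (a ∷ d)  l       e eq =
    contradiction (All.lookup a (lookup (keepT-⊆ V xs) (subst (x ∈_) (sym eq) (here refl)))) (<-irrefl refl)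

-- Boolean definitions and their combinatorial meaning.

module Bridge where

  open import Defs
  open Avoidance using (Has12453)
  open import Data.Bool.Base using (Bool; true; false; not; T)
  open import Data.Bool.ListAction using (all; any)
  open import Data.Bool.Properties using (T-≡)
  open import Data.List.Base using (List; []; _∷_; _++_; map; length; upTo; downFrom; concatMap; filterᵇ; zip)
  open import Data.List.Membership.Propositional using (_∈_)
  open import Data.List.Membership.Propositional.Properties
  open import Data.List.Properties using (∷-injective; length-downFrom)
  open import Data.List.Relation.Binary.Permutation.Propositional using (_↭_; ↭-refl; ↭-sym; ↭-trans; prep)
  open import Data.List.Relation.Binary.Permutation.Propositional.Properties using (shift; ↭-length; All-resp-↭)
  open import Data.List.Relation.Binary.Sublist.Propositional using (_⊆_; []; _∷_; _∷ʳ_)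
  open import Data.List.Relation.Unary.All as All using (All; []; _∷_)
  open import Data.List.Relation.Unary.AllPairs using ([]; _∷_)
  open import Data.List.Relation.Unary.Any using (here; there)
  open import Data.List.Relation.Unary.Unique.Propositional using (Unique)
  import Data.List.Relation.Unary.Unique.Propositional.Properties as Unique
  open import Data.Nat.Base
  open import Data.Nat.Properties
  open import Data.Product.Base using (∃; _×_; _,_; proj₁; proj₂)
  open import Data.Sum.Base using (inj₁; inj₂)
  open import Function.Base using (_∘_)
  open import Function.Bundles using (Equivalence)
  open import Relation.Binary.PropositionalEquality
  open import Relation.Nullary.Negation using (¬_; contradiction)

  private
    variable
      A B : Set

  remove-middle : ∀ {x : A} {xs} ys {zs} → All (x ≢_) xs → (∀ {y} → y ∈ x ∷ xs → y ∈ ys ++ x ∷ zs) →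
                  ∀ {y} → y ∈ xs → y ∈ ys ++ zs
  remove-middle ys a f m with ∈-++⁻ ys (f (there m))
  ... | inj₁ m′         = ∈-++⁺ˡ m′
  ... | inj₂ (here refl) = contradiction refl (All.lookup a m)
  ... | inj₂ (there m′) = ∈-++⁺ʳ ys m′

  length-middle′ : ∀ (ys : List A) {x zs} → length (ys ++ x ∷ zs) ≡ suc (length (ys ++ zs))
  length-middle′ []       = refl
  length-middle′ (y ∷ ys) = cong suc (length-middle′ ys)

  unique-length : ∀ {xs ys : List A} → Unique xs → (∀ {x} → x ∈ xs → x ∈ ys) → length xs ≤ length ys
  unique-length []       f = z≤n
  unique-length (a ∷ un) f with ∈-∃++ (f (here refl))
  ... | ys , zs , refl = ≤-trans (s≤s (unique-length un (remove-middle ys a f)))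
                           (≤-reflexive (sym (length-middle′ ys)))

  unique-↭ : ∀ {xs ys : List A} → Unique xs → (∀ {x} → x ∈ xs → x ∈ ys) → length ys ≤ length xs → xs ↭ ys
  unique-↭ {ys = []}     []       f l = ↭-refl
  unique-↭ {xs = x ∷ _}  (a ∷ un) f l with ∈-∃++ (f (here refl))
  ... | ys , zs , refl = ↭-trans
    (prep x (unique-↭ un (remove-middle ys a f) (≤-pred (≤-trans (≤-reflexive (sym (length-middle′ ys))) l))))
    (↭-sym (shift x ys zs))

  ∈-filterᵇ⁺ : ∀ (f : A → Bool) {x xs} → x ∈ xs → f x ≡ true → x ∈ filterᵇ f xs
  ∈-filterᵇ⁺ f {xs = y ∷ xs} (here refl) e rewrite e = here refl
  ∈-filterᵇ⁺ f {xs = y ∷ xs} (there m)   e with f y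
  ... | true  = there (∈-filterᵇ⁺ f m e)
  ... | false = ∈-filterᵇ⁺ f m e

  ∈-filterᵇ⁻ : ∀ (f : A → Bool) {x} xs → x ∈ filterᵇ f xs → x ∈ xs × f x ≡ true
  ∈-filterᵇ⁻ f (y ∷ xs) m with f y in eq
  ∈-filterᵇ⁻ f (y ∷ xs) (here refl) | true = here refl , eq
  ∈-filterᵇ⁻ f (y ∷ xs) (there m)   | true with ∈-filterᵇ⁻ f xs m
  ... | m′ , e = there m′ , e
  ∈-filterᵇ⁻ f (y ∷ xs) m           | false with ∈-filterᵇ⁻ f xs m
  ... | m′ , e = there m′ , e

  filterᵇ-unique : ∀ (f : A → Bool) {xs} → Unique xs → Unique (filterᵇ f xs)
  filterᵇ-unique f {[]}     []       = []
  filterᵇ-unique f {x ∷ xs} (a ∷ un) with f x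
  ... | false = filterᵇ-unique f un
  ... | true  = All.tabulate (λ m → All.lookup a (proj₁ (∈-filterᵇ⁻ f xs m))) ∷ filterᵇ-unique f un

  concatMap-unique : (f : A → List B) → ∀ {xs} → Unique xs → (∀ x → x ∈ xs → Unique (f x)) →
                     (∀ {x x′ y} → x ∈ xs → x′ ∈ xs → y ∈ f x → y ∈ f x′ → x ≡ x′) → Unique (concatMap f xs)
  concatMap-unique f {[]}     []       u inj = []
  concatMap-unique f {x ∷ xs} (a ∷ un) u inj = Unique.++⁺ (u x (here refl))
    (concatMap-unique f un (λ x′ → u x′ ∘ there) (λ m m′ → inj (there m) (there m′))) disjoint
    where
    disjoint : ∀ {y} → ¬ (y ∈ f x × y ∈ concatMap f xs)
    disjoint (m , m′) with find (∈-concatMap⁻ f {xs = xs} m′)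
      where open import Data.List.Membership.Propositional using (find)
    ... | x′ , x′∈ , q = All.lookup a x′∈ (inj (here refl) (there x′∈) m q)

  ∈-words : ∀ n k {p} → length p ≡ n → All (_< k) p → p ∈ words n k
  ∈-words zero    k {[]}    refl []      = here refl
  ∈-words (suc n) k {x ∷ p} e    (l ∷ a) =
    ∈-concatMap⁺ (λ x → map (x ∷_) (words n k)) (Any.map (λ { refl → ∈-map⁺ (x ∷_) (∈-words n k (suc-injective e) a) }) (∈-upTo⁺ l))
    where import Data.List.Relation.Unary.Any as Any

  ∈-words⁻ : ∀ n k {p} → p ∈ words n k → length p ≡ n × All (_< k) p
  ∈-words⁻ zero    k (here refl) = refl , []
  ∈-words⁻ (suc n) k m with find (∈-concatMap⁻ (λ x → map (x ∷_) (words n k)) {xs = upTo k} m)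
    where open import Data.List.Membership.Propositional using (find)
  ... | x , x∈ , q with ∈-map⁻ (x ∷_) q
  ...   | p , p∈ , refl with ∈-words⁻ n k p∈
  ...     | e , a = cong suc e , ∈-upTo⁻ x∈ ∷ a

  words-unique : ∀ n k → Unique (words n k)
  words-unique zero    k = [] ∷ []
  words-unique (suc n) k = concatMap-unique _ (Unique.upTo⁺ k)
    (λ x _ → Unique.map⁺ (proj₂ ∘ ∷-injective) (words-unique n k))
    (λ {x} {x′} _ _ m m′ → heads (∈-map⁻ (x ∷_) m) (∈-map⁻ (x′ ∷_) m′))
    where
    heads : ∀ {x x′ y} → ∃ (λ p → p ∈ words n k × y ≡ x ∷ p) → ∃ (λ p → p ∈ words n k × y ≡ x′ ∷ p) → x ≡ x′
    heads (_ , _ , refl) (_ , _ , e) = proj₁ (∷-injective e)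

  notIn-sound : ∀ x xs → notIn x xs ≡ true → All (x ≢_) xs
  notIn-sound x []       e = []
  notIn-sound x (y ∷ xs) e with x ≡ᵇ y in eq
  ... | false = (λ { refl → subst T eq (≡⇒≡ᵇ x x refl) }) ∷ notIn-sound x xs e

  notIn-complete : ∀ x xs → All (x ≢_) xs → notIn x xs ≡ true
  notIn-complete x []       []      = refl
  notIn-complete x (y ∷ xs) (l ∷ a) with x ≡ᵇ y in eq
  ... | true  = contradiction (≡ᵇ⇒≡ x y (subst T (sym eq) _)) l
  ... | false = notIn-complete x xs a

  distinct-sound : ∀ xs → distinct xs ≡ true → Unique xs
  distinct-sound []       e = []
  distinct-sound (x ∷ xs) e with notIn x xs in eq
  ... | true = notIn-sound x xs eq ∷ distinct-sound xs e

  distinct-complete : ∀ xs → Unique xs → distinct xs ≡ true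
  distinct-complete []       []       = refl
  distinct-complete (x ∷ xs) (a ∷ un) rewrite notIn-complete x xs a = distinct-complete xs un

  perms-unique : ∀ n → Unique (perms n)
  perms-unique n = filterᵇ-unique distinct (words-unique n n)

  downFrom-< : ∀ n → All (_< n) (downFrom n)
  downFrom-< zero    = []
  downFrom-< (suc n) = ≤-refl ∷ All.map m<n⇒m<1+n (downFrom-< n)

  perms-↭ : ∀ n {p} → p ∈ perms n → Unique p × p ↭ downFrom n
  perms-↭ n {p} m with ∈-filterᵇ⁻ distinct (words n n) m
  ... | m′ , e with ∈-words⁻ n n m′
  ...   | l , a = un , unique-↭ un (λ x∈ → ∈-downFrom⁺ (All.lookup a x∈))
                    (≤-reflexive (trans (length-downFrom n) (sym l)))
    where
    un : Unique p
    un = distinct-sound p e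

  Unique-resp-↭ : ∀ {xs ys : List ℕ} → xs ↭ ys → Unique xs → Unique ys
  Unique-resp-↭ p un = AllPairs-resp-↭ (λ x≢y → x≢y ∘ sym) (resp₂ _≢_) (↭⇒↭ₛ p) un
    where
    open import Data.List.Relation.Binary.Permutation.Setoid.Properties (setoid ℕ) using (AllPairs-resp-↭)
    open import Data.List.Relation.Binary.Permutation.Propositional using (↭⇒↭ₛ)

  ↭-perms : ∀ n {p} → p ↭ downFrom n → p ∈ perms n
  ↭-perms n {p} q = ∈-filterᵇ⁺ distinct
    (∈-words n n (trans (↭-length q) (length-downFrom n)) (All-resp-↭ (↭-sym q) (downFrom-< n)))
    (distinct-complete p (Unique-resp-↭ (↭-sym q) (Unique.downFrom⁺ n)))

  ∈-subseqs : ∀ {s xs : List ℕ} → s ⊆ xs → s ∈ subseqs (length s) xs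
  ∈-subseqs {[]}    p = here refl
  ∈-subseqs {x ∷ s} (y ∷ʳ p)   = ∈-++⁺ʳ (map (y ∷_) (subseqs (length s) _)) (∈-subseqs p)
  ∈-subseqs {x ∷ s} (refl ∷ p) = ∈-++⁺ˡ (∈-map⁺ (x ∷_) (∈-subseqs p))

  ∈-subseqs⁻ : ∀ k xs {s} → s ∈ subseqs k xs → s ⊆ xs × length s ≡ k
  ∈-subseqs⁻ zero    []       (here refl) = [] , refl
  ∈-subseqs⁻ zero    (x ∷ xs) (here refl) = x ∷ʳ proj₁ (∈-subseqs⁻ zero xs (here refl)) , refl
  ∈-subseqs⁻ (suc k) (x ∷ xs) m with ∈-++⁻ (map (x ∷_) (subseqs k xs)) m
  ... | inj₂ m′ with ∈-subseqs⁻ (suc k) xs m′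
  ...   | p , e = x ∷ʳ p , e
  ∈-subseqs⁻ (suc k) (x ∷ xs) m | inj₁ m′ with ∈-map⁻ (x ∷_) m′
  ...   | s , s∈ , refl with ∈-subseqs⁻ k xs s∈
  ...     | p , e = refl ∷ p , cong suc e

  any-∈ : ∀ (f : A → Bool) {x xs} → x ∈ xs → f x ≡ true → any f xs ≡ true
  any-∈ f {xs = y ∷ xs} (here refl) e rewrite e = refl
  any-∈ f {xs = y ∷ xs} (there m)   e with f y
  ... | true  = refl
  ... | false = any-∈ f m e

  any-∈⁻ : ∀ (f : A → Bool) xs → any f xs ≡ true → ∃ λ x → x ∈ xs × f x ≡ true
  any-∈⁻ f (y ∷ xs) e with f y in eq
  ... | true  = y , here refl , eq
  ... | false with any-∈⁻ f xs e
  ...   | x , m , e′ = x , there m , e′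

  <ᵇ-true : ∀ {m n} → m < n → (m <ᵇ n) ≡ true
  <ᵇ-true l = Equivalence.to T-≡ (<⇒<ᵇ l)

  <ᵇ-false : ∀ {m n} → n ≤ m → (m <ᵇ n) ≡ false
  <ᵇ-false {m} {n} l with m <ᵇ n in eq
  ... | false = refl
  ... | true  = contradiction (<ᵇ⇒< m n (subst T (sym eq) _)) (≤⇒≯ l)

  -- The test compares all 25 ordered pairs; the ten strict inequalities decide them all, each in
  -- both directions.
  orderIso-chain : ∀ {z a c d b} → z < a → z < c → z < d → z < b → a < c → a < d → a < b → c < d → b < c → b < d →
                   orderIso (z ∷ a ∷ c ∷ d ∷ b ∷ []) q12453 ≡ true
  orderIso-chain {z} {a} {c} {d} {b} za zc zd zb ac ad ab cd bc bd
    rewrite <ᵇ-false (≤-refl {z}) | <ᵇ-true za | <ᵇ-true zc | <ᵇ-true zd | <ᵇ-true zb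
          | <ᵇ-false (<⇒≤ za) | <ᵇ-false (≤-refl {a}) | <ᵇ-true ac | <ᵇ-true ad | <ᵇ-true ab
          | <ᵇ-false (<⇒≤ zc) | <ᵇ-false (<⇒≤ ac) | <ᵇ-false (≤-refl {c}) | <ᵇ-true cd | <ᵇ-false (<⇒≤ bc)
          | <ᵇ-false (<⇒≤ zd) | <ᵇ-false (<⇒≤ ad) | <ᵇ-false (<⇒≤ cd) | <ᵇ-false (≤-refl {d}) | <ᵇ-false (<⇒≤ bd)
          | <ᵇ-false (<⇒≤ zb) | <ᵇ-false (<⇒≤ ab) | <ᵇ-true bc | <ᵇ-true bd | <ᵇ-false (≤-refl {b}) = refl

  orderIso-complete : ∀ {z a c d b} → z < a → a < b → b < c → c < d →
                      orderIso (z ∷ a ∷ c ∷ d ∷ b ∷ []) q12453 ≡ true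
  orderIso-complete {z} {a} {c} {d} {b} za ab bc cd =
    orderIso-chain za (<-trans za ac) (<-trans za (<-trans ac cd)) (<-trans za ab)
                   ac (<-trans ac cd) ab cd bc (<-trans bc cd)
    where
    ac : a < c
    ac = <-trans ab bc

  all-∈ : ∀ (f : A → Bool) {x} xs → all f xs ≡ true → x ∈ xs → f x ≡ true
  all-∈ f (y ∷ xs) e (here refl) with f y
  ... | true = refl
  all-∈ f (y ∷ xs) e (there m) with f y
  ... | true = all-∈ f xs e m

  ⇔ᵇ-< : ∀ {m n} → ((m <ᵇ n) ⇔ᵇ true) ≡ true → m < n
  ⇔ᵇ-< {m} {n} e with m <ᵇ n in eq
  ... | true = <ᵇ⇒< m n (subst T (sym eq) _)

  orderIso-sound : ∀ s → length s ≡ 5 → orderIso s q12453 ≡ true →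
                   ∃ λ z → ∃ λ a → ∃ λ c → ∃ λ d → ∃ λ b →
                   s ≡ z ∷ a ∷ c ∷ d ∷ b ∷ [] × z < a × a < b × b < c × c < d
  orderIso-sound (z ∷ a ∷ c ∷ d ∷ b ∷ []) refl e = z , a , c , d , b , refl
    , ⇔ᵇ-< (entry (z , 1) (a , 2) at₀ at₁) , ⇔ᵇ-< (entry (a , 2) (b , 3) at₁ at₄)
    , ⇔ᵇ-< (entry (b , 3) (c , 4) at₄ at₂) , ⇔ᵇ-< (entry (c , 4) (d , 5) at₂ at₃)
    where
    pairs : List (ℕ × ℕ)
    pairs = zip (z ∷ a ∷ c ∷ d ∷ b ∷ []) q12453
    entry : ∀ u v → u ∈ pairs → v ∈ pairs → ((proj₁ u <ᵇ proj₁ v) ⇔ᵇ (proj₂ u <ᵇ proj₂ v)) ≡ true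
    entry u v m m′ = all-∈ (λ v → (proj₁ u <ᵇ proj₁ v) ⇔ᵇ (proj₂ u <ᵇ proj₂ v)) pairs
      (all-∈ (λ u → all (λ v → (proj₁ u <ᵇ proj₁ v) ⇔ᵇ (proj₂ u <ᵇ proj₂ v)) pairs) pairs e m) m′
    at₀ : (z , 1) ∈ pairs
    at₀ = here refl
    at₁ : (a , 2) ∈ pairs
    at₁ = there (here refl)
    at₂ : (c , 4) ∈ pairs
    at₂ = there (there (here refl))
    at₃ : (d , 5) ∈ pairs
    at₃ = there (there (there (here refl)))
    at₄ : (b , 3) ∈ pairs
    at₄ = there (there (there (there (here refl))))

  contains-complete : ∀ p → Has12453 p → contains p q12453 ≡ true
  contains-complete p (z , a , c , d , b , s , za , ab , bc , cd) =
    any-∈ (λ s → orderIso s q12453) (∈-subseqs s) (orderIso-complete za ab bc cd)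

  contains-sound : ∀ p → contains p q12453 ≡ true → Has12453 p
  contains-sound p e with any-∈⁻ (λ s → orderIso s q12453) (subseqs 5 p) e
  ... | s , s∈ , e′ with ∈-subseqs⁻ 5 p s∈
  ...   | s⊆ , l with orderIso-sound s l e′
  ...     | z , a , c , d , b , refl , r = z , a , c , d , b , s⊆ , r

  avoiders : ℕ → List (List ℕ)
  avoiders n = filterᵇ (λ p → not (contains p q12453)) (perms n)

  avoiders-unique : ∀ n → Unique (avoiders n)
  avoiders-unique n = filterᵇ-unique _ (perms-unique n)

  ∈-avoiders : ∀ n {p} → p ↭ downFrom n → ¬ Has12453 p → p ∈ avoiders n
  ∈-avoiders n {p} q av = ∈-filterᵇ⁺ _ (↭-perms n q) not-contains
    where
    not-contains : not (contains p q12453) ≡ true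
    not-contains with contains p q12453 in eq
    ... | true  = contradiction (contains-sound p eq) av
    ... | false = refl

  ∈-avoiders⁻ : ∀ n {p} → p ∈ avoiders n → Unique p × p ↭ downFrom n × ¬ Has12453 p
  ∈-avoiders⁻ n {p} m with ∈-filterᵇ⁻ (λ p → not (contains p q12453)) (perms n) m
  ... | m′ , e with perms-↭ n m′
  ...   | un , q = un , q , λ has → contradiction (trans (sym e) (cong not (contains-complete p has))) (λ ())

-- Upper bound: placing the left-to-right minima.

module Upper where

  open import Defs using (S; q12453)
  open Coefficients using (h)
  open Avoidance using (Has12453; Has1342; lehmer; avoids⇒walk)
  open Code
  open Decode
  open Bridge
  open import Data.Bool.Base using (Bool; true; false)
  open import Data.List.Base hiding (_∷ʳ_; lookup; sum; merge)
  open import Data.List.Membership.Propositional using (_∈_; lose)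
  open import Data.List.Membership.Propositional.Properties
  open import Data.List.Properties using (length-++; length-map; ++-assoc; ++-conicalˡ; ++-conicalʳ; length-downFrom; map-++; map-cong; map-∘)
  open import Data.List.Relation.Binary.Permutation.Propositional using (_↭_; ↭-sym; ↭-trans; prep; ↭-reflexive)
  open import Data.List.Relation.Binary.Permutation.Propositional.Properties using (shift; drop-mid; ↭-length; ∈-resp-↭; ↭-empty-inv)
  open import Data.List.Relation.Binary.Sublist.Propositional using (_⊆_; []; _∷_; _∷ʳ_; lookup; ⊆-trans)
  open import Data.List.Relation.Unary.All as All using (All; []; _∷_)
  open import Data.List.Relation.Unary.AllPairs using ([]; _∷_)
  open import Data.List.Relation.Unary.Any using (here; there)
  open import Data.List.Relation.Unary.Unique.Propositional using (Unique)
  open import Data.Nat.Base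
  open import Data.Nat.ListAction using (sum)
  open import Data.Nat.ListAction.Properties using (sum-++)
  open import Data.Nat.Properties
  open import Data.Nat.Tactic.RingSolver using (solve-∀)
  open import Data.Product.Base using (∃; _×_; _,_)
  open import Data.Sum.Base using (inj₁; inj₂)
  open import Function.Base using (_∘_)
  open import Relation.Binary.Definitions using (tri<; tri≈; tri>)
  open import Relation.Binary.PropositionalEquality
  open import Relation.Nullary.Decidable using (yes; no)
  open import Relation.Nullary.Negation using (¬_; contradiction)

  -- The left-to-right minima D of m ∷ xs other than m, and the remaining entries W.
  record Minima (m : ℕ) (xs : List ℕ) : Set where
    field
      P          : List Bool
      D W        : List ℕ
      merged     : xs ≡ merge P D W
      lengthD    : length D ≡ trues P
      lengthW    : length W ≡ falses P
      descending : Desc (m ∷ D)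
      W⊆         : W ⊆ xs
      preceded   : ∀ {a s} → a ∷ s ⊆ W → ∃ λ z → z < a × z ∷ a ∷ s ⊆ m ∷ xs

  minima : ∀ m xs → Unique (m ∷ xs) → Minima m xs
  minima m [] _ = record { P = [] ; D = [] ; W = [] ; merged = refl ; lengthD = refl ; lengthW = refl
                         ; descending = [] ∷ [] ; W⊆ = [] ; preceded = λ () }
  minima m (x ∷ xs) ((m≢x ∷ a) ∷ u ∷ un) with <-cmp x m
  ... | tri≈ _ x≡m _ = contradiction (sym x≡m) m≢x
  ... | tri< x<m _ _ = record
    { P = true ∷ M.P ; D = x ∷ M.D ; W = M.W ; merged = cong (x ∷_) M.merged
    ; lengthD = cong suc M.lengthD ; lengthW = M.lengthW
    ; descending = (x<m ∷ below M.descending) ∷ M.descending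
    ; W⊆ = x ∷ʳ M.W⊆
    ; preceded = λ s → let z , l , p = M.preceded s in z , l , m ∷ʳ p }
    where
    module M = Minima (minima x xs (u ∷ un))
    below : ∀ {D} → Desc (x ∷ D) → All (_< m) D
    below (b ∷ _) = All.map (λ l → <-trans l x<m) b
  ... | tri> _ _ m<x = record
    { P = false ∷ M.P ; D = M.D ; W = x ∷ M.W ; merged = cong (x ∷_) M.merged
    ; lengthD = M.lengthD ; lengthW = cong suc M.lengthW ; descending = M.descending
    ; W⊆ = refl ∷ M.W⊆ ; preceded = preceded′ }
    where
    module M = Minima (minima m xs (a ∷ un))
    insert : ∀ {z s} → z ∷ s ⊆ m ∷ xs → z ∷ s ⊆ m ∷ x ∷ xs
    insert (_ ∷ʳ p)   = m ∷ʳ x ∷ʳ p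
    insert (refl ∷ p) = refl ∷ (x ∷ʳ p)
    preceded′ : ∀ {a s} → a ∷ s ⊆ x ∷ M.W → ∃ λ z → z < a × z ∷ a ∷ s ⊆ m ∷ x ∷ xs
    preceded′ (_ ∷ʳ p)   with M.preceded p
    ... | z , l , q = z , l , insert q
    preceded′ (refl ∷ p) = m , m<x , refl ∷ refl ∷ ⊆-trans p M.W⊆

  -- The head of Z is the largest remaining value. If it belongs to the descending list D it must be
  -- the head of D; otherwise it is removed from W.
  mask : ∀ Z D W → Desc Z → Desc D → D ++ W ↭ Z →
         ∃ λ V → length V ≡ length Z × D ≡ keepT V Z × W ↭ keepF V Z
  mask [] D W dZ dD p = [] , refl , ++-conicalˡ D W (↭-empty-inv p)
                      , ↭-reflexive (++-conicalʳ D W (↭-empty-inv p))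
  mask (z ∷ Z) D W (a ∷ dZ) dD p with ∈-++⁻ D (∈-resp-↭ (↭-sym p) (here refl))
  ... | inj₂ z∈W with ∈-∃++ z∈W
  ...   | W₁ , W₂ , refl with mask Z D (W₁ ++ W₂) dZ dD
            (↭-trans (↭-reflexive (sym (++-assoc D W₁ W₂)))
              (drop-mid (D ++ W₁) [] (↭-trans (↭-reflexive (++-assoc D W₁ (z ∷ W₂))) p)))
  ...     | V , e , e′ , q = false ∷ V , cong suc e , e′ , ↭-trans (shift z W₁ W₂) (prep z q)
  mask (z ∷ Z) D W (a ∷ dZ) dD p | inj₁ z∈D with D | dD | z∈D
  ... | x ∷ D′ | b ∷ dD′ | there z∈D′ = contradiction (All.lookup b z∈D′) (x≯z (∈-resp-↭ p (here refl)))
    where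
    x≯z : x ∈ z ∷ Z → ¬ x > z
    x≯z (here refl) l = <-irrefl refl l
    x≯z (there m)   l = <-asym l (All.lookup a m)
  ... | .z ∷ D′ | b ∷ dD′ | here refl with mask Z D′ W dZ dD′ (drop-mid [] [] p)
  ...   | V , e , e′ , q = true ∷ V , cong suc e , cong (z ∷_) e′ , q

  downFrom-desc : ∀ n → Desc (downFrom n)
  downFrom-desc zero    = []
  downFrom-desc (suc n) = downFrom-< n ∷ downFrom-desc n

  boolWords : ℕ → List (List Bool)
  boolWords zero    = [] ∷ []
  boolWords (suc n) = map (true ∷_) (boolWords n) ++ map (false ∷_) (boolWords n)

  ∈-boolWords : ∀ V → V ∈ boolWords (length V)
  ∈-boolWords []          = here refl
  ∈-boolWords (true ∷ V)  = ∈-++⁺ˡ (∈-map⁺ (true ∷_) (∈-boolWords V))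
  ∈-boolWords (false ∷ V) = ∈-++⁺ʳ (map (true ∷_) (boolWords (length V))) (∈-map⁺ (false ∷_) (∈-boolWords V))

  ∈-boolWords⁻ : ∀ n {V} → V ∈ boolWords n → length V ≡ n
  ∈-boolWords⁻ zero    (here refl) = refl
  ∈-boolWords⁻ (suc n) m with ∈-++⁻ (map (true ∷_) (boolWords n)) m
  ... | inj₁ m′ with ∈-map⁻ (true ∷_) m′
  ...   | V , q , refl = cong suc (∈-boolWords⁻ n q)
  ∈-boolWords⁻ (suc n) m | inj₂ m′ with ∈-map⁻ (false ∷_) m′
  ...   | V , q , refl = cong suc (∈-boolWords⁻ n q)

  -- `P` marks the positions and `V` the values of the minima; masks that leave different numbers of
  -- other entries are incompatible.
  fill : ℕ → List Bool → List Bool → List (List ℕ)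
  fill n P V with falses P ≟ falses V
  ... | yes _ = map (λ cs → merge P (keepT V (downFrom n)) (pick cs (keepF V (downFrom n)))) (codes (falses P))
  ... | no  _ = []

  merges : ℕ → List (List ℕ)
  merges n = concatMap (λ P → concatMap (fill n P) (boolWords n)) (boolWords n)

  ∈-fill : ∀ n P V {p} cs → cs ∈ codes (falses P) → falses P ≡ falses V →
           p ≡ merge P (keepT V (downFrom n)) (pick cs (keepF V (downFrom n))) → p ∈ fill n P V
  ∈-fill n P V cs m e refl with falses P ≟ falses V
  ... | yes _ = ∈-map⁺ _ m
  ... | no ¬e = contradiction e ¬e

  ∈-merges : ∀ {n P V p} → length P ≡ n → length V ≡ n → p ∈ fill n P V → p ∈ merges n
  ∈-merges {n} {P} {V} refl e m = ∈-concatMap⁺ _ (lose (∈-boolWords P)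
    (∈-concatMap⁺ (fill n P) (lose (subst (λ i → V ∈ boolWords i) e (∈-boolWords V)) m)))

  Unique-⊆ : ∀ {xs ys : List ℕ} → xs ⊆ ys → Unique ys → Unique xs
  Unique-⊆ = AllPairs-⊆

  avoider-merge : ∀ n {p} → Unique p → p ↭ downFrom n → ¬ Has12453 p → p ∈ merges n
  avoider-merge zero    {p}      un q av rewrite ↭-empty-inv q = ∈-merges {0} {[]} {[]} refl refl (here refl)
  avoider-merge (suc n) {[]}     un q av with ↭-length q
  ... | ()
  avoider-merge (suc n) {x ∷ xs} un q av = found (mask Z D W (downFrom-desc (suc n)) descending
      (↭-trans (↭-sym (merge-↭ P′ {D} {W} (cong suc lengthD) lengthW)) (↭-trans (↭-reflexive (sym merged′)) q)))
    where
    open Minima (minima x xs un) renaming (D to D₀)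
    Z D : List ℕ
    Z = downFrom (suc n)
    -- The first entry of a permutation is always a left-to-right minimum.
    D = x ∷ D₀
    P′ : List Bool
    P′ = true ∷ P
    merged′ : x ∷ xs ≡ merge P′ D W
    merged′ = cong (x ∷_) merged
    avoids : ¬ Has1342 W
    avoids (a , c , d , b , s , r) with preceded s
    ... | z , l , s′ = av (z , a , c , d , b , s′ , l , r)
    found : ∃ (λ V → length V ≡ length Z × D ≡ keepT V Z × W ↭ keepF V Z) → x ∷ xs ∈ merges (suc n)
    found (V , e , eD , eW) with avoids⇒walk W (Unique-⊆ (_ ∷ʳ W⊆) un) avoids
    ... | v , walk , _ = ∈-merges {suc n} {P′} {V}
        (trans (sym (length-merge P′ {D} {W} (cong suc lengthD) lengthW)) (trans (cong length (sym merged′)) lengthp))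
        (trans e (length-downFrom (suc n)))
        (∈-fill (suc n) P′ V (lehmer W) (reindex codes (trans (length-lehmer W) lengthW) (walk-codes walk))
          (trans (sym lengthW) (trans (↭-length eW) (length-keepF V Z (≤-reflexive e))))
          (trans merged′ (cong₂ (merge P′) eD
            (sym (pick-lehmer W (keepF V Z) eW (AllPairs-⊆ (keepF-⊆ V Z) (downFrom-desc (suc n))))))))
      where
      lengthp : length (x ∷ xs) ≡ suc n
      lengthp = trans (↭-length q) (length-downFrom (suc n))
      length-lehmer : ∀ w → length (lehmer w) ≡ length w
      length-lehmer []      = refl
      length-lehmer (k ∷ w) = cong suc (length-lehmer w)

  S≤merges : ∀ n → S q12453 n ≤ length (merges n)
  S≤merges n = unique-length (avoiders-unique n)
    (λ m → let un , q , av = ∈-avoiders⁻ n m in avoider-merge n un q av)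

  length-concatMap-≤ : ∀ {A B : Set} (f : A → List B) (g : A → ℕ) k K xs →
                       (∀ x → x ∈ xs → length (f x) * k ≤ K * g x) →
                       length (concatMap f xs) * k ≤ K * sum (map g xs)
  length-concatMap-≤ f g k K []       p = z≤n
  length-concatMap-≤ f g k K (x ∷ xs) p = begin
    length (f x ++ concatMap f xs) * k              ≡⟨ cong (_* k) (length-++ (f x)) ⟩
    (length (f x) + length (concatMap f xs)) * k    ≡⟨ *-distribʳ-+ k (length (f x)) _ ⟩
    length (f x) * k + length (concatMap f xs) * k  ≤⟨ +-mono-≤ (p x (here refl)) (length-concatMap-≤ f g k K xs (λ y → p y ∘ there)) ⟩
    K * g x + K * sum (map g xs)                    ≡⟨ *-distribˡ-+ K (g x) _ ⟨
    K * (g x + sum (map g xs))                      ∎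
    where open ≤-Reasoning

  module Weights (c d : ℕ) where

    -- Homogeneous form of a power of c / d. Summing over masks of length n gives (c + d)^n, so
    -- binomial coefficients never have to be named.
    weight : List Bool → ℕ
    weight V = c ^ falses V * d ^ trues V

    sum-map-* : ∀ {A : Set} k (g : A → ℕ) xs → sum (map (λ x → k * g x) xs) ≡ k * sum (map g xs)
    sum-map-* k g []       = sym (*-zeroʳ k)
    sum-map-* k g (x ∷ xs) = trans (cong (k * g x +_) (sum-map-* k g xs)) (sym (*-distribˡ-+ k (g x) _))

    total-weight : ∀ n → sum (map weight (boolWords n)) ≡ (c + d) ^ n
    total-weight zero    = refl
    total-weight (suc n) = begin
      sum (map weight (map (true ∷_) B ++ map (false ∷_) B))
        ≡⟨ cong sum (map-++ weight (map (true ∷_) B) (map (false ∷_) B)) ⟩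
      sum (map weight (map (true ∷_) B) ++ map weight (map (false ∷_) B))
        ≡⟨ sum-++ (map weight (map (true ∷_) B)) _ ⟩
      sum (map weight (map (true ∷_) B)) + sum (map weight (map (false ∷_) B))
        ≡⟨ cong₂ _+_ (branch (true ∷_) d (λ V → eq₁ (c ^ falses V) d (d ^ trues V)))
                     (branch (false ∷_) c (λ V → *-assoc c (c ^ falses V) (d ^ trues V))) ⟩
      d * sum (map weight B) + c * sum (map weight B)
        ≡⟨ *-distribʳ-+ (sum (map weight B)) d c ⟨
      (d + c) * sum (map weight B)
        ≡⟨ cong₂ _*_ (+-comm d c) (total-weight n) ⟩
      (c + d) ^ suc n ∎
      where
      open ≡-Reasoning
      B : List (List Bool)
      B = boolWords n
      eq₁ : ∀ x d y → x * (d * y) ≡ d * (x * y)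
      eq₁ = solve-∀
      branch : ∀ (f : List Bool → List Bool) k → (∀ V → weight (f V) ≡ k * weight V) →
               sum (map weight (map f B)) ≡ k * sum (map weight B)
      branch f k p = trans (cong sum (trans (sym (map-∘ B)) (map-cong p B))) (sum-map-* k weight B)

  ^-*-distrib : ∀ a b n → (a * b) ^ n ≡ a ^ n * b ^ n
  ^-*-distrib a b zero    = refl
  ^-*-distrib a b (suc n) = trans (cong (a * b *_) (^-*-distrib a b n)) (eq a b (a ^ n) (b ^ n))
    where
    eq : ∀ a b x y → a * b * (x * y) ≡ a * x * (b * y)
    eq = solve-∀

  module _ (h-upper : ∀ n → h n ≤ 2 * 8 ^ n) (c d : ℕ) (8d²≤c² : 8 * (d * d) ≤ c * c) where
    open Weights c d

    -- As c / d ≥ √8, the factor 8^m is at most (c / d)^(2m). Each of the two masks, both with m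
    -- letters `false`, receives one factor (c / d)^m.
    fill-weight : ∀ n P V → length P ≡ n → length V ≡ n →
                  length (fill n P V) * (d ^ n * d ^ n) ≤ 2 * weight P * weight V
    fill-weight n P V eP eV with falses P ≟ falses V
    ... | no  _ = z≤n
    ... | yes e = begin
      length (map _ (codes m)) * (d ^ n * d ^ n)
        ≡⟨ cong₂ (λ x i → x * (d ^ i * d ^ i)) (trans (length-map _ (codes m)) (length-codes m)) (trans (sym eP) (sym (trues+falses P))) ⟩
      h m * (d ^ (t + m) * d ^ (t + m))
        ≤⟨ *-monoˡ-≤ (d ^ (t + m) * d ^ (t + m)) (h-upper m) ⟩
      2 * 8 ^ m * (d ^ (t + m) * d ^ (t + m))
        ≡⟨ cong (λ x → 2 * 8 ^ m * (x * x)) (^-distribˡ-+-* d t m) ⟩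
      2 * 8 ^ m * (d ^ t * d ^ m * (d ^ t * d ^ m))
        ≡⟨ eq₁ (8 ^ m) (d ^ t) (d ^ m) ⟩
      2 * (8 ^ m * (d ^ m * d ^ m)) * (d ^ t * d ^ t)
        ≡⟨ cong (λ x → 2 * x * (d ^ t * d ^ t)) (trans (cong (8 ^ m *_) (sym (^-*-distrib d d m))) (sym (^-*-distrib 8 (d * d) m))) ⟩
      2 * (8 * (d * d)) ^ m * (d ^ t * d ^ t)
        ≤⟨ *-monoˡ-≤ (d ^ t * d ^ t) (*-monoʳ-≤ 2 (^-monoˡ-≤ m 8d²≤c²)) ⟩
      2 * (c * c) ^ m * (d ^ t * d ^ t)
        ≡⟨ cong (λ x → 2 * x * (d ^ t * d ^ t)) (^-*-distrib c c m) ⟩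
      2 * (c ^ m * c ^ m) * (d ^ t * d ^ t)
        ≡⟨ eq₂ (c ^ m) (d ^ t) ⟩
      2 * (c ^ m * d ^ t) * (c ^ m * d ^ t)
        ≡⟨ cong₂ (λ i j → 2 * (c ^ m * d ^ t) * (c ^ i * d ^ j)) e same-trues ⟩
      2 * weight P * weight V ∎
      where
      open ≤-Reasoning
      m t : ℕ
      m = falses P
      t = trues P
      same-trues : trues P ≡ trues V
      same-trues = +-cancelʳ-≡ (falses P) (trues P) (trues V)
        (trans (trues+falses P) (trans eP (trans (sym eV) (trans (sym (trues+falses V)) (cong (trues V +_) (sym e))))))
      eq₁ : ∀ e x y → 2 * e * (x * y * (x * y)) ≡ 2 * (e * (y * y)) * (x * x)
      eq₁ = solve-∀
      eq₂ : ∀ x y → 2 * (x * x) * (y * y) ≡ 2 * (x * y) * (x * y)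
      eq₂ = solve-∀

    -- Letting the double sum run over all pairs of masks makes it a product of two equal sums.
    S-upper : ∀ n → S q12453 n * (d ^ n * d ^ n) ≤ 2 * ((c + d) ^ n * (c + d) ^ n)
    S-upper n = begin
      S q12453 n * k              ≤⟨ *-monoˡ-≤ k (S≤merges n) ⟩
      length (merges n) * k       ≤⟨ length-concatMap-≤ _ (λ P → T * weight P) k 2 B row ⟩
      2 * sum (map (λ P → T * weight P) B) ≡⟨ cong (2 *_) (trans (sum-map-* T weight B) (cong₂ _*_ (total-weight n) (total-weight n))) ⟩
      2 * ((c + d) ^ n * (c + d) ^ n) ∎
      where
      open ≤-Reasoning
      k T : ℕ
      k = d ^ n * d ^ n
      B : List (List Bool)
      B = boolWords n
      T = sum (map weight B)
      row : ∀ P → P ∈ B → length (concatMap (fill n P) B) * k ≤ 2 * (T * weight P)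
      row P mP = ≤-trans
        (length-concatMap-≤ (fill n P) weight k (2 * weight P) B
          (λ V mV → fill-weight n P V (∈-boolWords⁻ n mP) (∈-boolWords⁻ n mV)))
        (≤-reflexive (eq (weight P) T))
        where
        eq : ∀ x y → 2 * x * y ≡ 2 * (y * x)
        eq = solve-∀

-- Lower bound: minima inserted into a skew sum, block by block.

module Lower where

  open import Defs using (S; q12453)
  open Coefficients using (h)
  open Avoidance using (Has12453; Has1342; lehmer; walk⇒avoids)
  open Code
  open Decode
  open Bridge
  open Upper using (boolWords; ∈-boolWords⁻; downFrom-desc)
  open import Data.Bool.Base using (Bool; true; false)
  open import Data.List.Base hiding (_∷ʳ_; lookup; sum; merge)
  open import Data.List.Membership.Propositional using (_∈_)
  open import Data.List.Membership.Propositional.Properties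
  open import Data.List.Properties using (length-++; length-map; length-downFrom; length-drop; length-take; take++drop≡id; ∷-injective; ∷-injectiveʳ)
  open import Data.List.Relation.Binary.Permutation.Propositional using (_↭_; ↭-refl; ↭-sym; ↭-trans; ↭-reflexive)
  open import Data.List.Relation.Binary.Permutation.Propositional.Properties using (↭-length; ∈-resp-↭; All-resp-↭; shifts; ++⁺; ++⁺ˡ; ++⁺ʳ)
  open import Data.List.Relation.Binary.Sublist.Propositional using (_⊆_; []; _∷_; _∷ʳ_; lookup; ⊆-refl)
  import Data.List.Relation.Binary.Sublist.Propositional.Properties as Sublist
  open import Data.List.Relation.Unary.All as All using (All; []; _∷_)
  open import Data.List.Relation.Unary.AllPairs as AllPairs using ([]; _∷_)
  open import Data.List.Relation.Unary.Any using (here; there)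
  open import Data.List.Relation.Unary.Unique.Propositional using (Unique)
  import Data.List.Relation.Unary.Unique.Propositional.Properties as Unique
  open import Data.Nat.Base
  open import Data.Nat.Properties
  open import Data.Product.Base using (∃; _×_; _,_; proj₁; proj₂)
  open import Data.Sum.Base using (_⊎_; inj₁; inj₂)
  open import Function.Base using (_∘_)
  open import Relation.Binary.PropositionalEquality
  open import Relation.Nullary.Negation using (¬_; contradiction)

  private
    variable
      A B : Set

  -- Interleaving of W with entries smaller than everything before them (and than everything in prev).
  data Marked : List ℕ → List ℕ → List ℕ → Set where
    []    : ∀ {prev} → Marked prev [] []
    low   : ∀ {prev x p W} → All (x <_) prev → Marked (x ∷ prev) p W → Marked prev (x ∷ p) W
    other : ∀ {prev x p W} → Marked (x ∷ prev) p W → Marked prev (x ∷ p) (x ∷ W)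

  marked-all : ∀ {prev} p → Marked prev p p
  marked-all []      = []
  marked-all (x ∷ p) = other (marked-all p)

  -- A `low` entry is smaller than everything before it, so it cannot exceed an earlier a.
  marked-prev : ∀ {prev p W a s} → Marked prev p W → a ∈ prev → s ⊆ p → All (a <_) s → s ⊆ W
  marked-prev []        m []         _       = []
  marked-prev (low b M) m (_ ∷ʳ q)   l       = marked-prev M (there m) q l
  marked-prev (low b M) m (refl ∷ q) (l ∷ _) = contradiction l (<-asym (All.lookup b m))
  marked-prev (other M) m (_ ∷ʳ q)   l       = _ ∷ʳ marked-prev M (there m) q l
  marked-prev (other M) m (refl ∷ q) (_ ∷ l) = refl ∷ marked-prev M (there m) q l

  marked-sublist : ∀ {prev p W a s} → Marked prev p W → a ∷ s ⊆ p → All (a <_) s → s ⊆ W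
  marked-sublist (low b M) (_ ∷ʳ q)   l = marked-sublist M q l
  marked-sublist (low b M) (refl ∷ q) l = marked-prev M (here refl) q l
  marked-sublist (other M) (_ ∷ʳ q)   l = _ ∷ʳ marked-sublist M q l
  marked-sublist (other M) (refl ∷ q) l = _ ∷ʳ marked-prev M (here refl) q l

  marked-avoids : ∀ {prev p W} → Marked prev p W → ¬ Has1342 W → ¬ Has12453 p
  marked-avoids M av (z , a , c , d , b , s , za , ab , bc , cd) =
    av (a , c , d , b , marked-sublist M s (za ∷ <-trans za (<-trans ab bc)
       ∷ <-trans za (<-trans ab (<-trans bc cd)) ∷ <-trans za ab ∷ []) , ab , bc , cd)

  _≫_ : List ℕ → List ℕ → Set
  xs ≫ ys = ∀ {x y} → x ∈ xs → y ∈ ys → y < x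

  -- The rest q is handled by a continuation, which must accept any list of preceding entries drawn
  -- from prev, D and W; their order does not matter for `low`.
  marked-merge : ∀ P {D W prev q Wq} → length D ≡ trues P → length W ≡ falses P →
                 prev ≫ D → W ≫ D → Desc D →
                 (∀ {prev′} → (∀ {y} → y ∈ prev′ → y ∈ prev ⊎ y ∈ D ⊎ y ∈ W) → Marked prev′ q Wq) →
                 Marked prev (merge P D W ++ q) (W ++ Wq)
  marked-merge [] {[]} {[]} e f p w d k = k inj₁
  marked-merge (true ∷ P) {x ∷ D} {W} e f p w (a ∷ d) k =
    low (All.tabulate (λ m → p m (here refl)))
      (marked-merge P (suc-injective e) f
        (λ { (here refl) m′ → All.lookup a m′ ; (there m) m′ → p m (there m′) })
        (λ m m′ → w m (there m′)) d
        (λ g → k (λ m → up (g m))))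
    where
    up : ∀ {y prev} → y ∈ x ∷ prev ⊎ y ∈ D ⊎ y ∈ W → y ∈ prev ⊎ y ∈ x ∷ D ⊎ y ∈ W
    up (inj₁ (here e))  = inj₂ (inj₁ (here e))
    up (inj₁ (there m)) = inj₁ m
    up (inj₂ (inj₁ m))  = inj₂ (inj₁ (there m))
    up (inj₂ (inj₂ m))  = inj₂ (inj₂ m)
  marked-merge (false ∷ P) {D} {x ∷ W} e f p w d k =
    other (marked-merge P e (suc-injective f)
      (λ { (here refl) m′ → w (here refl) m′ ; (there m) m′ → p m m′ })
      (λ m m′ → w (there m) m′) d
      (λ g → k (λ m → up (g m))))
    where
    up : ∀ {y prev} → y ∈ x ∷ prev ⊎ y ∈ D ⊎ y ∈ W → y ∈ prev ⊎ y ∈ D ⊎ y ∈ x ∷ W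
    up (inj₁ (here e))  = inj₂ (inj₂ (here e))
    up (inj₁ (there m)) = inj₁ m
    up (inj₂ (inj₁ m))  = inj₂ (inj₁ m)
    up (inj₂ (inj₂ m))  = inj₂ (inj₂ (there m))

  drop-last : ∀ (w₁ : List ℕ) {w₂ s} → s ⊆ w₁ ++ w₂ → (∀ {y} → y ∈ s → ¬ y ∈ w₂) → s ⊆ w₁
  drop-last []       {s = []}    p          f = []
  drop-last []       {s = y ∷ s} p          f = contradiction (lookup p (here refl)) (f (here refl))
  drop-last (x ∷ w₁) {s = _}     (_ ∷ʳ p)   f = x ∷ʳ drop-last w₁ p f
  drop-last (x ∷ w₁) {s = _ ∷ _} (refl ∷ p) f = refl ∷ drop-last w₁ p (f ∘ there)

  -- An occurrence of a pattern that begins with its least entry, like 1342, cannot straddle a skew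
  -- sum.
  skew-split : ∀ w₁ {w₂ s} {a : ℕ} → w₁ ≫ w₂ → a ∷ s ⊆ w₁ ++ w₂ → All (a <_) s → a ∷ s ⊆ w₁ ⊎ a ∷ s ⊆ w₂
  skew-split []       g p          l = inj₂ p
  skew-split (x ∷ w₁) g (_ ∷ʳ p)   l with skew-split w₁ (g ∘ there) p l
  ... | inj₁ q = inj₁ (x ∷ʳ q)
  ... | inj₂ q = inj₂ q
  skew-split (x ∷ w₁) g (refl ∷ p) l =
    inj₁ (refl ∷ drop-last w₁ p (λ m m′ → <-asym (All.lookup l m) (g (here refl) m′)))

  skew-avoids : ∀ w₁ {w₂} → w₁ ≫ w₂ → ¬ Has1342 w₁ → ¬ Has1342 w₂ → ¬ Has1342 (w₁ ++ w₂)
  skew-avoids w₁ g n₁ n₂ (a , c , d , b , s , ab , bc , cd)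
    with skew-split w₁ g s (<-trans ab bc ∷ <-trans ab (<-trans bc cd) ∷ ab ∷ [])
  ... | inj₁ p = n₁ (a , c , d , b , p , ab , bc , cd)
  ... | inj₂ p = n₂ (a , c , d , b , p , ab , bc , cd)

  desc-avoids : ∀ {w} → Desc w → ¬ Has1342 w
  desc-avoids d (a , c , d′ , b , s , ab , bc , cd) with AllPairs-⊆ s d
  ... | (a>c ∷ _) ∷ _ = <-asym a>c (<-trans ab bc)

  desc-≫ : ∀ xs {ys} → Desc (xs ++ ys) → xs ≫ ys
  desc-≫ (x ∷ xs) (a ∷ d) (here refl) m′ = All.lookup a (∈-++⁺ʳ xs m′)
  desc-≫ (x ∷ xs) (a ∷ d) (there m)   m′ = desc-≫ xs d m m′

  desc-unique : ∀ {xs} → Desc xs → Unique xs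
  desc-unique = AllPairs.map (λ l e → <-irrefl (sym e) l)

  keepF-drop-⊆ : ∀ V (xs : List A) → keepF V xs ++ drop (length V) xs ⊆ xs
  keepF-drop-⊆ []          xs       = ⊆-refl
  keepF-drop-⊆ (true ∷ V)  []       = []
  keepF-drop-⊆ (false ∷ V) []       = []
  keepF-drop-⊆ (true ∷ V)  (x ∷ xs) = x ∷ʳ keepF-drop-⊆ V xs
  keepF-drop-⊆ (false ∷ V) (x ∷ xs) = refl ∷ keepF-drop-⊆ V xs

  keepT-drop-⊆ : ∀ V (xs : List A) → keepT V xs ++ drop (length V) xs ⊆ xs
  keepT-drop-⊆ []          xs       = ⊆-refl
  keepT-drop-⊆ (true ∷ V)  []       = []
  keepT-drop-⊆ (false ∷ V) []       = []
  keepT-drop-⊆ (true ∷ V)  (x ∷ xs) = refl ∷ keepT-drop-⊆ V xs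
  keepT-drop-⊆ (false ∷ V) (x ∷ xs) = x ∷ʳ keepT-drop-⊆ V xs

  -- β is one more than the largest entry of R, or 0 if R is empty. The last component carries the
  -- bound over to each new head of T.
  separator : ∀ T {R} → Desc (T ++ R) →
              ∃ λ β → All (_< β) R × All (β ≤_) T × (∀ {t} → All (_< t) (T ++ R) → β ≤ t)
  separator [] {[]}    d       = 0 , [] , [] , λ _ → z≤n
  separator [] {x ∷ R} (a ∷ d) = suc x , ≤-refl ∷ All.map m<n⇒m<1+n a , [] , λ { (l ∷ _) → l }
  separator (t ∷ T) (a ∷ d) with separator T d
  ... | β , r , t′ , g = β , r , g a ∷ t′ , λ { (l ∷ _) → ≤-trans (g a) (<⇒≤ l) }

  ++-split : ∀ (xs xs′ : List A) {ys ys′} → length xs ≡ length xs′ → xs ++ ys ≡ xs′ ++ ys′ → xs ≡ xs′ × ys ≡ ys′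
  ++-split []       []         l e = refl , e
  ++-split (x ∷ xs) (x′ ∷ xs′) l e with ∷-injective e
  ... | refl , e′ with ++-split xs xs′ (suc-injective l) e′
  ...   | refl , e″ = refl , e″

  -- Mask of positions, mask of values, and code of the arrangement of T.
  Chunk : Set
  Chunk = List Bool × List Bool × List ℕ

  -- Each chunk merges an arrangement of T with entries chosen from the next block of R below T;
  -- the entries of that block that were not chosen are arranged in the next chunk.
  build : List Chunk → List ℕ → List ℕ → List ℕ
  build []                T R = T ++ R
  build ((P , V , cs) ∷ ds) T R = merge P (keepT V R) (pick cs T) ++ build ds (keepF V R) (drop (length V) R)

  -- What remains of `build` without the inserted minima: a skew sum of 1342-avoiders, ended by a
  -- descending sequence.
  core : List Chunk → List ℕ → List ℕ → List ℕ
  core []                T R = T ++ R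
  core ((P , V , cs) ∷ ds) T R = pick cs T ++ core ds (keepF V R) (drop (length V) R)

  -- Each chunk has length l, with m entries of the skew sum and l - m inserted minima.
  module Chunks (l m : ℕ) where

    masks : List (List Bool)
    masks = filterᵇ (λ V → falses V ≡ᵇ m) (boolWords l)

    chunks : List Chunk
    chunks = cartesianProduct masks (cartesianProduct masks (codes m))

    IsMask : List Bool → Set
    IsMask V = length V ≡ l × falses V ≡ m

    ∈-masks⁻ : ∀ {V} → V ∈ masks → IsMask V
    ∈-masks⁻ q with ∈-filterᵇ⁻ (λ V → falses V ≡ᵇ m) (boolWords l) q
    ... | q′ , e = ∈-boolWords⁻ l q′ , ≡ᵇ⇒≡ _ m (subst T (sym e) _)
      where open import Data.Bool.Base using (T)

    record IsChunk (k : Chunk) : Set where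
      constructor isChunk
      field
        maskP : IsMask (proj₁ k)
        maskV : IsMask (proj₁ (proj₂ k))
        code  : proj₂ (proj₂ k) ∈ codes m

    ∈-chunks⁻ : ∀ {k} → k ∈ chunks → IsChunk k
    ∈-chunks⁻ q with ∈-cartesianProduct⁻ masks (cartesianProduct masks (codes m)) q
    ... | qP , q′ with ∈-cartesianProduct⁻ masks (codes m) q′
    ...   | qV , qc = isChunk (∈-masks⁻ qP) (∈-masks⁻ qV) qc

    record Room (k : ℕ) (T R : List ℕ) : Set where
      field
        desc    : Desc (T ++ R)
        lengthT : length T ≡ m
        enough  : k * l ≤ length R

    module Step {k P V cs T R} (room : Room (suc k) T R) (chunk : IsChunk (P , V , cs)) where
      open Room room
      open IsChunk chunk

      T′ R′ D W : List ℕ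
      T′ = keepF V R
      R′ = drop (length V) R
      D = keepT V R
      W = pick cs T

      descR : Desc R
      descR = AllPairs-⊆ (Sublist.++⁺ˡ T ⊆-refl) desc

      descT : Desc T
      descT = AllPairs-⊆ (Sublist.++⁺ʳ R ⊆-refl) desc

      V≤R : length V ≤ length R
      V≤R = ≤-trans (≤-reflexive (proj₁ maskV)) (≤-trans (m≤m+n l (k * l)) enough)

      length-cs : length cs ≡ length T
      length-cs = trans (codes-length m code) (sym lengthT)

      bounded : Bounded cs
      bounded = walk-bounded (proj₂ (codes-walk m code))

      W↭T : W ↭ T
      W↭T = pick-↭ T bounded length-cs

      lengthW : length W ≡ falses P
      lengthW = trans (↭-length W↭T) (trans lengthT (sym (proj₂ maskP)))

      lengthD : length D ≡ trues P
      lengthD = trans (length-keepT V R V≤R) (+-cancelʳ-≡ m (trues V) (trues P) (begin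
        trues V + m        ≡⟨ cong (trues V +_) (proj₂ maskV) ⟨
        trues V + falses V ≡⟨ trues+falses V ⟩
        length V           ≡⟨ trans (proj₁ maskV) (sym (proj₁ maskP)) ⟩
        length P           ≡⟨ trues+falses P ⟨
        trues P + falses P ≡⟨ cong (trues P +_) (proj₂ maskP) ⟩
        trues P + m        ∎))
        where open ≡-Reasoning

      next : Room k T′ R′
      next = record
        { desc = AllPairs-⊆ (keepF-drop-⊆ V R) descR
        ; lengthT = trans (length-keepF V R V≤R) (proj₂ maskV)
        ; enough = ≤-trans (≤-trans (≤-reflexive (sym (m+n∸m≡n l (k * l)))) (∸-monoˡ-≤ l enough))
                     (≤-reflexive (sym (trans (length-drop (length V) R) (cong (length R ∸_) (proj₁ maskV))))) }

      W≫R : W ≫ R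
      W≫R m m′ = desc-≫ T desc (∈-resp-↭ W↭T m) m′

      R′⊆R : R′ ⊆ R
      R′⊆R = Sublist.drop-⊆ (length V) R

    build-↭ : ∀ ds {T R} → All IsChunk ds → Room (length ds) T R → build ds T R ↭ T ++ R
    build-↭ []                  _       room = ↭-refl
    build-↭ ((P , V , cs) ∷ ds) {T} {R} (c ∷ a) room = ↭-trans
      (++⁺ (↭-trans (merge-↭ P lengthD lengthW) (++⁺ˡ D W↭T)) (build-↭ ds a next))
      (↭-trans (↭-reflexive (++-assoc D T (T′ ++ R′)))
        (↭-trans (shifts D T) (++⁺ˡ T (keep-↭ V R V≤R))))
      where
      open Step room c
      open import Data.List.Properties using (++-assoc)

    build-marked : ∀ ds {T R prev} → All IsChunk ds → Room (length ds) T R → prev ≫ R →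
                   Marked prev (build ds T R) (core ds T R)
    build-marked []                  {T} {R} _ room p = marked-all (T ++ R)
    build-marked ((P , V , cs) ∷ ds) {T} {R} {prev} (c ∷ a) room p =
      marked-merge P lengthD lengthW (λ m m′ → p m (lookup (keepT-⊆ V R) m′))
        (λ m m′ → W≫R m (lookup (keepT-⊆ V R) m′)) (AllPairs-⊆ (keepT-⊆ V R) descR)
        (λ g → build-marked ds a next (λ m m′ → after (g m) m′))
      where
      open Step room c
      after : ∀ {x y} → x ∈ prev ⊎ x ∈ D ⊎ x ∈ W → y ∈ R′ → y < x
      after (inj₁ m)        m′ = p m (lookup R′⊆R m′)
      after (inj₂ (inj₁ m)) m′ = desc-≫ D (AllPairs-⊆ (keepT-drop-⊆ V R) descR) m m′
      after (inj₂ (inj₂ m)) m′ = W≫R m (lookup R′⊆R m′)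

    core-∈ : ∀ ds {T R y} → All IsChunk ds → Room (length ds) T R → y ∈ core ds T R → y ∈ T ++ R
    core-∈ []                  _       room q = q
    core-∈ ((P , V , cs) ∷ ds) {T} {R} (c ∷ a) room q with ∈-++⁻ (pick cs T) q
    ... | inj₁ q′ = ∈-++⁺ˡ (∈-resp-↭ (Step.W↭T room c) q′)
    ... | inj₂ q′ = ∈-++⁺ʳ T (lookup (keepF-drop-⊆ V R) (core-∈ ds a (Step.next room c) q′))

    core-avoids : ∀ ds {T R} → All IsChunk ds → Room (length ds) T R → ¬ Has1342 (core ds T R)
    core-avoids []                  _       room = desc-avoids (Room.desc room)
    core-avoids ((P , V , cs) ∷ ds) {T} {R} (c ∷ a) room = skew-avoids W
      (λ m m′ → W≫R m (lookup (keepF-drop-⊆ V R) (core-∈ ds a next m′)))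
      (proj₂ (walk⇒avoids W (Unique-resp-↭ (↭-sym W↭T) (desc-unique descT))
        (subst (λ x → Walk x (proj₁ (codes-walk m (IsChunk.code c)))) (sym (lehmer-pick T bounded length-cs descT)) (proj₂ (codes-walk m (IsChunk.code c))))))
      (core-avoids ds a next)
      where
      open Step room c
      open Avoidance using (Walk)

    -- All chunks have equal length, so the first one can be cut off. The threshold between T and R
    -- then recovers its position mask and its two lists of values; these determine the value mask
    -- and, by `lehmer`, the code.
    build-injective : ∀ ds ds′ {T R} → All IsChunk ds → All IsChunk ds′ → length ds ≡ length ds′ →
                      Room (length ds) T R → build ds T R ≡ build ds′ T R → ds ≡ ds′
    build-injective [] [] _ _ _ _ _ = refl
    build-injective ((P , V , cs) ∷ ds) ((P′ , V′ , cs′) ∷ ds′) {T} {R} (c ∷ a) (c′ ∷ a′) e room eq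
      with ++-split (merge P (keepT V R) (pick cs T)) (merge P′ (keepT V′ R) (pick cs′ T)) same-length eq
      where
      module S₁ = Step room c
      module S₂ = Step room c′
      same-length : length (merge P (keepT V R) (pick cs T)) ≡ length (merge P′ (keepT V′ R) (pick cs′ T))
      same-length = trans (length-merge P S₁.lengthD S₁.lengthW)
        (trans (trans (proj₁ (IsChunk.maskP c)) (sym (proj₁ (IsChunk.maskP c′))))
               (sym (length-merge P′ S₂.lengthD S₂.lengthW)))
    ... | eq₁ , eq₂ with separator T (Room.desc room)
    ...   | β , below , over , _
      with merge-injective P P′ S₁.lengthD S₁.lengthW S₂.lengthD S₂.lengthW
             (Sublist.All-resp-⊆ (keepT-⊆ V R) below) (Sublist.All-resp-⊆ (keepT-⊆ V′ R) below)
             (All-resp-↭ (↭-sym S₁.W↭T) over) (All-resp-↭ (↭-sym S₂.W↭T) over) eq₁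
      where
      module S₁ = Step room c
      module S₂ = Step room c′
    ...     | refl , eqD , eqW
      with keepT-injective V V′ R (Step.descR room c) (Step.V≤R room c)
             (trans (proj₁ (IsChunk.maskV c)) (sym (proj₁ (IsChunk.maskV c′)))) eqD
         | trans (sym (lehmer-pick T S₁.bounded S₁.length-cs S₁.descT))
             (trans (cong lehmer eqW) (lehmer-pick T S₂.bounded S₂.length-cs S₂.descT))
      where
      module S₁ = Step room c
      module S₂ = Step room c′
    ...       | refl | refl = cong ((P , V , cs) ∷_)
      (build-injective ds ds′ a a′ (suc-injective e) (Step.next room c) eq₂)

    sequences : ℕ → List (List Chunk)
    sequences zero    = [] ∷ []
    sequences (suc t) = cartesianProductWith _∷_ chunks (sequences t)

    ∈-sequences⁻ : ∀ t {ds} → ds ∈ sequences t → length ds ≡ t × All IsChunk ds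
    ∈-sequences⁻ zero    (here refl) = refl , []
    ∈-sequences⁻ (suc t) q with ∈-cartesianProductWith⁻ _∷_ chunks (sequences t) q
    ... | k , ds , k∈ , ds∈ , refl with ∈-sequences⁻ t ds∈
    ...   | e , a = cong suc e , ∈-chunks⁻ k∈ ∷ a

    masks-unique : Unique masks
    masks-unique = filterᵇ-unique _ (boolWords-unique l)
      where
      boolWords-unique : ∀ n → Unique (boolWords n)
      boolWords-unique zero    = [] ∷ []
      boolWords-unique (suc n) = Unique.++⁺
        (Unique.map⁺ ∷-injectiveʳ (boolWords-unique n)) (Unique.map⁺ ∷-injectiveʳ (boolWords-unique n)) disjoint
        where
        disjoint : ∀ {V} → ¬ (V ∈ map (true ∷_) (boolWords n) × V ∈ map (false ∷_) (boolWords n))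
        disjoint (p , q) with ∈-map⁻ (true ∷_) p | ∈-map⁻ (false ∷_) q
        ... | _ , _ , refl | _ , _ , ()

    sequences-unique : ∀ t → Unique (sequences t)
    sequences-unique zero    = [] ∷ []
    sequences-unique (suc t) = Unique.cartesianProductWith⁺ _∷_ ∷-injective
      (Unique.cartesianProduct⁺ masks-unique (Unique.cartesianProduct⁺ masks-unique (codes-unique m)))
      (sequences-unique t)

    length-product : ∀ {C : Set} (f : A → B → C) xs ys → length (cartesianProductWith f xs ys) ≡ length xs * length ys
    length-product f []       ys = refl
    length-product f (x ∷ xs) ys =
      trans (length-++ (map (f x) ys)) (cong₂ _+_ (length-map (f x) ys) (length-product f xs ys))

    chunk-count : ℕ
    chunk-count = length masks * (length masks * h m)

    length-sequences : ∀ t → length (sequences t) ≡ chunk-count ^ t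
    length-sequences zero    = refl
    length-sequences (suc t) = trans (length-product _∷_ chunks (sequences t)) (cong₂ _*_
      (trans (length-product _,_ masks _) (cong (length masks *_)
        (trans (length-product _,_ masks (codes m)) (cong (length masks *_) (length-codes m)))))
      (length-sequences t))

    map-unique : (f : A → B) → ∀ {xs} → Unique xs → (∀ {x y} → x ∈ xs → y ∈ xs → f x ≡ f y → x ≡ y) → Unique (map f xs)
    map-unique f {[]}     []       inj = []
    map-unique f {x ∷ xs} (a ∷ un) inj = All.tabulate apart ∷ map-unique f un (λ p q → inj (there p) (there q))
      where
      apart : ∀ {y} → y ∈ map f xs → f x ≢ y
      apart q e with ∈-map⁻ f q
      ... | z , z∈ , refl = All.lookup a z∈ (inj (here refl) (there z∈) e)

    S-lower : ∀ t n → m + t * l ≤ n → chunk-count ^ t ≤ S q12453 n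
    S-lower t n le = begin
      chunk-count ^ t                   ≡⟨ length-sequences t ⟨
      length (sequences t)              ≡⟨ length-map f (sequences t) ⟨
      length (map f (sequences t))      ≤⟨ unique-length (map-unique f (sequences-unique t) inj) into ⟩
      S q12453 n                        ∎
      where
      open ≤-Reasoning
      Z T R : List ℕ
      Z = downFrom n
      -- The m largest values act as the remainder of a block before the first one.
      T = take m Z
      R = drop m Z
      TR : T ++ R ≡ Z
      TR = take++drop≡id m Z
      f : List Chunk → List ℕ
      f ds = build ds T R
      room : ∀ k → k ≡ t → Room k T R
      room k refl = record
        { desc = subst Desc (sym TR) (downFrom-desc n)
        ; lengthT = trans (length-take m Z) (m≤n⇒m⊓n≡m (≤-trans (≤-trans (m≤m+n m (t * l)) le) (≤-reflexive (sym (length-downFrom n)))))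
        ; enough = ≤-trans (≤-reflexive (sym (m+n∸m≡n m (t * l)))) (≤-trans (∸-monoˡ-≤ m le)
                     (≤-reflexive (sym (trans (length-drop m Z) (cong (_∸ m) (length-downFrom n)))))) }
      inj : ∀ {ds ds′} → ds ∈ sequences t → ds′ ∈ sequences t → f ds ≡ f ds′ → ds ≡ ds′
      inj {ds} {ds′} p q e with ∈-sequences⁻ t p | ∈-sequences⁻ t q
      ... | l₁ , a₁ | l₂ , a₂ = build-injective ds ds′ a₁ a₂ (trans l₁ (sym l₂)) (room _ l₁) e
      into : ∀ {p} → p ∈ map f (sequences t) → p ∈ avoiders n
      into q with ∈-map⁻ f q
      ... | ds , ds∈ , refl with ∈-sequences⁻ t ds∈
      ...   | e , a = ∈-avoiders n (↭-trans (build-↭ ds a (room _ e)) (↭-reflexive TR))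
                (marked-avoids (build-marked ds {prev = []} a (room _ e) (λ ())) (core-avoids ds a (room _ e)))

-- The limit, by comparison with rational numbers.

module Limit where

  open import Defs
  open Coefficients using (h; r; r-zero; r-suc-zero; r-suc; h-suc)
  open Growth using (module Asymptotics)
  open Decode using (trues; falses; trues+falses)
  open Upper using (boolWords; ∈-boolWords⁻; module Weights; ^-*-distrib; S-upper)
  open Lower using (module Chunks)
  open import Data.Bool.Base using (true; false; if_then_else_; T)
  open import Data.List.Base using (List; []; _∷_; map; length; filterᵇ)
  open import Data.List.Membership.Propositional using (_∈_)
  open import Data.List.Relation.Unary.Any using (here; there)
  open import Data.Nat.Base
  open import Data.Nat.DivMod using (_/_; _%_; m≡m%n+[m/n]*n; m%n<n; /-monoˡ-≤; m*n/n≡m)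
  open import Data.Nat.ListAction using (sum)
  open import Data.Nat.Properties
  open import Data.Nat.Tactic.RingSolver using (solve-∀)
  open import Data.Product.Base using (∃; ∃₂; _×_; _,_)
  open import Data.Sum.Base using (inj₁; inj₂)
  open import Function.Base using (_∘_)
  open import Relation.Binary.PropositionalEquality
  open import Relation.Nullary.Negation using (contradiction)

  open Asymptotics r h r-zero r-suc-zero r-suc refl h-suc using (h-upper; h-lower)

  sumTo : ℕ → (ℕ → ℕ) → ℕ
  sumTo zero    g = 0
  sumTo (suc N) g = sumTo N g + g N

  sumTo-+ : ∀ N f g → sumTo N (λ i → f i + g i) ≡ sumTo N f + sumTo N g
  sumTo-+ zero    f g = refl
  sumTo-+ (suc N) f g = trans (cong (_+ (f N + g N)) (sumTo-+ N f g)) (rearrange (sumTo N f) (sumTo N g) (f N) (g N))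
    where
    rearrange : ∀ a b c d → (a + b) + (c + d) ≡ (a + c) + (b + d)
    rearrange = solve-∀

  sumTo-cong : ∀ N {f g} → (∀ i → f i ≡ g i) → sumTo N f ≡ sumTo N g
  sumTo-cong zero    p = refl
  sumTo-cong (suc N) p = cong₂ _+_ (sumTo-cong N p) (p N)

  sumTo-term : ∀ N g i → i < N → g i ≤ sumTo N g
  sumTo-term (suc N) g i (s≤s l) with m≤n⇒m<n∨m≡n l
  ... | inj₁ l′   = ≤-trans (sumTo-term N g i l′) (m≤m+n _ (g N))
  ... | inj₂ refl = m≤n+m _ _

  sumTo-average : ∀ N g → ∃ λ i → i ≤ N × sumTo (suc N) g ≤ suc N * g i
  sumTo-average zero    g = 0 , z≤n , ≤-reflexive (sym (*-identityˡ (g 0)))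
  sumTo-average (suc N) g with sumTo-average N g
  ... | i , i≤N , p with ≤-total (g i) (g (suc N))
  ...   | inj₁ l = suc N , ≤-refl , ≤-trans (+-monoˡ-≤ (g (suc N)) (≤-trans p (*-monoʳ-≤ (suc N) l)))
                                      (≤-reflexive (+-comm _ (g (suc N))))
  ...   | inj₂ l = i , m≤n⇒m≤1+n i≤N , ≤-trans (+-mono-≤ p l) (≤-reflexive (+-comm _ (g i)))

  module _ {A : Set} (key weight : A → ℕ) where

    fibre : ℕ → List A → List A
    fibre i = filterᵇ (λ x → key x ≡ᵇ i)

    sum-fibres : ∀ N xs → (∀ {x} → x ∈ xs → key x < N) →
                 sum (map weight xs) ≤ sumTo N (λ i → sum (map weight (fibre i xs)))
    sum-fibres N []       k = z≤n
    sum-fibres N (x ∷ xs) k = begin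
      weight x + sum (map weight xs)
        ≤⟨ +-mono-≤ (≤-trans (≤-reflexive (sym (own (key x) refl))) (sumTo-term N single (key x) (k (here refl)))) (sum-fibres N xs (k ∘ there)) ⟩
      sumTo N single + sumTo N (λ i → sum (map weight (fibre i xs)))
        ≡⟨ sumTo-+ N single _ ⟨
      sumTo N (λ i → single i + sum (map weight (fibre i xs)))
        ≡⟨ sumTo-cong N step ⟨
      sumTo N (λ i → sum (map weight (fibre i (x ∷ xs)))) ∎
      where
      open ≤-Reasoning
      single : ℕ → ℕ
      single i = if key x ≡ᵇ i then weight x else 0
      own : ∀ i → key x ≡ i → single i ≡ weight x
      own i e with key x ≡ᵇ i in eq
      ... | true  = refl
      ... | false = contradiction (≡⇒≡ᵇ (key x) i e) (subst T eq)
      step : ∀ i → sum (map weight (fibre i (x ∷ xs))) ≡ single i + sum (map weight (fibre i xs))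
      step i with key x ≡ᵇ i
      ... | true  = refl
      ... | false = refl

    sum-constant : ∀ k xs → (∀ {x} → x ∈ xs → weight x ≡ k) → sum (map weight xs) ≡ length xs * k
    sum-constant k []       p = refl
    sum-constant k (x ∷ xs) p = cong₂ _+_ (p (here refl)) (sum-constant k xs (p ∘ there))

  module _ (c d : ℕ) where
    open Weights c d

    -- Of the l + 1 possible numbers of letters `false`, one carries at least the average share of
    -- the expansion of (c + d)^l.
    best-mask : ∀ l → ∃ λ m → m ≤ l × (c + d) ^ l ≤ suc l * (length (Chunks.masks l m) * (c ^ m * d ^ (l ∸ m)))
    best-mask l with sumTo-average l (λ i → sum (map weight (fibre falses weight i (boolWords l))))
    ... | m , m≤l , p = m , m≤l , (begin
      (c + d) ^ l                        ≡⟨ total-weight l ⟨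
      sum (map weight (boolWords l))     ≤⟨ sum-fibres falses weight (suc l) (boolWords l) (λ {V} q → s≤s (falses≤ V (∈-boolWords⁻ l q))) ⟩
      sumTo (suc l) (λ i → sum (map weight (fibre falses weight i (boolWords l)))) ≤⟨ p ⟩
      suc l * sum (map weight (Chunks.masks l m)) ≡⟨ cong (suc l *_) (sum-constant falses weight _ (Chunks.masks l m) value) ⟩
      suc l * (length (Chunks.masks l m) * (c ^ m * d ^ (l ∸ m))) ∎)
      where
      open ≤-Reasoning
      falses≤ : ∀ V → length V ≡ l → falses V ≤ l
      falses≤ V refl = ≤-trans (m≤n+m _ (trues V)) (≤-reflexive (trues+falses V))
      value : ∀ {V} → V ∈ Chunks.masks l m → weight V ≡ c ^ m * d ^ (l ∸ m)
      value {V} q with Chunks.∈-masks⁻ l m q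
      ... | refl , refl = cong (λ i → c ^ falses V * d ^ i)
        (trans (sym (m+n∸n≡m (trues V) (falses V))) (cong (_∸ falses V) (trues+falses V)))

    module _ (K : ℕ) (lower : ∀ n → (c * c) ^ n ≤ K * h n * (d * d) ^ n) where

      -- A chunk uses two masks, so the estimate of `best-mask` is squared; the resulting factor (c
      -- / d)^(2m) is at most K times the number of codes.
      chunk-lower : ∀ l → ∃ λ m → m ≤ l ×
        (c + d) ^ l * (c + d) ^ l ≤ suc l * suc l * K * Chunks.chunk-count l m * (d * d) ^ l
      chunk-lower l with best-mask l
      ... | m , m≤l , p = m , m≤l , (begin
        (c + d) ^ l * (c + d) ^ l
          ≤⟨ *-mono-≤ p p ⟩
        suc l * (B * (c ^ m * d ^ (l ∸ m))) * (suc l * (B * (c ^ m * d ^ (l ∸ m))))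
          ≡⟨ eq₁ (suc l) B (c ^ m) (d ^ (l ∸ m)) ⟩
        suc l * suc l * (B * B) * (c ^ m * c ^ m) * (d ^ (l ∸ m) * d ^ (l ∸ m))
          ≡⟨ cong (λ x → suc l * suc l * (B * B) * x * (d ^ (l ∸ m) * d ^ (l ∸ m))) (^-*-distrib c c m) ⟨
        suc l * suc l * (B * B) * (c * c) ^ m * (d ^ (l ∸ m) * d ^ (l ∸ m))
          ≤⟨ *-monoˡ-≤ (d ^ (l ∸ m) * d ^ (l ∸ m)) (*-monoʳ-≤ (suc l * suc l * (B * B)) (lower m)) ⟩
        suc l * suc l * (B * B) * (K * h m * (d * d) ^ m) * (d ^ (l ∸ m) * d ^ (l ∸ m))
          ≡⟨ cong (suc l * suc l * (B * B) * (K * h m * (d * d) ^ m) *_) (^-*-distrib d d (l ∸ m)) ⟨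
        suc l * suc l * (B * B) * (K * h m * (d * d) ^ m) * (d * d) ^ (l ∸ m)
          ≡⟨ eq₂ (suc l) B K (h m) ((d * d) ^ m) ((d * d) ^ (l ∸ m)) ⟩
        suc l * suc l * K * (B * (B * h m)) * ((d * d) ^ m * (d * d) ^ (l ∸ m))
          ≡⟨ cong (suc l * suc l * K * (B * (B * h m)) *_) (trans (sym (^-distribˡ-+-* (d * d) m (l ∸ m))) (cong ((d * d) ^_) (m+[n∸m]≡n m≤l))) ⟩
        suc l * suc l * K * Chunks.chunk-count l m * (d * d) ^ l ∎)
        where
        open ≤-Reasoning
        B : ℕ
        B = length (Chunks.masks l m)
        eq₁ : ∀ s B x y → s * (B * (x * y)) * (s * (B * (x * y))) ≡ s * s * (B * B) * (x * x) * (y * y)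
        eq₁ = solve-∀
        eq₂ : ∀ s B K x y z → s * s * (B * B) * (K * x * y) * z ≡ s * s * K * (B * (B * x)) * (y * z)
        eq₂ = solve-∀

  -- This is 1 + n / X ≤ (1 + 1 / X)^n without denominators.
  bernoulli : ∀ X n → (X + n) * X ^ n ≤ X * suc X ^ n
  bernoulli X zero    = ≤-reflexive (cong (_* 1) (+-identityʳ X))
  bernoulli X (suc n) = begin
    (X + suc n) * (X * X ^ n)             ≡⟨ eq₁ X n (X ^ n) ⟩
    X * ((X + n) * X ^ n) + X * X ^ n     ≤⟨ +-monoʳ-≤ (X * ((X + n) * X ^ n)) (*-monoˡ-≤ (X ^ n) (m≤m+n X n)) ⟩
    X * ((X + n) * X ^ n) + (X + n) * X ^ n ≡⟨ eq₂ X ((X + n) * X ^ n) ⟩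
    suc X * ((X + n) * X ^ n)             ≤⟨ *-monoʳ-≤ (suc X) (bernoulli X n) ⟩
    suc X * (X * suc X ^ n)               ≡⟨ eq₃ X (suc X ^ n) ⟩
    X * suc X ^ suc n                     ∎
    where
    open ≤-Reasoning
    eq₁ : ∀ X n p → (X + (1 + n)) * (X * p) ≡ X * ((X + n) * p) + X * p
    eq₁ = solve-∀
    eq₂ : ∀ X q → X * q + q ≡ (1 + X) * q
    eq₂ = solve-∀
    eq₃ : ∀ X q → (1 + X) * (X * q) ≡ X * ((1 + X) * q)
    eq₃ = solve-∀

  power-gap : ∀ k X Y n → 1 ≤ X → X < Y → k * X ≤ n + X → k * X ^ n ≤ Y ^ n
  power-gap k X Y n 1≤X X<Y l = *-cancelˡ-≤ X {{>-nonZero 1≤X}} (begin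
    X * (k * X ^ n)      ≡⟨ eq X k (X ^ n) ⟩
    k * X * X ^ n        ≤⟨ *-monoˡ-≤ (X ^ n) (≤-trans l (≤-reflexive (+-comm n X))) ⟩
    (X + n) * X ^ n      ≤⟨ bernoulli X n ⟩
    X * suc X ^ n        ≤⟨ *-monoʳ-≤ X (^-monoˡ-≤ n X<Y) ⟩
    X * Y ^ n            ∎)
    where
    open ≤-Reasoning
    eq : ∀ X k p → X * (k * p) ≡ k * X * p
    eq = solve-∀

  ^-*-cube : ∀ Y j → Y ^ (j + (j + j)) ≡ Y ^ j * (Y ^ j * Y ^ j)
  ^-*-cube Y j = trans (^-distribˡ-+-* Y j (j + j)) (cong (Y ^ j *_) (^-distribˡ-+-* Y j j))

  -- Bernoulli's inequality for each third of the exponent gives a cubic gain.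
  beat-quadratic : ∀ Q X Y → 1 ≤ Y → Y < X → ∃ λ l → 1 ≤ l × Q * (suc l * suc l) * Y ^ l ≤ X ^ l
  beat-quadratic Q X Y 1≤Y Y<X = l , ≤-trans 1≤j (m≤m+n j _) , *-cancelˡ-≤ (Y * (Y * Y)) {{>-nonZero (*-mono-≤ 1≤Y (*-mono-≤ 1≤Y 1≤Y))}} (begin
    Y * (Y * Y) * (Q * (suc l * suc l) * Y ^ l)
      ≤⟨ *-monoʳ-≤ (Y * (Y * Y)) (*-monoˡ-≤ (Y ^ l) (*-monoʳ-≤ Q (*-mono-≤ l≤ l≤))) ⟩
    Y * (Y * Y) * (Q * (4 * j * (4 * j)) * Y ^ l)
      ≡⟨ eq₁ Y Q j (Y ^ l) ⟩
    16 * Q * (Y * (Y * Y)) * (j * j) * Y ^ l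
      ≤⟨ *-monoˡ-≤ (Y ^ l) (*-mono-≤ (n≤1+n (16 * Q * (Y * (Y * Y)))) ≤-refl) ⟩
    j * (j * j) * Y ^ l
      ≡⟨ trans (cong (j * (j * j) *_) (^-*-cube Y j)) (eq₂ j (Y ^ j)) ⟩
    j * Y ^ j * (j * Y ^ j * (j * Y ^ j))
      ≤⟨ *-mono-≤ part (*-mono-≤ part part) ⟩
    Y * X ^ j * (Y * X ^ j * (Y * X ^ j))
      ≡⟨ trans (eq₃ Y (X ^ j)) (cong (Y * (Y * Y) *_) (sym (^-*-cube X j))) ⟩
    Y * (Y * Y) * X ^ l ∎)
    where
    open ≤-Reasoning
    j l : ℕ
    -- Exceeds the constant that is left over from (l + 1)² ≤ (4 j)² and the three factors Y of
    -- Bernoulli's inequality.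
    j = suc (16 * Q * (Y * (Y * Y)))
    l = j + (j + j)
    1≤j : 1 ≤ j
    1≤j = s≤s z≤n
    l≤ : suc l ≤ 4 * j
    l≤ = ≤-trans (+-monoˡ-≤ l 1≤j) (≤-reflexive (eq j))
      where
      eq : ∀ j → j + (j + (j + j)) ≡ 4 * j
      eq = solve-∀
    part : j * Y ^ j ≤ Y * X ^ j
    part = ≤-trans (*-monoˡ-≤ (Y ^ j) (m≤n+m j Y)) (≤-trans (bernoulli Y j) (*-monoʳ-≤ Y (^-monoˡ-≤ j Y<X)))
    eq₁ : ∀ Y Q j p → Y * (Y * Y) * (Q * (4 * j * (4 * j)) * p) ≡ 16 * Q * (Y * (Y * Y)) * (j * j) * p
    eq₁ = solve-∀
    eq₂ : ∀ j p → j * (j * j) * (p * (p * p)) ≡ j * p * (j * p * (j * p))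
    eq₂ = solve-∀
    eq₃ : ∀ Y p → Y * p * (Y * p * (Y * p)) ≡ Y * (Y * Y) * (p * (p * p))
    eq₃ = solve-∀

  n≤2^n : ∀ n → n ≤ 2 ^ n
  n≤2^n zero    = z≤n
  n≤2^n (suc n) = ≤-trans (+-mono-≤ (m^n>0 2 n) (n≤2^n n)) (≤-reflexive (cong (2 ^ n +_) (sym (+-identityʳ (2 ^ n)))))

  upper-bound : ∀ (s : ℕ → ℕ) a b c d → 1 ≤ b → 1 ≤ c → 1 ≤ d →
                (∀ n → s n * (d ^ n * d ^ n) ≤ 2 * ((c + d) ^ n * (c + d) ^ n)) → (c + d) * (c + d) * b < a * (d * d) →
                ∃ λ N → ∀ n → N ≤ n → s n * b ^ n ≤ a ^ n
  upper-bound s a b c d 1≤b 1≤c 1≤d estimate gap = 2 * X , bound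
    where
    X Y : ℕ
    X = (c + d) * (c + d) * b
    Y = a * (d * d)
    1≤X : 1 ≤ X
    1≤X = *-mono-≤ (*-mono-≤ (≤-trans 1≤c (m≤m+n c d)) (≤-trans 1≤c (m≤m+n c d))) 1≤b
    bound : ∀ n → 2 * X ≤ n → s n * b ^ n ≤ a ^ n
    bound n l = *-cancelʳ-≤ (s n * b ^ n) (a ^ n) ((d * d) ^ n) {{m^n≢0 (d * d) n {{>-nonZero (*-mono-≤ 1≤d 1≤d)}}}} (begin
      s n * b ^ n * (d * d) ^ n          ≡⟨ cong (s n * b ^ n *_) (^-*-distrib d d n) ⟩
      s n * b ^ n * (d ^ n * d ^ n)      ≡⟨ eq₁ (s n) (b ^ n) (d ^ n * d ^ n) ⟩
      s n * (d ^ n * d ^ n) * b ^ n      ≤⟨ *-monoˡ-≤ (b ^ n) (estimate n) ⟩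
      2 * ((c + d) ^ n * (c + d) ^ n) * b ^ n   ≡⟨ cong (λ x → 2 * x * b ^ n) (^-*-distrib (c + d) (c + d) n) ⟨
      2 * ((c + d) * (c + d)) ^ n * b ^ n       ≡⟨ trans (*-assoc 2 (((c + d) * (c + d)) ^ n) (b ^ n)) (cong (2 *_) (sym (^-*-distrib ((c + d) * (c + d)) b n))) ⟩
      2 * X ^ n                                 ≤⟨ power-gap 2 X Y n 1≤X gap (≤-trans l (m≤m+n n X)) ⟩
      Y ^ n                                     ≡⟨ ^-*-distrib a (d * d) n ⟩
      a ^ n * (d * d) ^ n                       ∎)
      where
      open ≤-Reasoning
      eq₁ : ∀ x y z → x * y * z ≡ x * z * y
      eq₁ = solve-∀

  ^-*-swap : ∀ x t l → x ^ (t * l) ≡ (x ^ l) ^ t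
  ^-*-swap x t l = trans (cong (x ^_) (*-comm t l)) (sym (^-*-assoc x l t))

  divide : ∀ o l T → 1 ≤ l → T * l ≤ o → ∃₂ λ e t → o ≡ e + t * l × e ≤ l × T ≤ t
  divide o l@(suc _) T 1≤l le = o % l , o / l , m≡m%n+[m/n]*n o l , <⇒≤ (m%n<n o l)
                              , ≤-trans (≤-reflexive (sym (m*n/n≡m T l))) (/-monoˡ-≤ l le)

  -- Write n = m + e + t l with e ≤ l. The surplus factor 2 per block pays for the m + e entries
  -- outside the t blocks, since 2^t ≥ t ≥ a^(2l).
  power-chain : ∀ (s : ℕ → ℕ) F a b l m → 1 ≤ a → 1 ≤ b → 1 ≤ l → m ≤ l → 2 * a ^ l ≤ F * b ^ l →
                (∀ t n → m + t * l ≤ n → F ^ t ≤ s n) →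
                ∀ n → m + a ^ (l + l) * l ≤ n → a ^ n ≤ s n * b ^ n
  power-chain s F a b l m 1≤a 1≤b 1≤l m≤l doubled powers n le
    with m≤n⇒∃[o]m+o≡n (≤-trans (m≤m+n m (a ^ (l + l) * l)) le)
  ... | o , refl with divide o l (a ^ (l + l)) 1≤l (+-cancelˡ-≤ m (a ^ (l + l) * l) o le)
  ...   | e , t , refl , e≤l , t≥ = begin
    a ^ (m + (e + t * l))               ≡⟨ cong (a ^_) (sym (+-assoc m e (t * l))) ⟩
    a ^ (m + e + t * l)                 ≡⟨ ^-distribˡ-+-* a (m + e) (t * l) ⟩
    a ^ (m + e) * a ^ (t * l)           ≡⟨ cong (a ^ (m + e) *_) (^-*-swap a t l) ⟩
    a ^ (m + e) * (a ^ l) ^ t           ≤⟨ *-monoˡ-≤ ((a ^ l) ^ t) (≤-trans (^-monoʳ-≤ a {{>-nonZero 1≤a}} (+-mono-≤ m≤l e≤l)) (≤-trans t≥ (n≤2^n t))) ⟩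
    2 ^ t * (a ^ l) ^ t                 ≡⟨ ^-*-distrib 2 (a ^ l) t ⟨
    (2 * a ^ l) ^ t                     ≤⟨ ^-monoˡ-≤ t doubled ⟩
    (F * b ^ l) ^ t                     ≡⟨ ^-*-distrib F (b ^ l) t ⟩
    F ^ t * (b ^ l) ^ t                 ≡⟨ cong (F ^ t *_) (^-*-swap b t l) ⟨
    F ^ t * b ^ (t * l)                 ≤⟨ *-mono-≤ (powers t (m + (e + t * l)) (+-monoʳ-≤ m (m≤n+m (t * l) e)))
                                             (^-monoʳ-≤ b {{>-nonZero 1≤b}} (≤-trans (m≤n+m (t * l) e) (m≤n+m (e + t * l) m))) ⟩
    s (m + (e + t * l)) * b ^ (m + (e + t * l)) ∎
    where open ≤-Reasoning

  cancel-chunk : ∀ σ K F x y z u → 1 ≤ σ → 1 ≤ K → 1 ≤ x →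
                 2 * K * σ * (y * x) ≤ u * z → u ≤ σ * K * F * x → 2 * y ≤ F * z
  cancel-chunk σ K F x y z u 1≤σ 1≤K 1≤x p q =
    *-cancelˡ-≤ (σ * K * x) {{>-nonZero (*-mono-≤ (*-mono-≤ 1≤σ 1≤K) 1≤x)}} (begin
      σ * K * x * (2 * y)     ≡⟨ eq₁ σ K x y ⟩
      2 * K * σ * (y * x)     ≤⟨ p ⟩
      u * z                   ≤⟨ *-monoˡ-≤ z q ⟩
      σ * K * F * x * z       ≡⟨ eq₂ (σ * K) F x z ⟩
      σ * K * x * (F * z)     ∎)
    where
    open ≤-Reasoning
    eq₁ : ∀ s k x y → s * k * x * (2 * y) ≡ 2 * k * s * (y * x)
    eq₁ = solve-∀
    eq₂ : ∀ s F x z → s * F * x * z ≡ s * x * (F * z)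
    eq₂ = solve-∀

  lower-bound : ∀ (s : ℕ → ℕ) K a b c d → 1 ≤ K → 1 ≤ a → 1 ≤ b → 1 ≤ d →
                (∀ l → ∃₂ λ m F → m ≤ l × (c + d) ^ l * (c + d) ^ l ≤ suc l * suc l * K * F * (d * d) ^ l
                                        × (∀ t n → m + t * l ≤ n → F ^ t ≤ s n)) →
                a * (d * d) < (c + d) * (c + d) * b →
                ∃ λ N → ∀ n → N ≤ n → a ^ n ≤ s n * b ^ n
  lower-bound s K a b c d 1≤K 1≤a 1≤b 1≤d estimate gap =
    -- Besides the constant K, the surplus 2 required by `power-chain` is gained here.
    from (beat-quadratic (2 * K) ((c + d) * (c + d) * b) (a * (d * d)) (*-mono-≤ 1≤a (*-mono-≤ 1≤d 1≤d)) gap)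
    where
    from : ∃ (λ l → 1 ≤ l × 2 * K * (suc l * suc l) * (a * (d * d)) ^ l ≤ ((c + d) * (c + d) * b) ^ l) →
           ∃ λ N → ∀ n → N ≤ n → a ^ n ≤ s n * b ^ n
    from (l , 1≤l , beats) with estimate l
    ... | m , F , m≤l , chunk , powers = m + a ^ (l + l) * l , power-chain s F a b l m 1≤a 1≤b 1≤l m≤l
      (cancel-chunk (suc l * suc l) K F ((d * d) ^ l) (a ^ l) (b ^ l) ((c + d) ^ l * (c + d) ^ l)
        (s≤s z≤n) 1≤K (m^n>0 (d * d) {{>-nonZero (*-mono-≤ 1≤d 1≤d)}} l)
        (subst₂ (λ x y → 2 * K * (suc l * suc l) * x ≤ y) (^-*-distrib a (d * d) l)
          (trans (^-*-distrib ((c + d) * (c + d)) b l) (cong (_* b ^ l) (^-*-distrib (c + d) (c + d) l))) beats)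
        chunk)
      powers

  -- With e = a - 9b, the ratio c / d is the image of e / 2b under y ↦ (3y + 8) / (y + 3), which fixes √8;
  -- it lies on the same side of √8, and (1 + c / d)² lies between a / b and (1 + √8)².
  module _ (b e : ℕ) where

    private
      c d : ℕ
      c = 3 * e + 16 * b
      d = e + 6 * b

    square-gap : c * c + 32 * (b * b) ≡ 8 * (d * d) + e * e
    square-gap = eq b e
      where
      eq : ∀ b e → (3 * e + 16 * b) * (3 * e + 16 * b) + 32 * (b * b) ≡ 8 * ((e + 6 * b) * (e + 6 * b)) + e * e
      eq = solve-∀

    cubic-gap : (9 * b + e) * (d * d) + (e + 5 * b) * (32 * (b * b)) ≡ (c + d) * (c + d) * b + (e + 5 * b) * (e * e)
    cubic-gap = eq b e
      where
      eq : ∀ b e → (9 * b + e) * ((e + 6 * b) * (e + 6 * b)) + (e + 5 * b) * (32 * (b * b))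
                 ≡ (3 * e + 16 * b + (e + 6 * b)) * (3 * e + 16 * b + (e + 6 * b)) * b + (e + 5 * b) * (e * e)
      eq = solve-∀

    private
      compare-sums : ∀ {w x y z} → w + x ≡ y + z → z < x → w < y
      compare-sums {w} {x} {y} {z} eq z<x = +-cancelʳ-< x w y (≤-<-trans (≤-reflexive eq) (+-monoʳ-< y z<x))

    module _ (1≤b : 1 ≤ b) where

      private
        5b≢0 : NonZero (e + 5 * b)
        5b≢0 = >-nonZero (≤-trans (*-mono-≤ {1} {5} (s≤s z≤n) 1≤b) (m≤n+m _ e))

      1≤c : 1 ≤ c
      1≤c = ≤-trans (*-mono-≤ {1} {16} (s≤s z≤n) 1≤b) (m≤n+m _ (3 * e))

      1≤d : 1 ≤ d
      1≤d = ≤-trans (*-mono-≤ {1} {6} (s≤s z≤n) 1≤b) (m≤n+m _ e)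

      above-gap : 32 * (b * b) < e * e → (c + d) * (c + d) * b < (9 * b + e) * (d * d)
      above-gap l = compare-sums (sym cubic-gap) (*-monoʳ-< (e + 5 * b) {{5b≢0}} l)

      above-square : 32 * (b * b) < e * e → 8 * (d * d) ≤ c * c
      above-square l = <⇒≤ (compare-sums (sym square-gap) l)

      below-gap : e * e < 32 * (b * b) → (9 * b + e) * (d * d) < (c + d) * (c + d) * b
      below-gap l = compare-sums cubic-gap (*-monoʳ-< (e + 5 * b) {{5b≢0}} l)

      below-square : e * e < 32 * (b * b) → c * c < 8 * (d * d)
      below-square l = compare-sums square-gap l

  BelowL-excess : ∀ a b → 1 ≤ b → BelowL a b → (a ∸ 9 * b) * (a ∸ 9 * b) < 32 * (b * b)
  BelowL-excess a b 1≤b (inj₂ l) = l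
  -- Below 9 b the truncated difference is 0, and the claim becomes 0 < 32 b².
  BelowL-excess a b 1≤b (inj₁ l) rewrite m≤n⇒m∸n≡0 (<⇒≤ l) = *-mono-≤ {1} {32} (s≤s z≤n) (*-mono-≤ 1≤b 1≤b)

  S-below : ∀ a b → 1 ≤ a → 1 ≤ b → BelowL a b → ∃ λ N → ∀ n → N ≤ n → a ^ n ≤ S q12453 n * b ^ n
  S-below a b 1≤a 1≤b below = from (h-lower (c * c) (d * d) (*-mono-≤ (1≤c b e 1≤b) (1≤c b e 1≤b))
      (*-mono-≤ (1≤d b e 1≤b) (1≤d b e 1≤b)) (below-square b e 1≤b small))
    where
    e c d : ℕ
    e = a ∸ 9 * b
    c = 3 * e + 16 * b
    d = e + 6 * b
    small : e * e < 32 * (b * b)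
    small = BelowL-excess a b 1≤b below
    from : (∃ λ K → ∀ n → (c * c) ^ n ≤ K * h n * (d * d) ^ n) → ∃ λ N → ∀ n → N ≤ n → a ^ n ≤ S q12453 n * b ^ n
    from (K , lower) = lower-bound (S q12453) K a b c d
      -- At n = 0 the estimate reads 1 ≤ K, as `h 0` is 1.
      (≤-trans (lower 0) (≤-reflexive (trans (*-identityʳ (K * 1)) (*-identityʳ K)))) 1≤a 1≤b (1≤d b e 1≤b)
      (λ l → let m , m≤l , chunk = chunk-lower c d K lower l in
             m , Chunks.chunk-count l m , m≤l , chunk , Chunks.S-lower l m)
      -- For a < 9 b, where e = 0, the inequality is proved for 9 b in place of a, which is
      -- stronger.
      (≤-<-trans (*-monoˡ-≤ (d * d) (m≤n+m∸n a (9 * b))) (below-gap b e 1≤b small))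

  S-above : ∀ a b → 1 ≤ b → AboveL a b → ∃ λ N → ∀ n → N ≤ n → S q12453 n * b ^ n ≤ a ^ n
  S-above a b 1≤b (9b<a , large) = upper-bound (S q12453) a b c d 1≤b (1≤c b e 1≤b) (1≤d b e 1≤b)
      (S-upper h-upper c d (above-square b e 1≤b large))
      (subst (λ x → (c + d) * (c + d) * b < x * (d * d)) (m+[n∸m]≡n (<⇒≤ 9b<a)) (above-gap b e 1≤b large))
    where
    e c d : ℕ
    e = a ∸ 9 * b
    c = 3 * e + 16 * b
    d = e + 6 * b

open import Data.Product.Base using (_,_)

theorem4p1 : NthRootLimitIs9+4√2 (S q12453)
theorem4p1 = Limit.S-below , Limit.S-above
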